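{- Given a set $X\subset\mathbb{R}^d$ of $n$ points, let $S^*$ be the optimal solution to the constrained $k$-means problem, namely, $S^*$ minimizes $f(S)=\sum_{x\in X}\min_{x'\in S}\|x-x'\|^2$ over sets $S\subset X$ subject to $|S|\le k$. For $\varepsilon>0$, one can find in $O(n^2dk\log(1/\varepsilon))$ time a set $S$ of size $|S|=O(k)+k\log(1/\varepsilon)$ such that $f(S)\le(1+\varepsilon)f(S^*)$.
   Context: $\|\cdot\|$ is the Euclidean norm on $\mathbb{R}^d$. In the constrained $k$-means problem the centers must be chosen among the data points, i.e. $S$ is a subset (not necessarily proper) of $X$.
   Formalization: For large ε, log(1/ε) is zero or negative and the bounds fail as written, so log(1/ε) is read as max(1, log(1/ε)) in the running time and as max(0, log(1/ε)) in the size bound; for ε ≤ 1/e both are log(1/ε). -}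

module Defs where

open import Algebra.Bundles using (CommutativeRing; Semiring)
open import Algebra.Structures using (IsCommutativeRing)
open import Data.Bool.Base using (Bool; true; false; if_then_else_; _∧_; not)
open import Data.Fin.Base using (Fin; fromℕ<; toℕ)
open import Data.Fin.Subset using (Subset; Nonempty; ∣_∣)
open import Data.Fin.Subset.Properties using (_∈?_)
open import Data.List.Base using (filter; map; allFin)
open import Data.Nat.Base as ℕ using (ℕ; suc; _≡ᵇ_; _≤ᵇ_)
open import Data.Nat.Properties using (_<?_)
open import Data.Product.Base using (∃; ∃-syntax; _×_; _,_)
open import Data.Vec.Base using (tabulate)
open import Level using (0ℓ)
open import Relation.Binary.Bundles using (DecTotalOrder; TotalOrder)
open import Relation.Binary.Core using (Rel)
open import Relation.Binary.PropositionalEquality.Core using (_≡_; _≢_)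
open import Relation.Binary.Structures using (IsDecTotalOrder)
open import Relation.Nullary.Decidable.Core using (yes; no; does)
import Algebra.Construct.NaturalChoice.Max as Max
import Algebra.Definitions.RawSemiring as RawSemiringDefs
import Data.List.Extrema as Extrema
import Relation.Binary.Construct.NonStrictToStrict as Strict

-- ℝ as a Dedekind-complete ordered field.  This determines ℝ up to unique
-- isomorphism; decidability of the order makes it the classical ℝ.  The value
-- of 0# ⁻¹ is unspecified.
record Reals : Set₁ where
  infix  8 -_
  infix  9 _⁻¹
  infixl 7 _*_
  infixl 6 _+_
  infix  4 _≤_
  field
    ℝ   : Set
    _≤_ : Rel ℝ 0ℓ
    _+_ : ℝ → ℝ → ℝ
    _*_ : ℝ → ℝ → ℝ
    -_  : ℝ → ℝ
    _⁻¹ : ℝ → ℝ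
    0#  : ℝ
    1#  : ℝ

  open Strict _≡_ _≤_ public using () renaming (_<_ to infix 4 _<_)

  -- The positive form of "least upper bound", classically the usual one.
  IsSup : (ℝ → Set) → ℝ → Set
  IsSup P s = (∀ p → P p → p ≤ s) × (∀ y → y < s → ∃[ p ] (P p × y < p))

  field
    isCommutativeRing : IsCommutativeRing _≡_ _+_ _*_ -_ 0# 1#
    0≢1               : 0# ≢ 1#
    *-inverseʳ        : ∀ x → x ≢ 0# → x * x ⁻¹ ≡ 1#
    isDecTotalOrder   : IsDecTotalOrder _≡_ _≤_
    +-monoˡ-≤         : ∀ z {x y} → x ≤ y → x + z ≤ y + z
    *-nonneg          : ∀ {x y} → 0# ≤ x → 0# ≤ y → 0# ≤ x * y
    complete          : ∀ (P : ℝ → Set) → ∃ P →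
                        ∃[ b ] (∀ p → P p → p ≤ b) → ∃ (IsSup P)

  commutativeRing : CommutativeRing 0ℓ 0ℓ
  commutativeRing = record { isCommutativeRing = isCommutativeRing }

  decTotalOrder : DecTotalOrder 0ℓ 0ℓ 0ℓ
  decTotalOrder = record { isDecTotalOrder = isDecTotalOrder }

  totalOrder : TotalOrder 0ℓ 0ℓ 0ℓ
  totalOrder = DecTotalOrder.totalOrder decTotalOrder

  open IsDecTotalOrder isDecTotalOrder public using (_≤?_)
  open Max totalOrder public using (_⊔_)
  open Extrema totalOrder public using (min)
  open RawSemiringDefs
    (Semiring.rawSemiring (CommutativeRing.semiring commutativeRing)) public
    using (sum; _^_)
    renaming (_×_ to _times_)

  fromℕ : ℕ → ℝ
  fromℕ m = m times 1#

  infix 4 _⟶_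

  _⟶_ : (ℕ → ℝ) → ℝ → Set
  u ⟶ L = ∀ δ → 0# < δ →
    ∃[ N ] (∀ m → N ℕ.≤ m → (u m + - L) ⊔ (- (u m + - L)) ≤ δ)

  -- ℓ is the natural logarithm of y, with exp ℓ = lim (1 + ℓ/m)ᵐ; for y > 0
  -- there is exactly one such ℓ.
  IsLog : ℝ → ℝ → Set
  IsLog y ℓ = (λ m → (1# + ℓ * fromℕ (suc m) ⁻¹) ^ suc m) ⟶ y

-- Programs of a real RAM: while-programs over integer arrays and real arrays.
-- Arrays are named by numerals in the program text and have two indices; a
-- scalar variable is the cell (0 , 0) of an array.  Integers support only
-- addition and truncated subtraction, reals only field operations and
-- comparison (no rounding), so that unit cost is not abused.

data NatExp : Set where
  lit     : ℕ → NatExp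
  cell    : (a : ℕ) (i j : NatExp) → NatExp
  _⊕_ _⊖_ : NatExp → NatExp → NatExp

data RealExp : Set where
  lit             : ℕ → RealExp
  cell            : (a : ℕ) (i j : NatExp) → RealExp
  _⊕_ _⊖_ _⊗_ _⊘_ : RealExp → RealExp → RealExp

data Test : Set where
  _≤ᴺ_ : NatExp → NatExp → Test
  _≤ᴿ_ : RealExp → RealExp → Test
  neg  : Test → Test

infixr 5 _⨾_

data Program : Set where
  skip       : Program
  setNat     : (a : ℕ) (i j : NatExp) → NatExp → Program
  setReal    : (a : ℕ) (i j : NatExp) → RealExp → Program
  _⨾_        : Program → Program → Program
  ifThenElse : Test → Program → Program → Program
  while      : Test → Program → Program

-- The cost of evaluating an expression is its number of nodes: every constant,
-- memory access, arithmetic operation and comparison costs 1.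

costᴺ : NatExp → ℕ
costᴺ (lit _)      = 1
costᴺ (cell _ i j) = 1 ℕ.+ costᴺ i ℕ.+ costᴺ j
costᴺ (e ⊕ e′)     = 1 ℕ.+ costᴺ e ℕ.+ costᴺ e′
costᴺ (e ⊖ e′)     = 1 ℕ.+ costᴺ e ℕ.+ costᴺ e′

costᴿ : RealExp → ℕ
costᴿ (lit _)      = 1
costᴿ (cell _ i j) = 1 ℕ.+ costᴺ i ℕ.+ costᴺ j
costᴿ (e ⊕ e′)     = 1 ℕ.+ costᴿ e ℕ.+ costᴿ e′
costᴿ (e ⊖ e′)     = 1 ℕ.+ costᴿ e ℕ.+ costᴿ e′
costᴿ (e ⊗ e′)     = 1 ℕ.+ costᴿ e ℕ.+ costᴿ e′
costᴿ (e ⊘ e′)     = 1 ℕ.+ costᴿ e ℕ.+ costᴿ e′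

costᵀ : Test → ℕ
costᵀ (e ≤ᴺ e′) = 1 ℕ.+ costᴺ e ℕ.+ costᴺ e′
costᵀ (e ≤ᴿ e′) = 1 ℕ.+ costᴿ e ℕ.+ costᴿ e′
costᵀ (neg b)   = 1 ℕ.+ costᵀ b

Memory : Set → Set
Memory A = ℕ → ℕ → ℕ → A

write : {A : Set} → Memory A → ℕ → ℕ → ℕ → A → Memory A
write μ a i j v a′ i′ j′ =
  if (a ≡ᵇ a′) ∧ (i ≡ᵇ i′) ∧ (j ≡ᵇ j′) then v else μ a′ i′ j′

module RealRAM (R : Reals) where
  open Reals R

  record State : Set where
    constructor state
    field
      nats  : Memory ℕ
      reals : Memory ℝ
  open State public

  evalᴺ : State → NatExp → ℕ
  evalᴺ σ (lit c)      = c
  evalᴺ σ (cell a i j) = nats σ a (evalᴺ σ i) (evalᴺ σ j)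
  evalᴺ σ (e ⊕ e′)     = evalᴺ σ e ℕ.+ evalᴺ σ e′
  evalᴺ σ (e ⊖ e′)     = evalᴺ σ e ℕ.∸ evalᴺ σ e′

  evalᴿ : State → RealExp → ℝ
  evalᴿ σ (lit c)      = fromℕ c
  evalᴿ σ (cell a i j) = reals σ a (evalᴺ σ i) (evalᴺ σ j)
  evalᴿ σ (e ⊕ e′)     = evalᴿ σ e + evalᴿ σ e′
  evalᴿ σ (e ⊖ e′)     = evalᴿ σ e + - evalᴿ σ e′
  evalᴿ σ (e ⊗ e′)     = evalᴿ σ e * evalᴿ σ e′
  evalᴿ σ (e ⊘ e′)     = evalᴿ σ e * evalᴿ σ e′ ⁻¹

  evalᵀ : State → Test → Bool
  evalᵀ σ (e ≤ᴺ e′) = evalᴺ σ e ≤ᵇ evalᴺ σ e′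
  evalᵀ σ (e ≤ᴿ e′) = does (evalᴿ σ e ≤? evalᴿ σ e′)
  evalᵀ σ (neg b)   = not (evalᵀ σ b)

  infix 4 ⟨_,_⟩⇓⟨_,_⟩

  -- ⟨ p , σ ⟩⇓⟨ τ , t ⟩: started in σ, p halts in τ after t steps.
  data ⟨_,_⟩⇓⟨_,_⟩ : Program → State → State → ℕ → Set where
    ⇓skip : ∀ {σ} → ⟨ skip , σ ⟩⇓⟨ σ , 1 ⟩

    ⇓setNat : ∀ {σ a i j e} →
      ⟨ setNat a i j e , σ ⟩⇓⟨
        state (write (nats σ) a (evalᴺ σ i) (evalᴺ σ j) (evalᴺ σ e)) (reals σ)
        , 1 ℕ.+ costᴺ i ℕ.+ costᴺ j ℕ.+ costᴺ e ⟩

    ⇓setReal : ∀ {σ a i j e} →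
      ⟨ setReal a i j e , σ ⟩⇓⟨
        state (nats σ) (write (reals σ) a (evalᴺ σ i) (evalᴺ σ j) (evalᴿ σ e))
        , 1 ℕ.+ costᴺ i ℕ.+ costᴺ j ℕ.+ costᴿ e ⟩

    ⇓seq : ∀ {p q σ τ υ s t} →
      ⟨ p , σ ⟩⇓⟨ τ , s ⟩ → ⟨ q , τ ⟩⇓⟨ υ , t ⟩ →
      ⟨ p ⨾ q , σ ⟩⇓⟨ υ , s ℕ.+ t ⟩

    ⇓then : ∀ {b p q σ τ t} → evalᵀ σ b ≡ true →
      ⟨ p , σ ⟩⇓⟨ τ , t ⟩ →
      ⟨ ifThenElse b p q , σ ⟩⇓⟨ τ , 1 ℕ.+ costᵀ b ℕ.+ t ⟩

    ⇓else : ∀ {b p q σ τ t} → evalᵀ σ b ≡ false →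
      ⟨ q , σ ⟩⇓⟨ τ , t ⟩ →
      ⟨ ifThenElse b p q , σ ⟩⇓⟨ τ , 1 ℕ.+ costᵀ b ℕ.+ t ⟩

    ⇓loop : ∀ {b p σ τ υ s t} → evalᵀ σ b ≡ true →
      ⟨ p , σ ⟩⇓⟨ τ , s ⟩ → ⟨ while b p , τ ⟩⇓⟨ υ , t ⟩ →
      ⟨ while b p , σ ⟩⇓⟨ υ , 1 ℕ.+ costᵀ b ℕ.+ s ℕ.+ t ⟩

    ⇓done : ∀ {b p σ} → evalᵀ σ b ≡ false →
      ⟨ while b p , σ ⟩⇓⟨ σ , 1 ℕ.+ costᵀ b ⟩

module KMeans (R : Reals) where
  open Reals R public
  open RealRAM R public

  ‖_‖² : ∀ {d} → (Fin d → ℝ) → ℝ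
  ‖ v ‖² = sum (λ c → v c * v c)

  _⊟_ : ∀ {d} → (Fin d → ℝ) → (Fin d → ℝ) → (Fin d → ℝ)
  (x ⊟ y) c = x c + - y c

  -- A set X of n points is an injective family X : Fin n → (Fin d → ℝ), and
  -- the subsets of X are the subsets of the index set Fin n.

  Distinct : ∀ {n d} → (Fin n → Fin d → ℝ) → Set
  Distinct X = ∀ i j → (∀ c → X i c ≡ X j c) → i ≡ j

  -- The element s₀ of S only serves as the initial value for the minimum of a
  -- list; the minimum does not depend on it.
  min[_,_] : ∀ {n} (S : Subset n) → Nonempty S → (Fin n → ℝ) → ℝ
  min[ S , (s₀ , _) ] g = min (g s₀) (map g (filter (_∈? S) (allFin _)))

  f : ∀ {n d} → (Fin n → Fin d → ℝ) → (S : Subset n) → Nonempty S → ℝ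
  f X S ne = sum (λ i → min[ S , ne ] (λ j → ‖ X i ⊟ X j ‖²))

  -- The empty set, where the minimum would be +∞, is not a competitor.
  IsOptimal : ∀ {n d} → (Fin n → Fin d → ℝ) → ℕ →
              (S : Subset n) → Nonempty S → Set
  IsOptimal X k S ne =
    ∣ S ∣ ℕ.≤ k × (∀ T (ne′ : Nonempty T) → ∣ T ∣ ℕ.≤ k → f X S ne ≤ f X T ne′)

  -- Integer array 0 initially holds n, d, k at (0 , 0), (1 , 0), (2 , 0); real
  -- array 0 holds the coordinates of the points, and ε is the cell (0 , 0) of
  -- real array 1.  All other cells are 0.
  inputNats : ℕ → ℕ → ℕ → Memory ℕ
  inputNats n d k 0 0 0 = n
  inputNats n d k 0 1 0 = d
  inputNats n d k 0 2 0 = k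
  inputNats n d k _ _ _ = 0

  inputReals : ∀ {n d} → (Fin n → Fin d → ℝ) → ℝ → Memory ℝ
  inputReals {n} {d} X ε 0 i j with i <? n | j <? d
  ... | yes i<n | yes j<d = X (fromℕ< i<n) (fromℕ< j<d)
  ... | _       | _       = 0#
  inputReals X ε 1 0 0 = ε
  inputReals X ε _ _ _ = 0#

  input : ∀ {n d} → (Fin n → Fin d → ℝ) → ℕ → ℝ → State
  input {n} {d} X k ε = state (inputNats n d k) (inputReals X ε)

  -- The output S consists of the i for which cell (i , 0) of integer array 1
  -- is nonzero.
  output : ∀ n → State → Subset n
  output n τ = tabulate (λ i → not (nats τ 1 (toℕ i) 0 ≡ᵇ 0))

{-# OPTIONS --safe #-}
module Submission where

-- A point x is worth Σ_y (D y - N |x - y|²)⁺ to a set with squared distances D,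
-- and the algorithm always adds the most valuable point.
--
-- With N = 1 this is the greedy algorithm: some optimal center decreases the
-- excess f(S) - f(S*) by at least a fraction 1/k of itself, so about
-- k log (c/ε) steps lead from a c-approximation to a (1 + ε)-approximation.
--
-- With the large constant N = A, 3k steps from any point give the
-- c-approximation.  Let λ bound the final value of every point, so that every
-- pick was worth at least λ.  Then f(S) ≤ k λ + A f(S*), and it remains to bound
-- k λ by O(f(S*)).  A pick is worth λ because of points that S* serves at a cost
-- comparable to the gain, and each point pays O(1) times its optimal cost in
-- total, unless there are optimal centers close to the pick.  In that case let t′
-- be the first later pick close to one of them.  If t′ resolves none of them
-- from the others, then picking t′ instead would have been an alternative, and
-- the points for which it is worse pay λ.  There is no t′ for at most one pick
-- per optimal center, and t′ separates two centers for at most k picks: such a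
-- pick is charged to the later of two representatives of the centers in a
-- farthest-first traversal of S*.

open import Defs
open import Algebra.Bundles using (CommutativeRing; RawRing)
open import Algebra.Solver.Ring.AlmostCommutativeRing
open import Data.Bool.Base using (Bool; true; false; not; _∨_; T)
open import Data.Empty using (⊥; ⊥-elim)
open import Data.Fin.Base using (Fin; zero; suc; toℕ; fromℕ<)
open import Data.Fin.Properties using (pigeonhole; toℕ-injective; toℕ-fromℕ<; toℕ<n; fromℕ<-toℕ)
open import Data.Fin.Subset using (Subset; Nonempty; ∣_∣; _∈_)
open import Data.Fin.Subset.Properties using (_∈?_)
open import Data.Integer.Base as ℤ using (ℤ; -[1+_]) renaming (+_ to pos)
open import Data.List.Base as List using (List; []; _∷_; filter; allFin)
open import Data.List.Membership.Propositional.Properties using (∈-map⁺; ∈-map⁻; ∈-filter⁺; ∈-filter⁻; ∈-allFin)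
open import Data.List.Relation.Unary.All using () renaming (lookup to All-lookup)
open import Data.Maybe.Base using (Maybe; just; nothing)
open import Data.Nat.Base as ℕ using (ℕ; zero; suc; NonZero; _≡ᵇ_; _≤ᵇ_)
open import Data.Nat.Solver using (module +-*-Solver)
open import Data.Product.Base using (∃-syntax; Σ-syntax; _×_; _,_; proj₁; proj₂)
open import Data.Sum.Base using (_⊎_; inj₁; inj₂)
open import Data.Unit.Base using (⊤; tt)
open import Data.Vec.Base as Vec using (Vec; []; _∷_; tabulate; here; there)
open import Data.Vec.N-ary using (N-ary; _$ⁿ_)
open import Data.Vec.Properties using (tabulate-cong; lookup⇒[]=; lookup∘tabulate)
open import Function.Base using (_∘_; id)
open import Relation.Binary.Definitions using (Tri; tri<; tri≈; tri>)
open import Relation.Binary.PropositionalEquality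
open import Relation.Binary.Structures using (IsDecTotalOrder)
open import Relation.Nullary using (¬_; Dec; yes; no)
open import Relation.Nullary.Decidable using (dec-true; dec-false)
import Algebra.Construct.NaturalChoice.Max as NaturalMax
import Algebra.Solver.Ring as RingSolver
import Data.Integer.Properties as ℤₚ
import Data.Nat.Properties as ℕₚ
open +-*-Solver using () renaming (solve to ℕ-solve; _:+_ to _:+ℕ_; _:*_ to _:*ℕ_; _:=_ to _:=ℕ_; con to conℕ)

-- The leading term of the size is `k log (1/ε)` with factor 1, so constant factors must be spent
-- before the greedy phase: starting within a factor `c` of the optimum costs about `k log c` extra
-- picks, which is `O(k)` only for constant `c`. A single arbitrary point can be arbitrarily bad;
-- hence the seeding.
--
-- The length `3k` comes from the accounting. Summed over `T` picks, the charges of `λ` to optimal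
-- centers and to representatives amount to at most `2kλ`, those to data points to at most
-- `6 A f(S*)`. So `T λ ≤ 2kλ + 6 A f(S*)`, and `T = 3k` leaves `kλ ≤ 6 A f(S*)` and a cost of at
-- most `7 A f(S*)`.
--
-- Squared distances obey the triangle inequality only up to a factor 2, and closeness is passed
-- through several such steps; the thresholds are therefore spaced by large powers of 2.
--
-- The program cannot take logarithms. It keeps an upper bound `p` on the relative excess, shrinks
-- it by `1 - 1/k` per pick and stops once `p ≤ ε`; the logarithm enters only when the turns are
-- counted.

module OrderedField (R : Reals) where
  open Reals R public

  private
    module CR = CommutativeRing commutativeRing
  open CR public using (+-comm; +-assoc; *-comm; *-assoc; +-identityˡ; +-identityʳ;
    *-identityˡ; *-identityʳ; zeroˡ; zeroʳ; distribˡ; distribʳ; -‿inverseʳ)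
  open IsDecTotalOrder isDecTotalOrder public using (antisym; total)
    renaming (refl to ≤-refl; trans to ≤-trans; reflexive to ≤-reflexive)
  open import Algebra.Properties.Semiring.Mult CR.semiring public
    using (×-homo-+; ×1-homo-*)
  open import Algebra.Properties.Ring CR.ring
    using (-0#≈0#; -‿distribˡ-*; -‿distribʳ-*; -‿involutive; -‿+-comm)

  -- An opaque copy of fromℕ: large numerals must never unfold to unary sums.
  opaque
    # : ℕ → ℝ
    # = fromℕ

    #≡fromℕ : ∀ n → # n ≡ fromℕ n
    #≡fromℕ n = refl

    #0 : # 0 ≡ 0#
    #0 = refl

    #-suc : ∀ n → # (suc n) ≡ 1# + # n
    #-suc n = refl

    #-+ : ∀ m n → # (m ℕ.+ n) ≡ # m + # n
    #-+ = ×-homo-+ 1#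

    #-* : ∀ m n → # (m ℕ.* n) ≡ # m * # n
    #-* = ×1-homo-*

  #1 : # 1 ≡ 1#
  #1 = trans (#-suc 0) (trans (cong (1# +_) #0) (+-identityʳ 1#))

  fromℤ : ℤ → ℝ
  fromℤ (pos zero)    = 0#
  fromℤ (pos (suc n)) = # (suc n)
  fromℤ -[1+ n ]      = - # (suc n)

  private
    fromℤ-pos : ∀ n → fromℤ (pos n) ≡ # n
    fromℤ-pos zero    = sym #0
    fromℤ-pos (suc n) = refl

    fromℤ-⊖ : ∀ m n → fromℤ (m ℤ.⊖ n) ≡ # m + - # n
    fromℤ-⊖ m zero = trans (fromℤ-pos m) (sym (trans (cong (λ z → # m + - z) #0) (trans (cong (# m +_) -0#≈0#) (+-identityʳ _))))
    fromℤ-⊖ zero (suc n) = sym (trans (cong (_+ - # (suc n)) #0) (+-identityˡ _))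
    fromℤ-⊖ (suc m) (suc n) = begin
      fromℤ (suc m ℤ.⊖ suc n)         ≡⟨ cong fromℤ (ℤₚ.[1+m]⊖[1+n]≡m⊖n m n) ⟩
      fromℤ (m ℤ.⊖ n)                 ≡⟨ fromℤ-⊖ m n ⟩
      # m + - # n                     ≡⟨ cong (_+ - # n) (sym (+-identityʳ (# m))) ⟩
      # m + 0# + - # n                ≡⟨ cong (λ z → # m + z + - # n) (sym (-‿inverseʳ 1#)) ⟩
      # m + (1# + - 1#) + - # n       ≡⟨ cong (_+ - # n) (sym (+-assoc (# m) 1# (- 1#))) ⟩
      # m + 1# + - 1# + - # n         ≡⟨ cong (λ z → z + - 1# + - # n) (+-comm (# m) 1#) ⟩
      1# + # m + - 1# + - # n         ≡⟨ +-assoc (1# + # m) (- 1#) (- # n) ⟩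
      1# + # m + (- 1# + - # n)       ≡⟨ cong (1# + # m +_) (-‿+-comm 1# (# n)) ⟩
      1# + # m + - (1# + # n)         ≡⟨ cong₂ (λ a b → a + - b) (sym (#-suc m)) (sym (#-suc n)) ⟩
      # (suc m) + - # (suc n)         ∎
      where open ≡-Reasoning

    fromℤ-neg : ∀ i → fromℤ (ℤ.- i) ≡ - fromℤ i
    fromℤ-neg (pos zero)    = sym -0#≈0#
    fromℤ-neg (pos (suc n)) = refl
    fromℤ-neg -[1+ n ]      = sym (-‿involutive _)

    fromℤ-+ : ∀ i j → fromℤ (i ℤ.+ j) ≡ fromℤ i + fromℤ j
    fromℤ-+ (pos m) (pos n) = trans (fromℤ-pos (m ℕ.+ n))
      (trans (#-+ m n) (sym (cong₂ _+_ (fromℤ-pos m) (fromℤ-pos n))))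
    fromℤ-+ (pos m) -[1+ n ] = trans (fromℤ-⊖ m (suc n)) (cong (_+ - # (suc n)) (sym (fromℤ-pos m)))
    fromℤ-+ -[1+ m ] (pos n) = trans (fromℤ-⊖ n (suc m))
      (trans (+-comm _ _) (cong (- # (suc m) +_) (sym (fromℤ-pos n))))
    fromℤ-+ -[1+ m ] -[1+ n ] = begin
      - # (suc (suc (m ℕ.+ n)))   ≡⟨ cong (λ z → - # z) (sym (ℕₚ.+-suc (suc m) n)) ⟩
      - # (suc m ℕ.+ suc n)       ≡⟨ cong -_ (#-+ (suc m) (suc n)) ⟩
      - (# (suc m) + # (suc n))   ≡⟨ sym (-‿+-comm _ _) ⟩
      - # (suc m) + - # (suc n)   ∎
      where open ≡-Reasoning

    fromℤ-pos-* : ∀ m j → fromℤ (pos m ℤ.* j) ≡ # m * fromℤ j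
    fromℤ-pos-* m (pos n) = trans (cong fromℤ (sym (ℤₚ.pos-* m n)))
      (trans (fromℤ-pos (m ℕ.* n)) (trans (#-* m n) (cong (# m *_) (sym (fromℤ-pos n)))))
    fromℤ-pos-* m -[1+ n ] = begin
      fromℤ (pos m ℤ.* -[1+ n ])             ≡⟨ cong fromℤ (sym (ℤₚ.neg-distribʳ-* (pos m) (pos (suc n)))) ⟩
      fromℤ (ℤ.- (pos m ℤ.* pos (suc n)))    ≡⟨ fromℤ-neg (pos m ℤ.* pos (suc n)) ⟩
      - fromℤ (pos m ℤ.* pos (suc n))        ≡⟨ cong -_ (fromℤ-pos-* m (pos (suc n))) ⟩
      - (# m * # (suc n))                    ≡⟨ -‿distribʳ-* _ _ ⟩
      # m * - # (suc n)                      ∎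
      where open ≡-Reasoning

    fromℤ-* : ∀ i j → fromℤ (i ℤ.* j) ≡ fromℤ i * fromℤ j
    fromℤ-* (pos m) j = trans (fromℤ-pos-* m j) (cong (_* fromℤ j) (sym (fromℤ-pos m)))
    fromℤ-* -[1+ m ] j = begin
      fromℤ (-[1+ m ] ℤ.* j)             ≡⟨ cong fromℤ (sym (ℤₚ.neg-distribˡ-* (pos (suc m)) j)) ⟩
      fromℤ (ℤ.- (pos (suc m) ℤ.* j))    ≡⟨ fromℤ-neg (pos (suc m) ℤ.* j) ⟩
      - fromℤ (pos (suc m) ℤ.* j)        ≡⟨ cong -_ (fromℤ-pos-* (suc m) j) ⟩
      - (# (suc m) * fromℤ j)            ≡⟨ -‿distribˡ-* _ _ ⟩
      - # (suc m) * fromℤ j              ∎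
      where open ≡-Reasoning

    ℤ-rawRing : RawRing _ _
    ℤ-rawRing = record { Carrier = ℤ; _≈_ = _≡_; _+_ = ℤ._+_; _*_ = ℤ._*_; -_ = ℤ.-_; 0# = pos 0; 1# = pos 1 }

    morphism : ℤ-rawRing -Raw-AlmostCommutative⟶ fromCommutativeRing commutativeRing
    morphism = record
      { ⟦_⟧ = fromℤ; +-homo = fromℤ-+; *-homo = fromℤ-*; -‿homo = fromℤ-neg
      ; 0-homo = refl; 1-homo = #1 }

    coeff≟ : ∀ i j → Maybe (fromℤ i ≡ fromℤ j)
    coeff≟ i j with i ℤₚ.≟ j
    ... | yes i≡j = just (cong fromℤ i≡j)
    ... | no  _   = nothing

  open RingSolver ℤ-rawRing (fromCommutativeRing commutativeRing) morphism coeff≟ public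
    using (Polynomial; con; _:+_; _:*_; _:-_; :-_; _:=_; solve)

  -- Evaluates to `0#` at 0 and to the opaque `# n` otherwise. So `1#` is not a literal for the
  -- solver: equations containing it take it as a variable or rewrite with `#1` first.
  κ : ∀ {n} → ℕ → Polynomial n
  κ n = con (pos n)

  -- Order, signs and cancellation

  infixr 8 _⊙_
  infixl 6 _⟨+⟩_ _⟨+<⟩_

  +-mono-≤ : ∀ {a b c d} → a ≤ b → c ≤ d → a + c ≤ b + d
  +-mono-≤ {a} {b} {c} {d} a≤b c≤d = ≤-trans (+-monoˡ-≤ c a≤b)
    (subst₂ _≤_ (+-comm c b) (+-comm d b) (+-monoˡ-≤ b c≤d))

  _⟨+⟩_ : ∀ {a b c d} → a ≤ b → c ≤ d → a + c ≤ b + d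
  _⟨+⟩_ = +-mono-≤

  +-cancelʳ-≤ : ∀ c {a b} → a + c ≤ b + c → a ≤ b
  +-cancelʳ-≤ c {a} {b} h = subst₂ _≤_ (undo a) (undo b) (+-monoˡ-≤ (- c) h)
    where
    undo : ∀ x → x + c + - c ≡ x
    undo x = solve 2 (λ x c → x :+ c :- c := x) refl x c

  -- The equation, meant for the ring solver, says that y - x = b - a.
  lin : ∀ {a b x y} → a ≤ b → x + b ≡ y + a → x ≤ y
  lin {a} {b} {x} {y} a≤b eq = +-cancelʳ-≤ b (subst (_≤ y + b) (sym eq) (+-mono-≤ ≤-refl a≤b))

  ≤⇒nonneg : ∀ {x y} → x ≤ y → 0# ≤ y + - x
  ≤⇒nonneg {x} {y} h = lin h (solve 2 (λ x y → κ 0 :+ y := (y :- x) :+ x) refl x y)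

  *-monoʳ-≤ : ∀ {c a b} → 0# ≤ c → a ≤ b → c * a ≤ c * b
  *-monoʳ-≤ {c} {a} {b} 0≤c a≤b = lin (*-nonneg 0≤c (≤⇒nonneg a≤b))
    (solve 3 (λ a b c → c :* a :+ c :* (b :- a) := c :* b :+ κ 0) refl a b c)

  *-monoˡ-≤ : ∀ {c a b} → 0# ≤ c → a ≤ b → a * c ≤ b * c
  *-monoˡ-≤ {c} 0≤c a≤b = subst₂ _≤_ (*-comm c _) (*-comm c _) (*-monoʳ-≤ 0≤c a≤b)

  0≤x² : ∀ x → 0# ≤ x * x
  0≤x² x with total 0# x
  ... | inj₁ 0≤x = *-nonneg 0≤x 0≤x
  ... | inj₂ x≤0 = subst (0# ≤_) (solve 1 (λ x → (:- x) :* (:- x) := x :* x) refl x) (*-nonneg 0≤-x 0≤-x)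
    where
    0≤-x : 0# ≤ - x
    0≤-x = lin x≤0 (solve 1 (λ x → κ 0 :+ κ 0 := (:- x) :+ x) refl x)

  0≤1 : 0# ≤ 1#
  0≤1 = subst (0# ≤_) (*-identityˡ 1#) (0≤x² 1#)

  0<1 : 0# < 1#
  0<1 = 0≤1 , 0≢1

  ≰⇒> : ∀ {a b} → ¬ (a ≤ b) → b < a
  ≰⇒> {a} {b} a≰b with total a b
  ... | inj₁ a≤b = ⊥-elim (a≰b a≤b)
  ... | inj₂ b≤a = b≤a , λ b≡a → a≰b (≤-reflexive (sym b≡a))

  ≰⇒≥ : ∀ {a b} → ¬ (a ≤ b) → b ≤ a
  ≰⇒≥ a≰b = proj₁ (≰⇒> a≰b)

  <⇒≱ : ∀ {a b} → a < b → ¬ (b ≤ a)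
  <⇒≱ (a≤b , a≢b) b≤a = a≢b (antisym a≤b b≤a)

  ≤-<-trans : ∀ {a b c} → a ≤ b → b < c → a < c
  ≤-<-trans a≤b b<c = ≤-trans a≤b (proj₁ b<c) , λ { refl → <⇒≱ b<c a≤b }

  <-≤-trans : ∀ {a b c} → a < b → b ≤ c → a < c
  <-≤-trans a<b b≤c = ≤-trans (proj₁ a<b) b≤c , λ { refl → <⇒≱ a<b b≤c }

  lin< : ∀ {a b x y} → a < b → x + b ≡ y + a → x < y
  lin< {a} {b} {x} {y} a<b eq = ≰⇒> λ y≤x →
    <⇒≱ a<b (lin y≤x (trans (+-comm b x) (trans eq (+-comm y a))))

  _⟨+<⟩_ : ∀ {a b c d} → a ≤ b → c < d → a + c < b + d
  _⟨+<⟩_ {a} {b} {c} {d} a≤b c<d = ≤-<-trans (+-monoˡ-≤ c a≤b)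
    (lin< c<d (solve 3 (λ b c d → b :+ c :+ d := b :+ d :+ c) refl b c d))

  *-pos : ∀ {x y} → 0# < x → 0# < y → 0# < x * y
  *-pos {x} {y} 0<x 0<y = *-nonneg (proj₁ 0<x) (proj₁ 0<y) , λ 0≡xy → proj₂ 0<y
    (sym (begin
      y                    ≡⟨ *-identityʳ y ⟨
      y * 1#               ≡⟨ cong (y *_) (sym (*-inverseʳ x (λ x≡0 → proj₂ 0<x (sym x≡0)))) ⟩
      y * (x * x ⁻¹)       ≡⟨ solve 3 (λ x y z → y :* (x :* z) := x :* y :* z) refl x y (x ⁻¹) ⟩
      x * y * x ⁻¹         ≡⟨ cong (_* x ⁻¹) (sym 0≡xy) ⟩
      0# * x ⁻¹            ≡⟨ zeroˡ (x ⁻¹) ⟩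
      0#                   ∎))
    where open ≡-Reasoning

  *-monoʳ-< : ∀ {c a b} → 0# < c → a < b → c * a < c * b
  *-monoʳ-< {c} {a} {b} 0<c a<b = lin< (*-pos 0<c 0<b-a)
    (solve 3 (λ a b c → c :* a :+ c :* (b :- a) := c :* b :+ κ 0) refl a b c)
    where
    0<b-a : 0# < b + - a
    0<b-a = lin< a<b (solve 2 (λ a b → κ 0 :+ b := (b :- a) :+ a) refl a b)

  *-cancelˡ-≤ : ∀ {c a b} → 0# < c → c * a ≤ c * b → a ≤ b
  *-cancelˡ-≤ {c} {a} {b} 0<c h with a ≤? b
  ... | yes a≤b = a≤b
  ... | no  a≰b = ⊥-elim (<⇒≱ (*-monoʳ-< 0<c (≰⇒> a≰b)) h)

  0≤# : ∀ n → 0# ≤ # n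
  0≤# zero    = ≤-reflexive (sym #0)
  0≤# (suc n) = subst₂ _≤_ (+-identityʳ 0#) (sym (#-suc n)) (+-mono-≤ 0≤1 (0≤# n))

  0<# : ∀ n .{{_ : NonZero n}} → 0# < # n
  0<# (suc n) = <-≤-trans 0<1 (subst₂ _≤_ (+-identityʳ 1#) (sym (#-suc n)) (+-mono-≤ ≤-refl (0≤# n)))

  #-mono : ∀ {m n} → m ℕ.≤ n → # m ≤ # n
  #-mono {n = n} ℕ.z≤n = subst (_≤ # n) (sym #0) (0≤# n)
  #-mono (ℕ.s≤s {m} {n} m≤n) = subst₂ _≤_ (sym (#-suc m)) (sym (#-suc n)) (+-mono-≤ ≤-refl (#-mono m≤n))

  _⊙_ : ∀ n {a b} → a ≤ b → # n * a ≤ # n * b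
  n ⊙ a≤b = *-monoʳ-≤ (0≤# n) a≤b

  -- Linear inequalities from certificates

  module LinearArithmetic where
    infixr 7 _⋆_
    infixl 6 _∔_
    infix  5 _⊑_
    infix  4 _⊢_·_

    data Linear (n : ℕ) : Set where
      var  : Fin n → Linear n
      𝟎    : Linear n
      _∔_ : Linear n → Linear n → Linear n
      _⋆_ : ℕ → Linear n → Linear n

    record Inequality (n : ℕ) : Set where
      constructor _⊑_
      field lhs rhs : Linear n
    open Inequality

    ⟦_⟧ : ∀ {n} → Linear n → Vec ℝ n → ℝ
    ⟦ var i ⟧  ρ = Vec.lookup ρ i
    ⟦ 𝟎 ⟧      ρ = 0#
    ⟦ s ∔ t ⟧ ρ = ⟦ s ⟧ ρ + ⟦ t ⟧ ρ
    ⟦ c ⋆ t ⟧ ρ = # c * ⟦ t ⟧ ρ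

    ⟦_⟧≤ : ∀ {n} → Inequality n → Vec ℝ n → Set
    ⟦ s ⊑ t ⟧≤ ρ = ⟦ s ⟧ ρ ≤ ⟦ t ⟧ ρ

    dot : ∀ {n} → Vec ℕ n → Vec ℝ n → ℝ
    dot []       []      = 0#
    dot (c ∷ cs) (x ∷ ρ) = # c * x + dot cs ρ

    unit : ∀ {n} → Fin n → Vec ℕ n
    unit zero    = 1 ∷ Vec.replicate _ 0
    unit (suc i) = 0 ∷ unit i

    coefficients : ∀ {n} → Linear n → Vec ℕ n
    coefficients (var i)  = unit i
    coefficients 𝟎        = Vec.replicate _ 0
    coefficients (s ∔ t) = Vec.zipWith ℕ._+_ (coefficients s) (coefficients t)
    coefficients (c ⋆ t) = Vec.map (c ℕ.*_) (coefficients t)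

    #0* : ∀ x → # 0 * x ≡ 0#
    #0* x = trans (cong (_* x) #0) (zeroˡ x)

    dot-0 : ∀ {n} (ρ : Vec ℝ n) → dot (Vec.replicate n 0) ρ ≡ 0#
    dot-0 []      = refl
    dot-0 (x ∷ ρ) = trans (cong₂ _+_ (#0* x) (dot-0 ρ)) (+-identityʳ 0#)

    dot-unit : ∀ {n} (i : Fin n) ρ → dot (unit i) ρ ≡ Vec.lookup ρ i
    dot-unit zero    (x ∷ ρ) = trans (cong₂ _+_ (trans (cong (_* x) #1) (*-identityˡ x)) (dot-0 ρ)) (+-identityʳ x)
    dot-unit (suc i) (x ∷ ρ) = trans (cong₂ _+_ (#0* x) (dot-unit i ρ)) (+-identityˡ _)

    dot-+ : ∀ {n} (cs ds : Vec ℕ n) ρ → dot (Vec.zipWith ℕ._+_ cs ds) ρ ≡ dot cs ρ + dot ds ρ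
    dot-+ []       []       []      = sym (+-identityʳ 0#)
    dot-+ (c ∷ cs) (d ∷ ds) (x ∷ ρ) = trans (cong₂ _+_ (cong (_* x) (#-+ c d)) (dot-+ cs ds ρ))
      (solve 5 (λ c d x s t → (c :+ d) :* x :+ (s :+ t) := c :* x :+ s :+ (d :* x :+ t)) refl
        (# c) (# d) x (dot cs ρ) (dot ds ρ))

    dot-· : ∀ {n} c (cs : Vec ℕ n) ρ → dot (Vec.map (c ℕ.*_) cs) ρ ≡ # c * dot cs ρ
    dot-· c []       []      = sym (zeroʳ (# c))
    dot-· c (d ∷ cs) (x ∷ ρ) = trans (cong₂ _+_ (cong (_* x) (#-* c d)) (dot-· c cs ρ))
      (solve 4 (λ c d x s → c :* d :* x :+ c :* s := c :* (d :* x :+ s)) refl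
        (# c) (# d) x (dot cs ρ))

    correct : ∀ {n} (t : Linear n) ρ → dot (coefficients t) ρ ≡ ⟦ t ⟧ ρ
    correct (var i)  ρ = dot-unit i ρ
    correct 𝟎        ρ = dot-0 ρ
    correct (s ∔ t) ρ = trans (dot-+ (coefficients s) (coefficients t) ρ) (cong₂ _+_ (correct s ρ) (correct t ρ))
    correct (c ⋆ t) ρ = trans (dot-· c (coefficients t) ρ) (cong (# c *_) (correct t ρ))

    Holds : ∀ {n} → List (ℕ × Inequality n) → Vec ℝ n → Set
    Holds []             ρ = ⊤
    Holds ((_ , h) ∷ hs) ρ = ⟦ h ⟧≤ ρ × Holds hs ρ

    total′ : ∀ {n} → (Inequality n → Linear n) → List (ℕ × Inequality n) → Linear n
    total′ side []             = 𝟎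
    total′ side ((c , h) ∷ hs) = c ⋆ side h ∔ total′ side hs

    total-≤ : ∀ {n} (hs : List (ℕ × Inequality n)) ρ → Holds hs ρ → ⟦ total′ lhs hs ⟧ ρ ≤ ⟦ total′ rhs hs ⟧ ρ
    total-≤ []             ρ _        = ≤-refl
    total-≤ ((c , h) ∷ hs) ρ (p , ps) = c ⊙ p ⟨+⟩ total-≤ hs ρ ps

    record Certificate (n : ℕ) : Set where
      constructor _⊢_·_
      field
        hypotheses : List (ℕ × Inequality n)
        multiplier : ℕ
        goal       : Inequality n
    open Certificate

    -- Both sides are vectors of numerals that compute, so `refl` checks a certificate. Adding each
    -- side of the hypotheses to the opposite side of the goal avoids subtraction.
    Balanced : ∀ {n} → Certificate n → Set
    Balanced (hs ⊢ m · (s ⊑ t)) =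
      coefficients (m ⋆ s ∔ total′ rhs hs) ≡ coefficients (m ⋆ t ∔ total′ lhs hs)

    sound : ∀ {n} (ρ : Vec ℝ n) (c : Certificate n) .{{_ : NonZero (multiplier c)}} →
      Balanced c → Holds (hypotheses c) ρ → ⟦ goal c ⟧≤ ρ
    sound ρ (hyps ⊢ m · (s ⊑ t)) balanced hs = *-cancelˡ-≤ (0<# m) (lin (total-≤ hyps ρ hs)
      (trans (sym (correct (m ⋆ s ∔ total′ rhs hyps) ρ))
        (trans (cong (λ cs → dot cs ρ) balanced) (correct (m ⋆ t ∔ total′ lhs hyps) ρ))))

    -- Some nonnegative combination of the hypotheses is a positive multiple of
    -- the goal.
    linarith : ∀ {n} (ρ : Vec ℝ n) (f : N-ary n (Linear n) (Certificate n)) →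
      let c = f $ⁿ Vec.map var (Vec.allFin n) in
      .{{_ : NonZero (multiplier c)}} → Balanced c → Holds (hypotheses c) ρ → ⟦ goal c ⟧≤ ρ
    linarith {n} ρ f = sound ρ (f $ⁿ Vec.map var (Vec.allFin n))

  open LinearArithmetic public using (linarith; _⊢_·_; _⊑_; _⋆_; _∔_; 𝟎)

  -- The supremum of {0} ∪ {1 | Φ} is positive exactly when Φ holds.
  lem : (Φ : Set) → Dec Φ
  lem Φ with complete (λ p → (p ≡ 0#) ⊎ (p ≡ 1# × Φ)) (0# , inj₁ refl) (1# , bound)
    where
    bound : ∀ p → (p ≡ 0#) ⊎ (p ≡ 1# × Φ) → p ≤ 1#
    bound p (inj₁ refl)       = 0≤1
    bound p (inj₂ (refl , _)) = ≤-refl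
  ... | s , upper , least with s ≤? 0#
  ... | yes s≤0 = no λ φ → <⇒≱ 0<1 (≤-trans (upper 1# (inj₂ (refl , φ))) s≤0)
  ... | no  s≰0 with least 0# (≰⇒> s≰0)
  ...   | p , inj₁ refl , 0<0       = ⊥-elim (proj₂ 0<0 refl)
  ...   | p , inj₂ (_ , φ) , _ = yes φ

  -- Otherwise the numerals have a supremum `s`; one of them exceeds `s - 1`, and its successor
  -- exceeds `s`.
  archimedean : ∀ x → ∃[ m ] x ≤ # m
  archimedean x with lem (∃[ m ] x ≤ # m)
  ... | yes h = h
  ... | no ¬h with complete (λ p → ∃[ m ] p ≡ # m) (# 0 , 0 , refl) (x , λ { p (m , refl) → ≰⇒≥ (λ x≤m → ¬h (m , x≤m)) })
  ... | s , upper , least with least (s + - 1#) (lin< 0<1 (solve 2 (λ s u → (s :- u) :+ u := s :+ κ 0) refl s 1#))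
  ... | _ , (m , refl) , s-1<m = ⊥-elim (<⇒≱ s-1<m (lin (upper _ (suc m , refl)) (trans (solve 3 (λ m s u → m :+ s := (s :- u) :+ (u :+ m)) refl (# m) s 1#)
      (cong (s + - 1# +_) (sym (#-suc m))))))

  -- Minima, positive parts and finite sums

  infixl 5 _⊓_
  _⊓_ : ℝ → ℝ → ℝ
  x ⊓ y with x ≤? y
  ... | yes _ = x
  ... | no  _ = y

  ⊓-≤ˡ : ∀ x y → x ⊓ y ≤ x
  ⊓-≤ˡ x y with x ≤? y
  ... | yes _   = ≤-refl
  ... | no  x≰y = ≰⇒≥ x≰y

  ⊓-≤ʳ : ∀ x y → x ⊓ y ≤ y
  ⊓-≤ʳ x y with x ≤? y
  ... | yes x≤y = x≤y
  ... | no  _   = ≤-refl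

  ⊓-sel : ∀ x y → (x ⊓ y ≡ x) ⊎ (x ⊓ y ≡ y)
  ⊓-sel x y with x ≤? y
  ... | yes _ = inj₁ refl
  ... | no  _ = inj₂ refl

  ⊓-yes : ∀ {x y} → x ≤ y → x ⊓ y ≡ x
  ⊓-yes {x} {y} x≤y with x ≤? y
  ... | yes _   = refl
  ... | no  x≰y = ⊥-elim (x≰y x≤y)

  ⊓-no : ∀ {x y} → ¬ x ≤ y → x ⊓ y ≡ y
  ⊓-no {x} {y} x≰y with x ≤? y
  ... | yes x≤y = ⊥-elim (x≰y x≤y)
  ... | no  _   = refl

  ⊓-glb : ∀ {x y z} → z ≤ x → z ≤ y → z ≤ x ⊓ y
  ⊓-glb {x} {y} z≤x z≤y with x ≤? y
  ... | yes _ = z≤x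
  ... | no  _ = z≤y

  -- The positive part of `v - u`, split on the very test by which the program decides whether to
  -- add the gain of a point.
  excess : ℝ → ℝ → ℝ
  excess u v with u ≤? v
  ... | yes _ = v + - u
  ... | no  _ = 0#

  0≤excess : ∀ u v → 0# ≤ excess u v
  0≤excess u v with u ≤? v
  ... | yes u≤v = ≤⇒nonneg u≤v
  ... | no  _   = ≤-refl

  -≤excess : ∀ u v → v + - u ≤ excess u v
  -≤excess u v with u ≤? v
  ... | yes _   = ≤-refl
  ... | no  u≰v = lin (≰⇒≥ u≰v) (solve 2 (λ u v → (v :- u) :+ u := κ 0 :+ v) refl u v)

  excess-pos : ∀ {u v} → u ≤ v → excess u v ≡ v + - u
  excess-pos {u} {v} u≤v with u ≤? v
  ... | yes _   = refl
  ... | no  u≰v = ⊥-elim (u≰v u≤v)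

  excess-neg : ∀ {u v} → ¬ u ≤ v → excess u v ≡ 0#
  excess-neg {u} {v} u≰v with u ≤? v
  ... | yes u≤v = ⊥-elim (u≰v u≤v)
  ... | no  _   = refl

  excess-mono : ∀ u {v w} → v ≤ w → excess u v ≤ excess u w
  excess-mono u {v} {w} v≤w with u ≤? v
  ... | yes _ = ≤-trans (+-monoˡ-≤ (- u) v≤w) (-≤excess u w)
  ... | no  _ = 0≤excess u w

  -- Accumulated in the order of the program's loops, so that `∑ m` is the loop invariant after `m`
  -- turns.
  ∑ : ℕ → (ℕ → ℝ) → ℝ
  ∑ zero    g = 0#
  ∑ (suc n) g = ∑ n g + g n

  ∑-mono : ∀ n {g h : ℕ → ℝ} → (∀ i → i ℕ.< n → g i ≤ h i) → ∑ n g ≤ ∑ n h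
  ∑-mono zero    g≤h = ≤-refl
  ∑-mono (suc n) g≤h = ∑-mono n (λ i i<n → g≤h i (ℕₚ.m<n⇒m<1+n i<n)) ⟨+⟩ g≤h n ℕₚ.≤-refl

  ∑-cong : ∀ n {g h : ℕ → ℝ} → (∀ i → i ℕ.< n → g i ≡ h i) → ∑ n g ≡ ∑ n h
  ∑-cong zero    g≡h = refl
  ∑-cong (suc n) g≡h = cong₂ _+_ (∑-cong n (λ i i<n → g≡h i (ℕₚ.m<n⇒m<1+n i<n))) (g≡h n ℕₚ.≤-refl)

  ∑-nonneg : ∀ n {g : ℕ → ℝ} → (∀ i → i ℕ.< n → 0# ≤ g i) → 0# ≤ ∑ n g
  ∑-nonneg zero    0≤g = ≤-refl
  ∑-nonneg (suc n) {g} 0≤g = subst (_≤ ∑ (suc n) g) (+-identityʳ 0#)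
    (∑-nonneg n (λ i i<n → 0≤g i (ℕₚ.m<n⇒m<1+n i<n)) ⟨+⟩ 0≤g n ℕₚ.≤-refl)

  ∑-+ : ∀ n (g h : ℕ → ℝ) → ∑ n (λ i → g i + h i) ≡ ∑ n g + ∑ n h
  ∑-+ zero    g h = sym (+-identityʳ 0#)
  ∑-+ (suc n) g h = trans (cong (_+ (g n + h n)) (∑-+ n g h))
    (solve 4 (λ a b c d → a :+ b :+ (c :+ d) := a :+ c :+ (b :+ d)) refl (∑ n g) (∑ n h) (g n) (h n))

  ∑-*ˡ : ∀ n c (g : ℕ → ℝ) → ∑ n (λ i → c * g i) ≡ c * ∑ n g
  ∑-*ˡ zero    c g = sym (zeroʳ c)
  ∑-*ˡ (suc n) c g = trans (cong (_+ c * g n) (∑-*ˡ n c g)) (sym (distribˡ c (∑ n g) (g n)))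

  ∑-const : ∀ n c → ∑ n (λ _ → c) ≡ # n * c
  ∑-const zero    c = sym (trans (cong (_* c) #0) (zeroˡ c))
  ∑-const (suc n) c = trans (cong (_+ c) (∑-const n c))
    (trans (+-comm (# n * c) c) (trans (cong (_+ # n * c) (sym (*-identityˡ c)))
      (trans (sym (distribʳ c 1# (# n))) (cong (_* c) (sym (#-suc n))))))

  ∑-swap : ∀ m n (g : ℕ → ℕ → ℝ) → ∑ m (λ i → ∑ n (g i)) ≡ ∑ n (λ j → ∑ m (λ i → g i j))
  ∑-swap zero    n g = sym (trans (∑-const n 0#) (zeroʳ (# n)))
  ∑-swap (suc m) n g = trans (cong (_+ ∑ n (g m)) (∑-swap m n g)) (sym (∑-+ n _ (g m)))

  ∑-zero : ∀ n {g : ℕ → ℝ} → (∀ i → i ℕ.< n → g i ≡ 0#) → ∑ n g ≡ 0#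
  ∑-zero n g≡0 = trans (∑-cong n g≡0) (trans (∑-const n 0#) (zeroʳ (# n)))

  ∑-term : ∀ n {g : ℕ → ℝ} → (∀ i → i ℕ.< n → 0# ≤ g i) → ∀ {i} → i ℕ.< n → g i ≤ ∑ n g
  ∑-term (suc n) {g} 0≤g {i} i<1+n with i ℕₚ.≟ n
  ... | yes refl = lin (∑-nonneg n (λ j j<n → 0≤g j (ℕₚ.m<n⇒m<1+n j<n)))
                     (solve 2 (λ s x → x :+ s := s :+ x :+ κ 0) refl (∑ n g) (g n))
  ... | no  i≢n  = lin (∑-term n (λ j j<n → 0≤g j (ℕₚ.m<n⇒m<1+n j<n)) (ℕₚ.≤∧≢⇒< (ℕₚ.≤-pred i<1+n) i≢n) ⟨+⟩ 0≤g n ℕₚ.≤-refl)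
                     (solve 3 (λ s x y → y :+ (s :+ x) := s :+ x :+ (y :+ κ 0)) refl (∑ n g) (g n) (g i))

  -- The way charges are counted: an account that no two picks can both charge is charged at most
  -- once. If the last term is positive, all others vanish.
  ∑-atMostOne : ∀ n (g : ℕ → ℝ) c → 0# ≤ c → (∀ i → i ℕ.< n → g i ≤ c) →
    (∀ i j → i ℕ.< j → j ℕ.< n → g i ≡ 0# ⊎ g j ≡ 0#) → ∑ n g ≤ c
  ∑-atMostOne zero    g c 0≤c g≤c one = 0≤c
  ∑-atMostOne (suc n) g c 0≤c g≤c one with g n ≤? 0#
  ... | yes gn≤0 = lin (∑-atMostOne n g c 0≤c (λ i i<n → g≤c i (ℕₚ.m<n⇒m<1+n i<n))
                         (λ i j i<j j<n → one i j i<j (ℕₚ.m<n⇒m<1+n j<n)) ⟨+⟩ gn≤0)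
                     (solve 3 (λ s x c → s :+ x :+ (c :+ κ 0) := c :+ (s :+ x)) refl (∑ n g) (g n) c)
  ... | no  gn≰0 = subst (_≤ c) (trans (sym (+-identityˡ (g n))) (cong (_+ g n) (sym (∑-zero n others)))) (g≤c n ℕₚ.≤-refl)
    where
    others : ∀ i → i ℕ.< n → g i ≡ 0#
    others i i<n with one i n i<n ℕₚ.≤-refl
    ... | inj₁ gi≡0 = gi≡0
    ... | inj₂ gn≡0 = ⊥-elim (gn≰0 (≤-reflexive gn≡0))

-- Picking by score, and the farthest-first traversal

module FarthestPoint (R : Reals) where
  open OrderedField R public

  advance : ℕ × ℝ → ℕ → ℝ → ℕ × ℝ
  advance (i , v) m w with v ≤? w
  ... | yes _ = m , w
  ... | no  _ = i , v

  advance-yes : ∀ {s m w} → proj₂ s ≤ w → advance s m w ≡ (m , w)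
  advance-yes {_ , v} {m} {w} v≤w with v ≤? w
  ... | yes _   = refl
  ... | no  v≰w = ⊥-elim (v≰w v≤w)

  advance-no : ∀ {s m w} → ¬ proj₂ s ≤ w → advance s m w ≡ s
  advance-no {_ , v} {m} {w} v≰w with v ≤? w
  ... | yes v≤w = ⊥-elim (v≰w v≤w)
  ... | no  _   = refl

  -- The initial record 0 is safe because all scores are nonnegative: the first candidate always
  -- replaces it.
  scan : (ℕ → ℝ) → ℕ → ℕ × ℝ
  scan g zero = 0 , 0#
  scan g (suc m) = advance (scan g m) m (g m)

  argmax : ℕ → (ℕ → ℝ) → ℕ
  argmax n g = proj₁ (scan g n)

  scan-cong : ∀ {g h : ℕ → ℝ} n → (∀ i → i ℕ.< n → g i ≡ h i) → scan g n ≡ scan h n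
  scan-cong zero g≡h = refl
  scan-cong (suc m) g≡h =
    cong₂ (λ s w → advance s m w) (scan-cong m (λ i i<m → g≡h i (ℕₚ.m<n⇒m<1+n i<m))) (g≡h m ℕₚ.≤-refl)

  scan-spec : ∀ {g : ℕ → ℝ} n → (∀ i → i ℕ.< n → 0# ≤ g i) → 0 ℕ.< n →
    proj₁ (scan g n) ℕ.< n × proj₂ (scan g n) ≡ g (proj₁ (scan g n)) ×
    (∀ i → i ℕ.< n → g i ≤ proj₂ (scan g n))
  scan-spec {g} (suc zero) 0≤g _ with 0# ≤? g 0
  ... | yes _   = ℕₚ.≤-refl , refl , λ { zero _ → ≤-refl ; (suc _) (ℕ.s≤s ()) }
  ... | no  0≰g = ⊥-elim (0≰g (0≤g 0 ℕₚ.≤-refl))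
  scan-spec {g} (suc (suc m)) 0≤g _
    with scan-spec {g} (suc m) (λ i i<m → 0≤g i (ℕₚ.m<n⇒m<1+n i<m)) ℕ.z<s
  ... | arg<m , val , bound with proj₂ (scan g (suc m)) ≤? g (suc m)
  ...   | yes v≤g = ℕₚ.≤-refl , refl , λ i i<n → below i (ℕₚ.m≤n⇒m<n∨m≡n (ℕₚ.≤-pred i<n))
    where
    below : ∀ i → i ℕ.< suc m ⊎ i ≡ suc m → g i ≤ g (suc m)
    below i (inj₁ i<m)  = ≤-trans (bound i i<m) v≤g
    below i (inj₂ refl) = ≤-refl
  ...   | no  v≰g = ℕₚ.m<n⇒m<1+n arg<m , val , λ i i<n → below i (ℕₚ.m≤n⇒m<n∨m≡n (ℕₚ.≤-pred i<n))
    where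
    below : ∀ i → i ℕ.< suc m ⊎ i ≡ suc m → g i ≤ proj₂ (scan g (suc m))
    below i (inj₁ i<m)  = bound i i<m
    below i (inj₂ refl) = ≰⇒≥ v≰g

  argmax-< : ∀ {g : ℕ → ℝ} n → (∀ i → i ℕ.< n → 0# ≤ g i) → 0 ℕ.< n → argmax n g ℕ.< n
  argmax-< n 0≤g 0<n = proj₁ (scan-spec n 0≤g 0<n)

  argmax-max : ∀ {g : ℕ → ℝ} n → (∀ i → i ℕ.< n → 0# ≤ g i) → ∀ {i} → i ℕ.< n → g i ≤ g (argmax n g)
  argmax-max n 0≤g {i} i<n = let _ , val , bound = scan-spec n 0≤g (ℕₚ.≤-<-trans ℕ.z≤n i<n) in
    subst (_ ≤_) val (bound i i<n)

  -- Abstracts the squared Euclidean distance between indexed points; the factor 2 in `q-tri` is the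
  -- source of all the constants of the seeding phase.
  record QuasiMetric : Set where
    field
      q     : ℕ → ℕ → ℝ
      0≤q   : ∀ x y → 0# ≤ q x y
      q-refl : ∀ x → q x x ≡ 0#
      q-sym : ∀ x y → q x y ≡ q y x
      q-tri : ∀ x y z → q x z ≤ # 2 * q x y + # 2 * q y z

  next : (n : ℕ) (q : ℕ → ℕ → ℝ) (score : (ℕ → ℝ) → ℕ → ℝ) → (ℕ → ℝ) → (ℕ → ℝ)
  next n q score D y = D y ⊓ q (argmax n (score D)) y

  rounds : (n : ℕ) (q : ℕ → ℕ → ℝ) (score : (ℕ → ℝ) → ℕ → ℝ) → (ℕ → ℝ) → ℕ → (ℕ → ℝ)
  rounds n q score D₀ zero    = D₀
  rounds n q score D₀ (suc t) = next n q score (rounds n q score D₀ t)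

  -- Used twice: on the data points with the program's score, and on the optimal centers with the
  -- score `D` itself, which gives the farthest-first traversal.
  module Covering (M : QuasiMetric) (n : ℕ) (score : (ℕ → ℝ) → ℕ → ℝ) (start : ℕ) where
    open QuasiMetric M

    D : ℕ → ℕ → ℝ
    D = rounds n q score (q start)

    pick : ℕ → ℕ
    pick t = argmax n (score (D t))

    -- Shifted by one against `pick`: `D t` is the distance to `center 0`, ..., `center t`, and
    -- `pick t` joins them at `suc t`.
    center : ℕ → ℕ
    center zero    = start
    center (suc t) = pick t

    D-antitone : ∀ {s t} y → s ℕ.≤ t → D t y ≤ D s y
    D-antitone {s} {zero} y ℕ.z≤n = ≤-refl
    D-antitone {s} {suc t} y s≤1+t with ℕₚ.m≤n⇒m<n∨m≡n s≤1+t
    ... | inj₁ s<1+t = ≤-trans (⊓-≤ˡ _ _) (D-antitone y (ℕₚ.≤-pred s<1+t))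
    ... | inj₂ refl  = ≤-refl

    D-attained : ∀ t y → ∃[ j ] (j ℕ.≤ t × D t y ≡ q (center j) y)
    D-attained zero    y = 0 , ℕ.z≤n , refl
    D-attained (suc t) y with ⊓-sel (D t y) (q (pick t) y)
    ... | inj₂ D≡q = suc t , ℕₚ.≤-refl , D≡q
    ... | inj₁ D≡D = let j , j≤t , D≡q = D-attained t y in j , ℕₚ.m≤n⇒m≤1+n j≤t , trans D≡D D≡q

    D≤center : ∀ {j t} y → j ℕ.≤ t → D t y ≤ q (center j) y
    D≤center {zero}  y j≤t = D-antitone y j≤t
    D≤center {suc j} y j≤t = ≤-trans (D-antitone y j≤t) (⊓-≤ʳ _ _)

    0≤D : ∀ t y → 0# ≤ D t y
    0≤D t y = let j , _ , D≡q = D-attained t y in subst (0# ≤_) (sym D≡q) (0≤q (center j) y)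

    D-lipschitz : ∀ t x y → D t y ≤ # 2 * D t x + # 2 * q x y
    D-lipschitz t x y = let j , j≤t , D≡q = D-attained t x in
      ≤-trans (D≤center y j≤t) (subst (λ z → q (center j) y ≤ # 2 * z + # 2 * q x y) (sym D≡q) (q-tri (center j) x y))

  least : {P : ℕ → Set} → ∀ m → P m → ∃[ j ] (j ℕ.≤ m × P j × (∀ i → i ℕ.< j → ¬ P i))
  least {P} m Pm with below m
    where
    below : ∀ m → (∀ i → i ℕ.< m → ¬ P i) ⊎ (∃[ j ] (j ℕ.< m × P j × (∀ i → i ℕ.< j → ¬ P i)))
    below zero = inj₁ λ _ ()
    below (suc m) with below m
    ... | inj₂ (j , j<m , rest) = inj₂ (j , ℕₚ.m<n⇒m<1+n j<m , rest)
    ... | inj₁ none with lem (P m)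
    ...   | yes Pm = inj₂ (m , ℕₚ.≤-refl , Pm , none)
    ...   | no ¬Pm = inj₁ λ i i≤m Pi → case i i≤m Pi (ℕₚ.m≤n⇒m<n∨m≡n (ℕₚ.≤-pred i≤m))
      where
      case : ∀ i → i ℕ.< suc m → P i → i ℕ.< m ⊎ i ≡ m → ⊥
      case i _ Pi (inj₁ i<m)  = none i i<m Pi
      case i _ Pi (inj₂ refl) = ¬Pm Pi
  ... | inj₁ none = m , ℕₚ.≤-refl , Pm , none
  ... | inj₂ (j , j<m , rest) = j , ℕₚ.<⇒≤ j<m , rest

  -- Farthest-first traversal of the optimal centers

  module Gonzalez (M : QuasiMetric) (k : ℕ) (0<k : 0 ℕ.< k) where
    open QuasiMetric M
    open Covering M k (λ D → D) 0 public

    δ : ℕ → ℝ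
    δ m = D m (pick m)

    pick-<k : ∀ m → pick m ℕ.< k
    pick-<k m = argmax-< k (λ i _ → 0≤D m i) 0<k

    center-<k : ∀ j → center j ℕ.< k
    center-<k zero    = 0<k
    center-<k (suc m) = pick-<k m

    D≤δ : ∀ m {i} → i ℕ.< k → D m i ≤ δ m
    D≤δ m = argmax-max k (λ i _ → 0≤D m i)

    δ-separated : ∀ {j m} → j ℕ.≤ m → δ m ≤ q (center j) (pick m)
    δ-separated {j} {m} j≤m = D≤center (pick m) j≤m

    -- Among `k + 1` successive choices from `k` indices one repeats, and a repeated pick has
    -- distance 0 to an earlier center.
    δ-vanishes : ∃[ m ] δ m ≤ 0#
    δ-vanishes with pigeonhole (ℕₚ.n<1+n k) (λ i → fromℕ< (center-<k (toℕ i)))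
    ... | i , j , i<j , ci≡cj = collapse (toℕ i) (toℕ j) i<j
            (trans (sym (toℕ-fromℕ< (center-<k (toℕ i)))) (trans (cong toℕ ci≡cj) (toℕ-fromℕ< (center-<k (toℕ j)))))
      where
      collapse : ∀ i j → i ℕ.< j → center i ≡ center j → ∃[ m ] δ m ≤ 0#
      collapse i (suc m) (ℕ.s≤s i≤m) ci≡cj = m , subst (δ m ≤_)
        (trans (cong (λ c → q c (pick m)) ci≡cj) (q-refl (pick m))) (δ-separated i≤m)

    -- Stop the traversal at the first stage with `16 δ ≤ ρ` and represent `i` by its nearest center
    -- so far. Whatever was picked before that stage was picked at a scale above `ρ / 16`.
    net : ∀ {ρ} → 0# < ρ → ∀ {i} → i ℕ.< k →
      ∃[ j ] (# 16 * q (center j) i ≤ ρ × (∀ m → m ℕ.< j → ρ < # 16 * δ m))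
    net {ρ} 0<ρ {i} i<k =
      let m₀ , δ≤0 = δ-vanishes
          m , _ , 16δ≤ρ , before = least {λ m → # 16 * δ m ≤ ρ} m₀
            (≤-trans (16 ⊙ δ≤0) (subst (_≤ ρ) (sym (zeroʳ (# 16))) (proj₁ 0<ρ)))
          j , j≤m , D≡q = D-attained m i
      in j , subst (λ z → # 16 * z ≤ ρ) D≡q (≤-trans (16 ⊙ D≤δ m i<k) 16δ≤ρ)
           , λ m′ m′<j → ≰⇒> (before m′ (ℕₚ.<-≤-trans m′<j j≤m))

    -- The later representative of the pair, to which a separation of `i` from `i′` is charged.
    -- `lower` and `upper` tie its scale `δ m` to the distance of the pair, so two pairs with the
    -- same stage `m` have distances within a factor 80.
    record Landmark (i i′ : ℕ) : Set where
      field
        m       : ℕ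
        ω       : ℕ
        ω∈      : ω ≡ i ⊎ ω ≡ i′
        close   : # 16 * q (pick m) ω ≤ q i i′
        lower   : q i i′ < # 16 * δ m
        upper   : δ m ≤ # 5 * q i i′

    private
      -- The earlier representative was already a center when the later one was picked, so `δ m` is
      -- at most their distance, which is at most `(2/16 + 4 + 4/16) q i i′`.
      later : ∀ {i i′ a b j j′} → j ℕ.< j′ → q a b ≡ q i i′ → (∀ m → m ℕ.< j′ → q i i′ < # 16 * δ m) →
        # 16 * q (center j) a ≤ q i i′ → # 16 * q (center j′) b ≤ q i i′ →
        b ≡ i ⊎ b ≡ i′ → Landmark i i′
      later {i} {i′} {a} {b} {j} {suc m} (ℕ.s≤s j≤m) Q≡ before near near′ b∈ = record
        { m = m ; ω = b ; ω∈ = b∈ ; close = near′ ; lower = before m ℕₚ.≤-refl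
        ; upper = linarith
            (δ m ∷ q (center j) a ∷ q (center j) (pick m) ∷ q b (pick m) ∷ q a (pick m) ∷ q a b ∷ q i i′ ∷ [])
            (λ d u v w x y Q → (16 , d ⊑ v) ∷ (16 , v ⊑ 2 ⋆ u ∔ 2 ⋆ x) ∷ (32 , x ⊑ 2 ⋆ y ∔ 2 ⋆ w)
              ∷ (2 , 16 ⋆ u ⊑ Q) ∷ (4 , 16 ⋆ w ⊑ Q) ∷ (64 , y ⊑ Q) ∷ (10 , 𝟎 ⊑ Q) ∷ []
              ⊢ 16 · d ⊑ 5 ⋆ Q) refl
            (δ-separated j≤m , q-tri (center j) a (pick m) , q-tri a b (pick m) , near
            , subst (λ z → # 16 * z ≤ q i i′) (q-sym (pick m) b) near′ , ≤-reflexive Q≡ , 0≤q i i′ , tt) }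

      -- A common representative would give `q i i′ ≤ (2/16 + 2/16) q i i′`. Hence one of the two is
      -- later than the other.
      separated : ∀ {i i′ j} → 0# < q i i′ → # 16 * q (center j) i ≤ q i i′ →
        # 16 * q (center j) i′ ≤ q i i′ → ⊥
      separated {i} {i′} {j} 0<Q near near′ = <⇒≱ 0<Q (linarith
        (q i (center j) ∷ q (center j) i′ ∷ q i i′ ∷ [])
        (λ a b Q → (8 , Q ⊑ 2 ⋆ a ∔ 2 ⋆ b) ∷ (1 , 16 ⋆ a ⊑ Q) ∷ (1 , 16 ⋆ b ⊑ Q) ∷ [] ⊢ 6 · Q ⊑ 𝟎) refl
        (q-tri i (center j) i′ , subst (λ z → # 16 * z ≤ q i i′) (q-sym (center j) i) near , near′ , tt))

    landmark : ∀ {i i′} → i ℕ.< k → i′ ℕ.< k → 0# < q i i′ → Landmark i i′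
    landmark {i} {i′} i<k i′<k 0<Q =
      let j , near , before = net 0<Q i<k
          j′ , near′ , before′ = net 0<Q i′<k
      in compare j j′ near near′ before before′ (ℕₚ.<-cmp j j′)
      where
      compare : ∀ j j′ → # 16 * q (center j) i ≤ q i i′ → # 16 * q (center j′) i′ ≤ q i i′ →
        (∀ m → m ℕ.< j → q i i′ < # 16 * δ m) → (∀ m → m ℕ.< j′ → q i i′ < # 16 * δ m) →
        Tri (j ℕ.< j′) (j ≡ j′) (j′ ℕ.< j) → Landmark i i′
      compare j j′ near near′ before before′ (tri< j<j′ _ _) = later j<j′ refl before′ near near′ (inj₂ refl)
      compare j j  near near′ before before′ (tri≈ _ refl _) = ⊥-elim (separated {j = j} 0<Q near near′)
      compare j j′ near near′ before before′ (tri> _ _ j′<j) = later j′<j (q-sym i′ i) before near′ near (inj₁ refl)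

-- The seeding phase

module Greedy (R : Reals) where
  open FarthestPoint R public

  -- A charge of `c` made if `Φ` holds. The conditions quantify over picks and are decided by `lem`,
  -- which is open to the analysis though not to the program.
  when : Set → ℝ → ℝ
  when Φ c with lem Φ
  ... | yes _ = c
  ... | no  _ = 0#

  when-yes : ∀ {Φ : Set} {c} → Φ → when Φ c ≡ c
  when-yes {Φ} φ with lem Φ
  ... | yes _ = refl
  ... | no ¬φ = ⊥-elim (¬φ φ)

  when-cases : ∀ Φ c → when Φ c ≡ 0# ⊎ (Φ × when Φ c ≡ c)
  when-cases Φ c with lem Φ
  ... | yes φ = inj₂ (φ , refl)
  ... | no  _ = inj₁ refl

  0≤when : ∀ Φ {c} → 0# ≤ c → 0# ≤ when Φ c
  0≤when Φ 0≤c with lem Φ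
  ... | yes _ = 0≤c
  ... | no  _ = ≤-refl

  when-≤ : ∀ Φ {c} → 0# ≤ c → when Φ c ≤ c
  when-≤ Φ 0≤c with lem Φ
  ... | yes _ = ≤-refl
  ... | no  _ = 0≤c

  by-cases : ∀ {P : Set} (Φ : Set) → (Φ → P) → (¬ Φ → P) → P
  by-cases Φ f g with lem Φ
  ... | yes φ = f φ
  ... | no ¬φ = g ¬φ

  not-all : ∀ {k} {P : ℕ → Set} → ¬ (∀ i → i ℕ.< k → P i) → ∃[ i ] (i ℕ.< k × ¬ P i)
  not-all {k} {P} ¬all = by-cases (∃[ i ] (i ℕ.< k × ¬ P i)) (λ h → h)
    (λ none → ⊥-elim (¬all λ i i<k → by-cases (P i) (λ h → h) (λ ¬Pi → ⊥-elim (none (i , i<k , ¬Pi)))))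

  score : ℕ → (ℕ → ℕ → ℝ) → ℕ → (ℕ → ℝ) → ℕ → ℝ
  score n q A D x = ∑ n (λ y → excess (# A * q x y) (D y))

  0≤score : ∀ n q A D x → 0# ≤ score n q A D x
  0≤score n q A D x = ∑-nonneg n (λ y _ → 0≤excess _ _)

  module Clustering (M : QuasiMetric) (n k : ℕ) (0<n : 0 ℕ.< n)
    (o : ℕ → ℕ) (o<n : ∀ {i} → i ℕ.< k → o i ℕ.< n)
    (ν : ℕ → ℕ) (ν<k : ∀ {y} → y ℕ.< n → ν y ℕ.< k) where
    open QuasiMetric M

    e : ℕ → ℝ
    e y = q (o (ν y)) y

    0≤e : ∀ y → 0# ≤ e y
    0≤e y = 0≤q _ _

    cost : ℝ
    cost = ∑ n e

    0≤cost : 0# ≤ cost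
    0≤cost = ∑-nonneg n (λ y _ → 0≤e y)

    best : ℕ → (ℕ → ℝ) → ℕ
    best A D = argmax n (score n q A D)

    best-<n : ∀ A D → best A D ℕ.< n
    best-<n A D = argmax-< n (λ x _ → 0≤score n q A D x) 0<n

    best-max : ∀ A D {x} → x ℕ.< n → score n q A D x ≤ score n q A D (best A D)
    best-max A D = argmax-max n (λ x _ → 0≤score n q A D x)

    -- From its own optimal center `y` gains at least `D y - A e y`. These gains are part of the
    -- scores of the `k` optimal centers, none of which exceeds the best score.
    relaxation : ∀ A D → ∑ n D ≤ # k * score n q A D (best A D) + # A * cost
    relaxation A D = ≤-trans
      (∑-mono n {h = λ y → ∑ k (λ i → excess (# A * q (o i) y) (D y)) + # A * e y} pointwise)
      (≤-trans
        (≤-reflexive (trans (∑-+ n _ _) (cong₂ _+_ (∑-swap n k _) (∑-*ˡ n (# A) e))))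
        (+-monoˡ-≤ _ (≤-trans (∑-mono k (λ i i<k → best-max A D (o<n i<k))) (≤-reflexive (∑-const k _)))))
      where
      pointwise : ∀ y → y ℕ.< n → D y ≤ ∑ k (λ i → excess (# A * q (o i) y) (D y)) + # A * e y
      pointwise y y<n = lin
        (≤-trans (-≤excess (# A * e y) (D y))
          (∑-term k {λ i → excess (# A * q (o i) y) (D y)} (λ i _ → 0≤excess _ _) (ν<k y<n)))
        (solve 3 (λ d a s → d :+ s := s :+ a :+ (d :- a)) refl (D y) (# A * e y) _)

    -- With `N = 1` the score of a point measures the decrease of the cost when it is added.
    greedy-gain : ∀ D → ∑ n (next n q (score n q 1) D) + score n q 1 D (best 1 D) ≤ ∑ n D
    greedy-gain D = subst (_≤ ∑ n D) (∑-+ n _ _) (∑-mono n λ y _ → pointwise (q (best 1 D) y) (D y))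
      where
      pointwise : ∀ a v → (v ⊓ a) + excess (# 1 * a) v ≤ v
      pointwise a v = by-cases (# 1 * a ≤ v)
        (λ h → lin (⊓-≤ʳ v a) (trans (cong (λ z → (v ⊓ a) + z + a) (excess-pos h))
          (solve 3 (λ m a v → m :+ (v :- κ 1 :* a) :+ a := v :+ m) refl (v ⊓ a) a v)))
        (λ h → ≤-trans (≤-reflexive (trans (cong ((v ⊓ a) +_) (excess-neg h)) (+-identityʳ _))) (⊓-≤ˡ v a))

    -- With gain `g`, new sum `S′` and old sum `S`: `k S′ ≤ k S - k g` and `S ≤ k g + cost` give
    -- `k S′ ≤ (k - 1) S + cost`. The factor `1 - 1/k` is stated without division.
    shrink : ∀ {D p p′} → 0 ℕ.< k → ∑ n D ≤ cost + p * cost → # k * p′ ≡ # k * p + - p →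
      ∑ n (next n q (score n q 1) D) ≤ cost + p′ * cost
    shrink {D} {p} {p′} 0<k h kp′ = *-cancelˡ-≤ (0<# k {{ℕ.>-nonZero 0<k}}) (lin
      (*-monoʳ-≤ (0≤# k) (greedy-gain D) ⟨+⟩ relaxation 1 D ⟨+⟩ *-monoʳ-≤ (≤⇒nonneg (#-mono 0<k)) h)
      (trans (solve 6 (λ K S′ g S c p → K :* S′ :+ (K :* S :+ (K :* g :+ κ 1 :* c) :+ (K :- κ 1) :* (c :+ p :* c))
          := (K :* c :+ (K :* p :- p) :* c) :+ (K :* (S′ :+ g) :+ S :+ (K :- κ 1) :* S)) refl
          (# k) (∑ n (next n q (score n q 1) D)) (score n q 1 D (best 1 D)) (∑ n D) cost p)
        (cong (_+ (# k * (∑ n (next n q (score n q 1) D) + score n q 1 D (best 1 D)) + ∑ n D + (# k + - # 1) * ∑ n D))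
          (trans (cong (λ z → # k * cost + z * cost) (sym kp′))
            (solve 3 (λ K c p → K :* c :+ K :* p :* c := K :* (c :+ p :* c)) refl (# k) cost p′)))))

  -- B exceeds all constants lost to the relaxed triangle inequality in
  -- split-injective, and A = 16 B.
  A B : ℕ
  A = 524288
  B = 32768

  module SeedingPhase (M : QuasiMetric) (n k T : ℕ) (0<n : 0 ℕ.< n) (0<k : 0 ℕ.< k)
    (o : ℕ → ℕ) (o<n : ∀ {i} → i ℕ.< k → o i ℕ.< n)
    (ν : ℕ → ℕ) (ν<k : ∀ {y} → y ℕ.< n → ν y ℕ.< k) where
    open QuasiMetric M
    open Clustering M n k 0<n o o<n ν ν<k
    open Covering M n (score n q A) 0

    x : ℕ → ℕ
    x = pick

    -- The scale of a pick: closeness of `x t` to optimal centers is measured against its distance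
    -- to the earlier picks.
    r : ℕ → ℝ
    r t = D t (x t)

    λ₀ : ℝ
    λ₀ = score n q A (D T) (x T)

    0≤λ₀ : 0# ≤ λ₀
    0≤λ₀ = 0≤score n q A (D T) (x T)

    -- Scores only fall as `D` falls, so the final candidate was worth at least `λ₀` at time `t`,
    -- and `x t` was preferred to it.
    λ₀≤ : ∀ {t} → t ℕ.≤ T → λ₀ ≤ score n q A (D t) (x t)
    λ₀≤ {t} t≤T = ≤-trans (∑-mono n (λ y _ → excess-mono _ (D-antitone y t≤T)))
      (best-max A (D t) (best-<n A (D T)))

    centers : QuasiMetric
    centers = record { q = λ i j → q (o i) (o j) ; 0≤q = λ i j → 0≤q (o i) (o j)
      ; q-refl = λ i → q-refl (o i) ; q-sym = λ i j → q-sym (o i) (o j)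
      ; q-tri = λ i j l → q-tri (o i) (o j) (o l) }

    module G = Gonzalez centers k 0<k

    -- Three strengths of closeness. `near` marks the centers a pick lies close to, and `meets`
    -- detects a later pick that arrives at one of them. Failure of the weakest, `nearish`, means
    -- that the later pick separates a center from the one it meets. The gaps absorb the losses of
    -- `q-tri`.
    near meets nearish : ℕ → ℕ → Set
    near    t i = # B * q (x t) (o i) ≤ r t
    meets   t i = # 512 * q (x t) (o i) ≤ r t
    nearish t i = # 16 * q (x t) (o i) ≤ r t

    0≤r : ∀ t → 0# ≤ r t
    0≤r t = 0≤D t (x t)

    near⇒meets : ∀ t i → near t i → meets t i
    near⇒meets t i h = linarith (q (x t) (o i) ∷ r t ∷ [])
      (λ a r → (1 , B ⋆ a ⊑ r) ∷ (32256 , 𝟎 ⊑ a) ∷ [] ⊢ 1 · 512 ⋆ a ⊑ r) refl (h , 0≤q _ _ , tt)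

    -- `D t y` is at most `2 r t + 2 q (x t) y`, and `r t ≤ B q (x t) (o i)`, which is at most `2 B`
    -- times the sum of the distances of `y` to `x t` and to `o i`. Since `A = 16 B`, the assumption
    -- that `y` gains absorbs every term in `q (x t) y`.
    far-cost : ∀ t i y → ¬ near t i → # A * q (x t) y ≤ D t y → D t y ≤ # A * q (o i) y
    far-cost t i y far inside = linarith
      (D t y ∷ r t ∷ q (x t) y ∷ q (x t) (o i) ∷ q (o i) y ∷ q y (o i) ∷ [])
      (λ E r a c w w′ → (4 , E ⊑ 2 ⋆ r ∔ 2 ⋆ a) ∷ (8 , r ⊑ B ⋆ c) ∷ (262144 , c ⊑ 2 ⋆ a ∔ 2 ⋆ w′)
        ∷ (2 , A ⋆ a ⊑ E) ∷ (524280 , 𝟎 ⊑ a) ∷ (A , w′ ⊑ w) ∷ (1 , 𝟎 ⊑ E) ∷ [] ⊢ 1 · E ⊑ A ⋆ w)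
      refl (D-lipschitz t (x t) y , ≰⇒≥ far , q-tri (x t) y (o i) , inside , 0≤q _ _
           , ≤-reflexive (q-sym y (o i)) , 0≤D t y , tt)

    -- Between two picks that compete for the same points, the gain at t′ must
    -- have been compensated at t by points that t′ serves badly.
    exchange : ∀ {E E′ a b c} → E′ ≤ E → E′ ≤ a → 0# ≤ a → 0# ≤ b → 0# ≤ c →
      (# A * a ≤ E → a < b → E ≤ c ⊎ # A * b ≤ c) →
      excess (# A * a) E + excess (# A * b) E′ ≤ excess (# A * b) E + c
    exchange {E} {E′} {a} {b} {c} E′≤E E′≤a 0≤a 0≤b 0≤c charge =
      by-cases (# A * b ≤ E′) served unserved
      where
      goal : Set
      goal = excess (# A * a) E + excess (# A * b) E′ ≤ excess (# A * b) E + c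

      X Y Z : ℝ
      X = excess (# A * a) E
      Y = excess (# A * b) E′
      Z = excess (# A * b) E

      E≤Z : E ≤ Z + # A * b
      E≤Z = lin (-≤excess (# A * b) E) (solve 3 (λ E z w → E :+ z := z :+ w :+ (E :- w)) refl E Z (# A * b))

      X-pos : # A * a ≤ E → X + # A * a ≤ E
      X-pos h = ≤-reflexive (trans (cong (_+ # A * a) (excess-pos h))
        (solve 2 (λ E w → E :- w :+ w := E) refl E (# A * a)))

      Y-pos : # A * b ≤ E′ → Y + # A * b ≤ E′
      Y-pos h = ≤-reflexive (trans (cong (_+ # A * b) (excess-pos h))
        (solve 2 (λ E w → E :- w :+ w := E) refl E′ (# A * b)))

      -- By the time of `t′` the pick `t` already serves `y`, so `E′ ≤ a`: whatever `y` still gains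
      -- at `t′` is covered by the `A a` subtracted from its gain at `t`.
      served : # A * b ≤ E′ → goal
      served Ab≤E′ = by-cases (# A * a ≤ E)
        (λ Aa≤E → linarith (X ∷ Y ∷ Z ∷ E ∷ E′ ∷ a ∷ b ∷ c ∷ [])
          (λ X Y Z E E′ a b c → (1 , X ∔ A ⋆ a ⊑ E) ∷ (1 , Y ∔ A ⋆ b ⊑ E′) ∷ (1 , E ⊑ Z ∔ A ⋆ b)
            ∷ (1 , E′ ⊑ a) ∷ (524287 , 𝟎 ⊑ a) ∷ (1 , 𝟎 ⊑ c) ∷ [] ⊢ 1 · X ∔ Y ⊑ Z ∔ c) refl
          (X-pos Aa≤E , Y-pos Ab≤E′ , E≤Z , E′≤a , 0≤a , 0≤c , tt))
        (λ Aa≰E → linarith (X ∷ Y ∷ Z ∷ E ∷ E′ ∷ a ∷ b ∷ c ∷ [])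
          (λ X Y Z E E′ a b c → (1 , X ⊑ 𝟎) ∷ (1 , Y ∔ A ⋆ b ⊑ E′) ∷ (1 , E ⊑ Z ∔ A ⋆ b)
            ∷ (1 , E′ ⊑ E) ∷ (1 , 𝟎 ⊑ c) ∷ [] ⊢ 1 · X ∔ Y ⊑ Z ∔ c) refl
          (≤-reflexive (excess-neg Aa≰E) , Y-pos Ab≤E′ , E≤Z , E′≤E , 0≤c , tt))

      unserved : ¬ # A * b ≤ E′ → goal
      unserved Ab≰E′ = by-cases (# A * a ≤ E)
        (λ Aa≤E → by-cases (b ≤ a)
          (λ b≤a → linarith (X ∷ Y ∷ Z ∷ E ∷ a ∷ b ∷ c ∷ [])
            (λ X Y Z E a b c → (1 , X ∔ A ⋆ a ⊑ E) ∷ (1 , Y ⊑ 𝟎) ∷ (1 , E ⊑ Z ∔ A ⋆ b)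
              ∷ (A , b ⊑ a) ∷ (1 , 𝟎 ⊑ c) ∷ [] ⊢ 1 · X ∔ Y ⊑ Z ∔ c) refl
            (X-pos Aa≤E , Y≤0 , E≤Z , b≤a , 0≤c , tt))
          (λ b≰a → charged Aa≤E (charge Aa≤E (≰⇒> b≰a))))
        (λ Aa≰E → linarith (X ∷ Y ∷ Z ∷ c ∷ [])
          (λ X Y Z c → (1 , X ⊑ 𝟎) ∷ (1 , Y ⊑ 𝟎) ∷ (1 , 𝟎 ⊑ Z) ∷ (1 , 𝟎 ⊑ c) ∷ [] ⊢ 1 · X ∔ Y ⊑ Z ∔ c) refl
          (≤-reflexive (excess-neg Aa≰E) , Y≤0 , 0≤excess _ _ , 0≤c , tt))
        where
        Y≤0 : Y ≤ 0#
        Y≤0 = ≤-reflexive (excess-neg Ab≰E′)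

        charged : # A * a ≤ E → E ≤ c ⊎ # A * b ≤ c → goal
        charged Aa≤E (inj₁ E≤c) = linarith (X ∷ Y ∷ Z ∷ E ∷ a ∷ c ∷ [])
          (λ X Y Z E a c → (1 , X ∔ A ⋆ a ⊑ E) ∷ (1 , Y ⊑ 𝟎) ∷ (1 , E ⊑ c) ∷ (1 , 𝟎 ⊑ Z) ∷ (A , 𝟎 ⊑ a) ∷ []
            ⊢ 1 · X ∔ Y ⊑ Z ∔ c) refl
          (X-pos Aa≤E , Y≤0 , E≤c , 0≤excess _ _ , 0≤a , tt)
        charged Aa≤E (inj₂ Ab≤c) = linarith (X ∷ Y ∷ Z ∷ E ∷ a ∷ b ∷ c ∷ [])
          (λ X Y Z E a b c → (1 , X ∔ A ⋆ a ⊑ E) ∷ (1 , Y ⊑ 𝟎) ∷ (1 , E ⊑ Z ∔ A ⋆ b) ∷ (1 , A ⋆ b ⊑ c) ∷ (A , 𝟎 ⊑ a) ∷ []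
            ⊢ 1 · X ∔ Y ⊑ Z ∔ c) refl
          (X-pos Aa≤E , Y≤0 , E≤Z , Ab≤c , 0≤a , tt)

    record First (t t′ : ℕ) : Set where
      field
        t<t′   : t ℕ.< t′
        t′<T   : t′ ℕ.< T
        i      : ℕ
        i<k    : i ℕ.< k
        near-i : near t i
        meet-i : meets t′ i
        before : ∀ s → t ℕ.< s → s ℕ.< t′ → ∀ j → j ℕ.< k → near t j → ¬ meets s j

    Last : ℕ → ℕ → Set
    Last t i = near t i × (∀ s → t ℕ.< s → s ℕ.< T → ∀ j → j ℕ.< k → near t j → ¬ meets s j)

    record Split (t p : ℕ) : Set where
      field
        t′      : ℕ
        first   : First t t′
      open First first public
      field
        i′      : ℕ
        i′<k    : i′ ℕ.< k
        near-i′ : near t i′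
        far-i′  : ¬ nearish t′ i′
        0<Q     : 0# < q (o i) (o i′)
        mark    : G.Landmark i i′
      open G.Landmark mark public
      field
        pick≡p  : G.pick m ≡ p

    -- Within `r t / 512` of one center and farther than `r t / 16` from the other, a pick can only
    -- separate centers whose distance is comparable to its scale.
    split-apart : ∀ t i i′ → meets t i → ¬ nearish t i′ → r t < # 64 * q (o i) (o i′)
    split-apart t i i′ meet far = ≰⇒> λ 64Q≤r → <⇒≱ (≰⇒> far) (linarith
      (r t ∷ q (x t) (o i) ∷ q (x t) (o i′) ∷ q (o i) (o i′) ∷ [])
      (λ r a b Q → (1 , 512 ⋆ a ⊑ r) ∷ (256 , b ⊑ 2 ⋆ a ∔ 2 ⋆ Q) ∷ (8 , 64 ⋆ Q ⊑ r) ∷ (7 , 𝟎 ⊑ r) ∷ []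
        ⊢ 16 · 16 ⋆ b ⊑ r) refl (meet , q-tri (x t) (o i) (o i′) , 64Q≤r , 0≤r t , tt))

    split-positive : ∀ t i i′ → meets t i → ¬ nearish t i′ → 0# < q (o i) (o i′)
    split-positive t i i′ meet far = ≰⇒> λ Q≤0 → <⇒≱ (split-apart t i i′ meet far) (linarith
      (r t ∷ q (o i) (o i′) ∷ []) (λ r Q → (64 , Q ⊑ 𝟎) ∷ (1 , 𝟎 ⊑ r) ∷ [] ⊢ 1 · 64 ⋆ Q ⊑ r) refl (Q≤0 , 0≤r t , tt))

    -- A shared representative makes the pair distances `Q` and `Q′` comparable. As `s` is near both
    -- centers of its own pair, `Q′`, and with it `Q`, is tiny against `r s`; and `x s` is close to
    -- `p`, hence to the center `S.ω` near `t`. Comparing `s` with the pick `S.t′` that first meets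
    -- a center near `t` is then contradictory in each order.
    split-injective : ∀ {t s p} → t ℕ.< s → s ℕ.< T → Split t p → Split s p → ⊥
    split-injective {t} {s} {p} t<s s<T S S′ = same (ℕₚ.<-cmp S.m S′.m)
      where
      module S = Split S
      module S′ = Split S′

      Q Q′ u : ℝ
      Q  = q (o S.i) (o S.i′)
      Q′ = q (o S′.i) (o S′.i′)
      u  = q (x s) (o p)

      -- Picking the same center twice makes the second scale 0, while a landmark has positive
      -- scale.
      repeated : ∀ {m m′ Q} → m ℕ.< m′ → G.pick m ≡ p → G.pick m′ ≡ p → 0# < Q → ¬ (Q < # 16 * G.δ m′)
      repeated {m} {m′} {Q} m<m′ ≡p ≡p′ 0<Q Q<16δ = <⇒≱ (≤-<-trans (proj₁ 0<Q) Q<16δ)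
        (≤-trans (16 ⊙ G.δ-separated {suc m} m<m′)
          (≤-reflexive (trans (cong (# 16 *_) (trans (cong₂ (λ a b → q (o a) (o b)) ≡p ≡p′) (q-refl (o p)))) (zeroʳ (# 16)))))

      16δ≤80Q′ : S.m ≡ S′.m → Q ≤ # 80 * Q′
      16δ≤80Q′ m≡m′ = linarith (Q ∷ Q′ ∷ G.δ S.m ∷ [])
        (λ Q Q′ d → (1 , Q ⊑ 16 ⋆ d) ∷ (16 , d ⊑ 5 ⋆ Q′) ∷ [] ⊢ 1 · Q ⊑ 80 ⋆ Q′) refl
        (proj₁ S.lower , subst (λ m → G.δ m ≤ # 5 * Q′) (sym m≡m′) S′.upper , tt)

      near-ω : near t S.ω
      near-ω with S.ω∈
      ... | inj₁ ω≡i  = subst (near t) (sym ω≡i) S.near-i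
      ... | inj₂ ω≡i′ = subst (near t) (sym ω≡i′) S.near-i′

      near-ω′ : near s S′.ω
      near-ω′ with S′.ω∈
      ... | inj₁ ω≡i  = subst (near s) (sym ω≡i) S′.near-i
      ... | inj₂ ω≡i′ = subst (near s) (sym ω≡i′) S′.near-i′

      ω<k : S.ω ℕ.< k
      ω<k with S.ω∈
      ... | inj₁ ω≡i  = subst (ℕ._< k) (sym ω≡i) S.i<k
      ... | inj₂ ω≡i′ = subst (ℕ._< k) (sym ω≡i′) S.i′<k

      i-ω : q (o S.i) (o S.ω) ≤ Q
      i-ω with S.ω∈
      ... | inj₁ ω≡i  = subst (_≤ Q) (sym (trans (cong (λ j → q (o S.i) (o j)) ω≡i) (q-refl (o S.i)))) (0≤q _ _)
      ... | inj₂ ω≡i′ = ≤-reflexive (cong (λ j → q (o S.i) (o j)) ω≡i′)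

      close : # 16 * q (o S.ω) (o p) ≤ Q
      close = subst (λ z → # 16 * z ≤ Q) (trans (cong (λ a → q (o a) (o S.ω)) S.pick≡p) (q-sym _ _)) S.close

      close′ : # 16 * q (o S′.ω) (o p) ≤ Q′
      close′ = subst (λ z → # 16 * z ≤ Q′) (trans (cong (λ a → q (o a) (o S′.ω)) S′.pick≡p) (q-sym _ _)) S′.close

      BQ′≤4r : # B * Q′ ≤ # 4 * r s
      BQ′≤4r = linarith (Q′ ∷ r s ∷ q (o S′.i) (x s) ∷ q (x s) (o S′.i) ∷ q (x s) (o S′.i′) ∷ [])
        (λ Q r a a′ b → (B , Q ⊑ 2 ⋆ a ∔ 2 ⋆ b) ∷ (65536 , a ⊑ a′) ∷ (2 , B ⋆ a′ ⊑ r) ∷ (2 , B ⋆ b ⊑ r) ∷ []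
          ⊢ 1 · B ⋆ Q ⊑ 4 ⋆ r) refl
        (q-tri _ (x s) _ , ≤-reflexive (q-sym _ _) , S′.near-i , S′.near-i′ , tt)

      Bu≤3r : # B * u ≤ # 3 * r s
      Bu≤3r = linarith (u ∷ r s ∷ q (x s) (o S′.ω) ∷ q (o S′.ω) (o p) ∷ Q′ ∷ [])
        (λ u r a b Q → (32768 , u ⊑ 2 ⋆ a ∔ 2 ⋆ b) ∷ (2 , B ⋆ a ⊑ r) ∷ (4096 , 16 ⋆ b ⊑ Q) ∷ (1 , 4096 ⋆ Q ⊑ r) ∷ []
          ⊢ 1 · B ⋆ u ⊑ 3 ⋆ r) refl
        (q-tri (x s) (o S′.ω) (o p) , near-ω′ , close′
        , linarith (Q′ ∷ r s ∷ []) (λ Q r → (1 , B ⋆ Q ⊑ 4 ⋆ r) ∷ (4 , 𝟎 ⊑ r) ∷ [] ⊢ 8 · 4096 ⋆ Q ⊑ r) refl (BQ′≤4r , 0≤r s , tt) , tt)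

      BQ≤320r : Q ≤ # 80 * Q′ → # B * Q ≤ # 320 * r s
      BQ≤320r h = linarith (Q ∷ Q′ ∷ r s ∷ [])
        (λ Q Q′ r → (B , Q ⊑ 80 ⋆ Q′) ∷ (80 , B ⋆ Q′ ⊑ 4 ⋆ r) ∷ [] ⊢ 1 · B ⋆ Q ⊑ 320 ⋆ r) refl (h , BQ′≤4r , tt)

      meets-ω : Q ≤ # 80 * Q′ → meets s S.ω
      meets-ω h = linarith (q (x s) (o S.ω) ∷ u ∷ q (o p) (o S.ω) ∷ q (o S.ω) (o p) ∷ Q ∷ r s ∷ [])
        (λ z u a a′ Q r → (32768 , z ⊑ 2 ⋆ u ∔ 2 ⋆ a) ∷ (2 , B ⋆ u ⊑ 3 ⋆ r) ∷ (65536 , a ⊑ a′) ∷ (4096 , 16 ⋆ a′ ⊑ Q)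
          ∷ (1 , 4096 ⋆ Q ⊑ 40 ⋆ r) ∷ (18 , 𝟎 ⊑ r) ∷ [] ⊢ 64 · 512 ⋆ z ⊑ r) refl
        (q-tri _ (o p) _ , Bu≤3r , ≤-reflexive (q-sym _ _) , close
        , linarith (Q ∷ r s ∷ []) (λ Q r → (1 , B ⋆ Q ⊑ 320 ⋆ r) ∷ [] ⊢ 8 · 4096 ⋆ Q ⊑ 40 ⋆ r) refl (BQ≤320r h , tt)
        , 0≤r s , tt)

      same : Tri (S.m ℕ.< S′.m) (S.m ≡ S′.m) (S′.m ℕ.< S.m) → ⊥
      same (tri< m<m′ _ _) = repeated m<m′ S.pick≡p S′.pick≡p S′.0<Q S′.lower
      same (tri> _ _ m′<m) = repeated m′<m S′.pick≡p S.pick≡p S.0<Q S.lower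
      same (tri≈ _ m≡m′ _) = order (ℕₚ.<-cmp s S.t′)
        where
        Q≤80Q′ : Q ≤ # 80 * Q′
        Q≤80Q′ = 16δ≤80Q′ m≡m′

        r≤64Q : r S.t′ ≤ # 64 * Q
        r≤64Q = proj₁ (split-apart S.t′ S.i S.i′ S.meet-i S.far-i′)

        order : Tri (s ℕ.< S.t′) (s ≡ S.t′) (S.t′ ℕ.< s) → ⊥
        -- `s` would have met a center near `t` before the first pick to do so.
        order (tri< s<t′ _ _) = S.before s t<s s<t′ S.ω ω<k near-ω (meets-ω Q≤80Q′)
        -- The separating pick has scale at most `64 Q`, whereas `Q` is at most `320 / B` times that
        -- of `s`.
        order (tri≈ _ s≡t′ _) = <⇒≱ S.0<Q (linarith (Q ∷ r s ∷ [])
          (λ Q r → (1 , B ⋆ Q ⊑ 320 ⋆ r) ∷ (320 , r ⊑ 64 ⋆ Q) ∷ [] ⊢ 12288 · Q ⊑ 𝟎) refl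
          (BQ≤320r Q≤80Q′ , subst (λ z → r z ≤ # 64 * Q) (sym s≡t′) r≤64Q , tt))
        -- Now `x S.t′` is already a center at time `s`, so `r s` is at most its distance to `x s`.
        -- The path through `S.i`, `S.ω` and `p` bounds that distance by `O(Q)` plus a small
        -- fraction of `r s`.
        order (tri> _ _ t′<s) = <⇒≱ S.0<Q (linarith
          (Q ∷ r s ∷ r S.t′ ∷ u ∷ q (o p) (x s) ∷ q (x S.t′) (x s) ∷ q (x S.t′) (o p) ∷ q (x S.t′) (o S.i)
            ∷ q (o S.i) (o p) ∷ q (o S.i) (o S.ω) ∷ q (o S.ω) (o p) ∷ [])
          (λ Q r r′ u u′ a b c d f g →
            (5242880 , r ⊑ a) ∷ (5242880 , a ⊑ 2 ⋆ b ∔ 2 ⋆ u′) ∷ (10485760 , u′ ⊑ u) ∷ (10485760 , b ⊑ 2 ⋆ c ∔ 2 ⋆ d)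
            ∷ (40960 , 512 ⋆ c ⊑ r′) ∷ (40960 , r′ ⊑ 64 ⋆ Q) ∷ (20971520 , d ⊑ 2 ⋆ f ∔ 2 ⋆ g) ∷ (41943040 , f ⊑ Q)
            ∷ (2621440 , 16 ⋆ g ⊑ Q) ∷ (320 , B ⋆ u ⊑ 3 ⋆ r) ∷ (16381 , B ⋆ Q ⊑ 320 ⋆ r) ∷ [] ⊢ 489586688 · Q ⊑ 𝟎) refl
          (D≤center (x s) t′<s , q-tri _ (o p) _ , ≤-reflexive (q-sym _ _) , q-tri _ (o S.i) _ , S.meet-i , r≤64Q
          , q-tri _ (o S.ω) _ , i-ω , close , Bu≤3r , BQ≤320r Q≤80Q′ , tt))

    -- Accounts to which the value of a pick is charged

    charged-outside charged-between : ℕ → ℕ → Set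
    charged-outside t y = # A * q (x t) y ≤ D t y × D t y ≤ # A * e y
    charged-between t y = ∃[ t′ ] (First t t′ × near t (ν y) × # A * q (x t) y ≤ D t y × ¬ (D t y ≤ # A * e y)
      × q (x t) y < q (x t′) y × q (x t′) y ≤ # 4 * e y)

    -- Before `t′`, pick `s` would meet a center near `t` too early. At `t′` itself, a gain for `y`
    -- contradicts that `x t` serves `y` better. After `t′`, `y` is already served within `4 e y`,
    -- so the bound by `A e y` that must fail at `s` holds.
    between-exclusive : ∀ {t s y} → t ℕ.< s → y ℕ.< n → charged-between t y → charged-between s y → ⊥
    between-exclusive {t} {s} {y} t<s y<n (t′ , F , near-t , _ , _ , a<b , b≤4e) (_ , F′ , near-s , inside , unpaid , _) =
      order (ℕₚ.<-cmp s t′)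
      where
      order : Tri (s ℕ.< t′) (s ≡ t′) (t′ ℕ.< s) → ⊥
      order (tri< s<t′ _ _) = First.before F s t<s s<t′ (ν y) (ν<k y<n) near-t (near⇒meets s (ν y) near-s)
      order (tri≈ _ s≡t′ _) = <⇒≱ (subst (λ z → q (x t) y < q (x z) y) (sym s≡t′) a<b) (linarith
        (q (x t) y ∷ q (x s) y ∷ D s y ∷ [])
        (λ a b E → (1 , A ⋆ b ⊑ E) ∷ (1 , E ⊑ a) ∷ (524287 , 𝟎 ⊑ b) ∷ [] ⊢ 1 · b ⊑ a) refl
        (inside , D≤center y t<s , 0≤q _ _ , tt))
      order (tri> _ _ t′<s) = unpaid (linarith (D s y ∷ q (x t′) y ∷ e y ∷ [])
        (λ E b e → (1 , E ⊑ b) ∷ (1 , b ⊑ 4 ⋆ e) ∷ (524284 , 𝟎 ⊑ e) ∷ [] ⊢ 1 · E ⊑ A ⋆ e) refl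
        (D≤center y t′<s , b≤4e , 0≤e y , tt))

    outside between : ℕ → ℕ → ℝ
    outside t y = when (charged-outside t y) (D t y)
    between t y = when (charged-between t y) (# 4 * (# A * e y))

    0≤4Ae : ∀ y → 0# ≤ # 4 * (# A * e y)
    0≤4Ae y = *-nonneg (0≤# 4) (*-nonneg (0≤# A) (0≤e y))

    ∑-between : ∀ y → y ℕ.< n → ∑ T (λ t → between t y) ≤ # 4 * (# A * e y)
    ∑-between y y<n = ∑-atMostOne T (λ t → between t y) _ (0≤4Ae y) (λ t _ → when-≤ _ (0≤4Ae y)) one
      where
      one : ∀ t s → t ℕ.< s → s ℕ.< T → between t y ≡ 0# ⊎ between s y ≡ 0#
      one t s t<s _ = both (when-cases _ _) (when-cases _ _)
        where
        both : between t y ≡ 0# ⊎ (charged-between t y × _) → between s y ≡ 0# ⊎ (charged-between s y × _) → _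
        both (inj₁ ≡0) _ = inj₁ ≡0
        both (inj₂ _) (inj₁ ≡0) = inj₂ ≡0
        both (inj₂ (h , _)) (inj₂ (h′ , _)) = ⊥-elim (between-exclusive t<s y<n h h′)

    -- The potential min (D t y) (A e y) halves whenever y is charged.
    ∑-outside : ∀ y → ∑ T (λ t → outside t y) ≤ # 2 * (# A * e y)
    ∑-outside y = linarith (∑ T (λ t → outside t y) ∷ G T ∷ G 0 ∷ # A * e y ∷ [])
      (λ s g g₀ a → (1 , s ∔ 2 ⋆ g ⊑ 2 ⋆ g₀) ∷ (2 , 𝟎 ⊑ g) ∷ (2 , g₀ ⊑ a) ∷ [] ⊢ 1 · s ⊑ 2 ⋆ a) refl
      (telescope T , ⊓-glb (0≤D T y) 0≤Ae , ⊓-≤ʳ _ _ , tt)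
      where
      0≤Ae : 0# ≤ # A * e y
      0≤Ae = *-nonneg (0≤# A) (0≤e y)

      G : ℕ → ℝ
      G t = D t y ⊓ # A * e y

      drop : ∀ t → outside t y + # 2 * G (suc t) ≤ # 2 * G t
      drop t = go (when-cases (charged-outside t y) (D t y))
        where
        go : outside t y ≡ 0# ⊎ (charged-outside t y × outside t y ≡ D t y) → outside t y + # 2 * G (suc t) ≤ # 2 * G t
        go (inj₁ ≡0) = linarith (outside t y ∷ G (suc t) ∷ G t ∷ [])
          (λ z g′ g → (1 , z ⊑ 𝟎) ∷ (2 , g′ ⊑ g) ∷ [] ⊢ 1 · z ∔ 2 ⋆ g′ ⊑ 2 ⋆ g) refl
          (≤-reflexive ≡0 , ⊓-glb (≤-trans (⊓-≤ˡ _ _) (⊓-≤ˡ _ _)) (⊓-≤ʳ _ _) , tt)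
        go (inj₂ ((inside , paid) , ≡D)) = linarith (outside t y ∷ G (suc t) ∷ G t ∷ D t y ∷ q (x t) y ∷ [])
          (λ z g′ g E a → (1 , z ⊑ E) ∷ (2 , g′ ⊑ a) ∷ (1 , A ⋆ a ⊑ E) ∷ (524286 , 𝟎 ⊑ a) ∷ (2 , E ⊑ g) ∷ []
            ⊢ 1 · z ∔ 2 ⋆ g′ ⊑ 2 ⋆ g) refl
          (≤-reflexive ≡D , ≤-trans (⊓-≤ˡ _ _) (⊓-≤ʳ _ _) , inside , 0≤q _ _ , ⊓-glb ≤-refl paid , tt)

      telescope : ∀ t → ∑ t (λ t → outside t y) + # 2 * G t ≤ # 2 * G 0
      telescope zero    = ≤-reflexive (+-identityˡ _)
      telescope (suc t) = linarith (∑ t (λ t → outside t y) ∷ outside t y ∷ G (suc t) ∷ G t ∷ G 0 ∷ [])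
        (λ s z g′ g g₀ → (1 , s ∔ 2 ⋆ g ⊑ 2 ⋆ g₀) ∷ (1 , z ∔ 2 ⋆ g′ ⊑ 2 ⋆ g) ∷ [] ⊢ 1 · s ∔ z ∔ 2 ⋆ g′ ⊑ 2 ⋆ g₀) refl
        (telescope t , drop t , tt)

    lasts splits : ℕ → ℕ → ℝ
    lasts  t i = when (Last t i) λ₀
    splits t p = when (Split t p) λ₀

    -- A later pick near the same center would in particular meet it.
    ∑-lasts : ∀ i → i ℕ.< k → ∑ T (λ t → lasts t i) ≤ λ₀
    ∑-lasts i i<k = ∑-atMostOne T (λ t → lasts t i) λ₀ 0≤λ₀ (λ t _ → when-≤ _ 0≤λ₀) one
      where
      one : ∀ t s → t ℕ.< s → s ℕ.< T → lasts t i ≡ 0# ⊎ lasts s i ≡ 0#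
      one t s t<s s<T = both (when-cases _ _) (when-cases _ _)
        where
        both : lasts t i ≡ 0# ⊎ (Last t i × _) → lasts s i ≡ 0# ⊎ (Last s i × _) → _
        both (inj₁ ≡0) _ = inj₁ ≡0
        both (inj₂ _) (inj₁ ≡0) = inj₂ ≡0
        both (inj₂ ((near-t , never) , _)) (inj₂ ((near-s , _) , _)) =
          ⊥-elim (never s t<s s<T i i<k near-t (near⇒meets s i near-s))

    ∑-splits : ∀ p → ∑ T (λ t → splits t p) ≤ λ₀
    ∑-splits p = ∑-atMostOne T (λ t → splits t p) λ₀ 0≤λ₀ (λ t _ → when-≤ _ 0≤λ₀) one
      where
      one : ∀ t s → t ℕ.< s → s ℕ.< T → splits t p ≡ 0# ⊎ splits s p ≡ 0#
      one t s t<s s<T = both (when-cases _ _) (when-cases _ _)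
        where
        both : splits t p ≡ 0# ⊎ (Split t p × _) → splits s p ≡ 0# ⊎ (Split s p × _) → _
        both (inj₁ ≡0) _ = inj₁ ≡0
        both (inj₂ _) (inj₁ ≡0) = inj₂ ≡0
        both (inj₂ (h , _)) (inj₂ (h′ , _)) = ⊥-elim (split-injective t<s s<T h h′)

    charges : ℕ → ℝ
    charges t = ∑ k (lasts t) + ∑ k (splits t) + ∑ n (outside t) + ∑ n (between t)

    0≤outside : ∀ t y → 0# ≤ outside t y
    0≤outside t y = 0≤when _ (0≤D t y)

    0≤between : ∀ t y → 0# ≤ between t y
    0≤between t y = 0≤when _ (0≤4Ae y)

    paid-by : ∀ t {a} → a ≤ ∑ k (lasts t) ⊎ a ≤ ∑ k (splits t) ⊎ a ≤ ∑ n (outside t) + ∑ n (between t) → a ≤ charges t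
    paid-by t {a} h = go h
      where
      0≤lasts : 0# ≤ ∑ k (lasts t)
      0≤lasts = ∑-nonneg k (λ _ _ → 0≤when _ 0≤λ₀)
      0≤splits : 0# ≤ ∑ k (splits t)
      0≤splits = ∑-nonneg k (λ _ _ → 0≤when _ 0≤λ₀)
      0≤o : 0# ≤ ∑ n (outside t)
      0≤o = ∑-nonneg n (λ y _ → 0≤outside t y)
      0≤b : 0# ≤ ∑ n (between t)
      0≤b = ∑-nonneg n (λ y _ → 0≤between t y)
      ρ = a ∷ ∑ k (lasts t) ∷ ∑ k (splits t) ∷ ∑ n (outside t) ∷ ∑ n (between t) ∷ []
      go : a ≤ ∑ k (lasts t) ⊎ a ≤ ∑ k (splits t) ⊎ a ≤ ∑ n (outside t) + ∑ n (between t) → a ≤ charges t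
      go (inj₁ h) = linarith ρ (λ a l s o b → (1 , a ⊑ l) ∷ (1 , 𝟎 ⊑ s) ∷ (1 , 𝟎 ⊑ o) ∷ (1 , 𝟎 ⊑ b) ∷ []
        ⊢ 1 · a ⊑ l ∔ s ∔ o ∔ b) refl (h , 0≤splits , 0≤o , 0≤b , tt)
      go (inj₂ (inj₁ h)) = linarith ρ (λ a l s o b → (1 , a ⊑ s) ∷ (1 , 𝟎 ⊑ l) ∷ (1 , 𝟎 ⊑ o) ∷ (1 , 𝟎 ⊑ b) ∷ []
        ⊢ 1 · a ⊑ l ∔ s ∔ o ∔ b) refl (h , 0≤lasts , 0≤o , 0≤b , tt)
      go (inj₂ (inj₂ h)) = linarith ρ (λ a l s o b → (1 , a ⊑ o ∔ b) ∷ (1 , 𝟎 ⊑ l) ∷ (1 , 𝟎 ⊑ s) ∷ []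
        ⊢ 1 · a ⊑ l ∔ s ∔ o ∔ b) refl (h , 0≤lasts , 0≤splits , tt)

    λ₀≤charges-far : ∀ {t} → t ℕ.< T → (∀ i → i ℕ.< k → ¬ near t i) → λ₀ ≤ ∑ n (outside t) + ∑ n (between t)
    λ₀≤charges-far {t} t<T far = ≤-trans (λ₀≤ (ℕₚ.<⇒≤ t<T)) (≤-trans (∑-mono n pointwise)
      (lin (∑-nonneg n (λ y _ → 0≤between t y)) (solve 2 (λ a b → a :+ b := a :+ b :+ κ 0) refl _ _)))
      where
      pointwise : ∀ y → y ℕ.< n → excess (# A * q (x t) y) (D t y) ≤ outside t y
      pointwise y y<n = by-cases (# A * q (x t) y ≤ D t y)
        (λ inside → ≤-trans (≤-reflexive (excess-pos inside))
          (≤-trans (lin (*-nonneg (0≤# A) (0≤q (x t) y)) (solve 2 (λ E a → E :- a :+ a := E :+ κ 0) refl (D t y) (# A * q (x t) y)))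
            (≤-reflexive (sym (when-yes (inside , far-cost t (ν y) y (far (ν y) (ν<k y<n)) inside))))))
        (λ outside → ≤-trans (≤-reflexive (excess-neg outside)) (0≤outside t y))

    -- At time `t` the point `x t′` scored no better than `x t`. By `exchange`, the score of `x t`
    -- at `t` plus that of `x t′` at `t′` is at most the score of `x t′` at `t` plus the charges;
    -- cancelling leaves the second score, which is at least `λ₀`.
    λ₀≤charges-nested : ∀ {t t′} → First t t′ → (∀ i → i ℕ.< k → near t i → nearish t′ i) →
      λ₀ ≤ ∑ n (outside t) + ∑ n (between t)
    λ₀≤charges-nested {t} {t′} F nested = linarith
      (λ₀ ∷ score n q A (D t) (x t) ∷ score n q A (D t′) (x t′) ∷ score n q A (D t) (x t′) ∷ ∑ n (outside t) ∷ ∑ n (between t) ∷ [])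
      (λ l X Y Z a b → (1 , l ⊑ Y) ∷ (1 , Z ⊑ X) ∷ (1 , X ∔ Y ⊑ Z ∔ (a ∔ b)) ∷ [] ⊢ 1 · l ⊑ a ∔ b) refl
      (λ₀≤ (ℕₚ.<⇒≤ t′<T) , best-max A (D t) (best-<n A (D t′)) , total-exchange , tt)
      where
      open First F
      charge : ∀ y → y ℕ.< n → # A * q (x t) y ≤ D t y → q (x t) y < q (x t′) y →
        D t y ≤ outside t y + between t y ⊎ # A * q (x t′) y ≤ outside t y + between t y
      charge y y<n inside a<b = by-cases (D t y ≤ # A * e y) paid λ unpaid → by-cases (near t (ν y))
        (λ near-y → let b≤4e = farther near-y in
          inj₂ (linarith (q (x t′) y ∷ e y ∷ outside t y ∷ between t y ∷ # A * q (x t′) y ∷ # A * e y ∷ [])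
            (λ b e c d Ab Ae → (1 , Ab ⊑ 4 ⋆ Ae) ∷ (1 , 4 ⋆ Ae ⊑ d) ∷ (1 , 𝟎 ⊑ c) ∷ [] ⊢ 1 · Ab ⊑ c ∔ d) refl
            ( linarith (q (x t′) y ∷ e y ∷ []) (λ b e → (A , b ⊑ 4 ⋆ e) ∷ [] ⊢ 1 · A ⋆ b ⊑ 4 ⋆ (A ⋆ e)) refl (b≤4e , tt)
            , ≤-reflexive (sym (when-yes (t′ , F , near-y , inside , unpaid , a<b , b≤4e))) , 0≤outside t y , tt)))
        (λ far → paid (far-cost t (ν y) y far inside))
        where
        paid : D t y ≤ # A * e y → D t y ≤ outside t y + between t y ⊎ # A * q (x t′) y ≤ outside t y + between t y
        paid h = inj₁ (linarith (D t y ∷ outside t y ∷ between t y ∷ [])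
          (λ E c d → (1 , E ⊑ c) ∷ (1 , 𝟎 ⊑ d) ∷ [] ⊢ 1 · E ⊑ c ∔ d) refl
          (≤-reflexive (sym (when-yes (inside , h))) , 0≤between t y , tt))

        -- With `a < b` the distances of `y` to `x t` and `x t′`: `D t′ y ≤ a` gives `r t′ ≤ 4 b`,
        -- so `nearish` puts `x t′` within `b / 4` of the center of `y`, and `b ≤ b / 2 + 2 e y`.
        farther : near t (ν y) → q (x t′) y ≤ # 4 * e y
        farther near-y = linarith (q (x t′) y ∷ q (x t) y ∷ q (x t′) (o (ν y)) ∷ r t′ ∷ D t′ y ∷ q y (x t′) ∷ e y ∷ [])
          (λ b a c r E b′ e → (2 , b ⊑ 2 ⋆ c ∔ 2 ⋆ e) ∷ (1 , 4 ⋆ c ⊑ b) ∷ [] ⊢ 1 · b ⊑ 4 ⋆ e) refl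
          (q-tri _ (o (ν y)) _ , linarith
            (q (x t′) y ∷ q (x t) y ∷ q (x t′) (o (ν y)) ∷ r t′ ∷ D t′ y ∷ q y (x t′) ∷ [])
            (λ b a c r E b′ → (1 , 16 ⋆ c ⊑ r) ∷ (1 , r ⊑ 2 ⋆ E ∔ 2 ⋆ b′) ∷ (2 , E ⊑ a) ∷ (2 , a ⊑ b) ∷ (2 , b′ ⊑ b) ∷ []
              ⊢ 4 · 4 ⋆ c ⊑ b) refl
            (nested (ν y) (ν<k y<n) near-y , D-lipschitz t′ y (x t′) , D≤center y t<t′ , proj₁ a<b , ≤-reflexive (q-sym _ _) , tt) , tt)

      total-exchange : score n q A (D t) (x t) + score n q A (D t′) (x t′) ≤
        score n q A (D t) (x t′) + (∑ n (outside t) + ∑ n (between t))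
      total-exchange = subst₂ _≤_ (∑-+ n _ _)
        (trans (∑-+ n _ _) (cong (score n q A (D t) (x t′) +_) (∑-+ n _ _)))
        (∑-mono n (λ y y<n → exchange (D-antitone y (ℕₚ.<⇒≤ t<t′)) (D≤center y t<t′) (0≤q _ _) (0≤q _ _)
          (subst (_≤ outside t y + between t y) (+-identityʳ 0#) (0≤outside t y ⟨+⟩ 0≤between t y)) (charge y y<n)))

    one-of : ∀ (P : ℕ → Set) {i} → i ℕ.< k → P i → λ₀ ≤ ∑ k (λ i → when (P i) λ₀)
    one-of P {i} i<k Pi = subst (_≤ ∑ k (λ i → when (P i) λ₀)) (when-yes Pi)
      (∑-term k {λ i → when (P i) λ₀} (λ i _ → 0≤when (P i) 0≤λ₀) i<k)

    λ₀≤charges : ∀ {t} → t ℕ.< T → λ₀ ≤ charges t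
    λ₀≤charges {t} t<T = by-cases (∀ i → i ℕ.< k → ¬ near t i)
      (λ far → paid-by t (inj₂ (inj₂ (λ₀≤charges-far t<T far))))
      (λ ¬far → touched (not-all ¬far))
      where
      Meets : ℕ → Set
      Meets t′ = t ℕ.< t′ × t′ ℕ.< T × ∃[ j ] (j ℕ.< k × near t j × meets t′ j)

      reached : ∀ {t′} → First t t′ → λ₀ ≤ charges t
      reached {t′} F = by-cases (∀ i → i ℕ.< k → near t i → nearish t′ i)
        (λ nested → paid-by t (inj₂ (inj₂ (λ₀≤charges-nested F nested))))
        (λ ¬nested → let i′ , i′<k , ¬impl = not-all ¬nested in
          by-cases (near t i′)
            (λ near-i′ → split i′ i′<k near-i′ (λ nearish-i′ → ¬impl (λ _ → nearish-i′)))
            (λ ¬near → ⊥-elim (¬impl (λ near-i′ → ⊥-elim (¬near near-i′)))))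
        where
        open First F
        split : ∀ i′ → i′ ℕ.< k → near t i′ → ¬ nearish t′ i′ → λ₀ ≤ charges t
        split i′ i′<k near-i′ far-i′ = paid-by t (inj₂ (inj₁ (one-of (Split t) (G.pick-<k (G.Landmark.m mark)) witness)))
          where
          0<Q : 0# < q (o i) (o i′)
          0<Q = split-positive t′ i i′ meet-i far-i′
          mark : G.Landmark i i′
          mark = G.landmark i<k i′<k 0<Q
          witness : Split t (G.pick (G.Landmark.m mark))
          witness = record { t′ = t′ ; first = F ; i′ = i′ ; i′<k = i′<k ; near-i′ = near-i′ ; far-i′ = far-i′
            ; 0<Q = 0<Q ; mark = mark ; pick≡p = refl }

      touched : ∃[ i ] (i ℕ.< k × ¬ ¬ near t i) → λ₀ ≤ charges t
      touched (i , i<k , ¬¬near) = by-cases (∃[ t′ ] Meets t′)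
        (λ { (t′ , meet) → let t″ , _ , (t<t″ , t″<T , j , j<k , near-j , meet-j) , before = least {Meets} t′ meet in
          reached record { t<t′ = t<t″ ; t′<T = t″<T ; i = j ; i<k = j<k ; near-i = near-j ; meet-i = meet-j
            ; before = λ s t<s s<t″ j j<k near-j meet-j →
                before s s<t″ (t<s , ℕₚ.<-trans s<t″ t″<T , j , j<k , near-j , meet-j) } })
        (λ none → paid-by t (inj₁ (one-of (Last t) i<k
          (by-cases (near t i) (λ h → h) (λ ¬h → ⊥-elim (¬¬near ¬h))
            , λ s t<s s<T j j<k near-j meet-j → none (s , t<s , s<T , j , j<k , near-j , meet-j)))))

    ∑-charges : ∑ T charges ≤ # k * λ₀ + # k * λ₀ + # 2 * (# A * cost) + # 4 * (# A * cost)
    ∑-charges = subst (_≤ # k * λ₀ + # k * λ₀ + # 2 * (# A * cost) + # 4 * (# A * cost)) (sym (trans (∑-+ T _ _) (cong (_+ ∑ T (λ t → ∑ n (between t)))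
        (trans (∑-+ T _ _) (cong (_+ ∑ T (λ t → ∑ n (outside t))) (∑-+ T _ _))))))
      (columns k lasts (λ _ → λ₀) ∑-lasts (∑-const k λ₀)
        ⟨+⟩ columns k splits (λ _ → λ₀) (λ p _ → ∑-splits p) (∑-const k λ₀)
        ⟨+⟩ columns n outside (λ y → # 2 * (# A * e y)) (λ y _ → ∑-outside y) (scaled (# 2))
        ⟨+⟩ columns n between (λ y → # 4 * (# A * e y)) ∑-between (scaled (# 4)))
      where
      columns : ∀ m (g : ℕ → ℕ → ℝ) (c : ℕ → ℝ) {C} → (∀ j → j ℕ.< m → ∑ T (λ t → g t j) ≤ c j) → ∑ m c ≡ C →
        ∑ T (λ t → ∑ m (g t)) ≤ C
      columns m g c {C} h refl = subst (_≤ C) (sym (∑-swap T m g)) (∑-mono m h)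
      scaled : ∀ c → ∑ n (λ y → c * (# A * e y)) ≡ c * (# A * cost)
      scaled c = trans (∑-*ˡ n c _) (cong (c *_) (∑-*ˡ n (# A) e))

    λ₀-bound : # T * λ₀ ≤ # k * λ₀ + # k * λ₀ + # 6 * (# A * cost)
    λ₀-bound = linarith (# T * λ₀ ∷ ∑ T charges ∷ # k * λ₀ ∷ # A * cost ∷ [])
      (λ l c h a → (1 , l ⊑ c) ∷ (1 , c ⊑ h ∔ h ∔ 2 ⋆ a ∔ 4 ⋆ a) ∷ [] ⊢ 1 · l ⊑ h ∔ h ∔ 6 ⋆ a) refl
      (subst (_≤ ∑ T charges) (∑-const T λ₀) (∑-mono T (λ t → λ₀≤charges)) , ∑-charges , tt)

    -- Two of the three multiples of `k λ₀` are absorbed by the first two accounts; the third is at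
    -- most `6 A cost`, and `relaxation` adds one more `A cost`.
    seeding : # T ≡ # k + # k + # k → ∑ n (D T) ≤ # 7 * (# A * cost)
    seeding T≡3k = linarith (∑ n (D T) ∷ # k * λ₀ ∷ # T * λ₀ ∷ # A * cost ∷ [])
      (λ d h l a → (1 , d ⊑ h ∔ a) ∷ (1 , l ⊑ h ∔ h ∔ 6 ⋆ a) ∷ (1 , h ∔ h ∔ h ⊑ l) ∷ [] ⊢ 1 · d ⊑ 7 ⋆ a) refl
      (relaxation A (D T) , λ₀-bound
      , ≤-reflexive (trans (solve 2 (λ k l → k :* l :+ k :* l :+ k :* l := (k :+ k :+ k) :* l) refl (# k) λ₀)
          (cong (_* λ₀) (sym T≡3k))) , tt)

-- The number of greedy steps

module Logarithm (R : Reals) where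
  open OrderedField R
  open import Algebra.Properties.CommutativeSemiring.Exp
    (CommutativeRing.commutativeSemiring commutativeRing) using (^-homo-*; ^-assocʳ; ^-distrib-*)

  open NaturalMax totalOrder public using (x≤x⊔y; x≤y⊔x; ⊔-lub)

  0≤^ : ∀ {x} n → 0# ≤ x → 0# ≤ x ^ n
  0≤^ zero    0≤x = 0≤1
  0≤^ (suc n) 0≤x = *-nonneg 0≤x (0≤^ n 0≤x)

  ^-mono-≤ : ∀ {x y} n → 0# ≤ x → x ≤ y → x ^ n ≤ y ^ n
  ^-mono-≤ zero    0≤x x≤y = ≤-refl
  ^-mono-≤ (suc n) 0≤x x≤y = ≤-trans (*-monoʳ-≤ 0≤x (^-mono-≤ n 0≤x x≤y)) (*-monoˡ-≤ (0≤^ n (≤-trans 0≤x x≤y)) x≤y)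

  1^ : ∀ n → 1# ^ n ≡ 1#
  1^ zero    = refl
  1^ (suc n) = trans (*-identityˡ _) (1^ n)

  ^-≤1 : ∀ {x} n → 0# ≤ x → x ≤ 1# → x ^ n ≤ 1#
  ^-≤1 {x} n 0≤x x≤1 = subst (x ^ n ≤_) (1^ n) (^-mono-≤ n 0≤x x≤1)

  #⁻¹ : ∀ n .{{_ : NonZero n}} → # n * (# n) ⁻¹ ≡ 1#
  #⁻¹ n = *-inverseʳ (# n) (λ #n≡0 → proj₂ (0<# n) (sym #n≡0))

  0≤#⁻¹ : ∀ n .{{_ : NonZero n}} → 0# ≤ (# n) ⁻¹
  0≤#⁻¹ n = *-cancelˡ-≤ (0<# n) (subst₂ _≤_ (sym (zeroʳ (# n))) (sym (#⁻¹ n)) 0≤1)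

  -- The product decreases in `i`, because `(1 + h)(1 - (i + 1) h) = 1 - i h - (i + 1) h²`.
  bernoulli-upper : ∀ {h} i → 0# ≤ h → (1# + h) ^ i * (1# + - (# i * h)) ≤ 1#
  bernoulli-upper {h} zero 0≤h = ≤-reflexive (trans (*-identityˡ _)
    (trans (cong (λ z → 1# + - (z * h)) #0) (solve 2 (λ u h → u :- κ 0 :* h := u) refl 1# h)))
  bernoulli-upper {h} (suc i) 0≤h = ≤-trans (lin (*-nonneg (0≤^ i 0≤1+h) (*-nonneg (0≤# (suc i)) (0≤x² h))) step) (bernoulli-upper i 0≤h)
    where
    0≤1+h : 0# ≤ 1# + h
    0≤1+h = subst (_≤ 1# + h) (+-identityʳ 0#) (0≤1 ⟨+⟩ 0≤h)
    P = (1# + h) ^ i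
    step : (1# + h) * P * (1# + - (# (suc i) * h)) + P * (# (suc i) * (h * h)) ≡ P * (1# + - (# i * h)) + 0#
    step = trans (cong₂ (λ u z → (u + h) * P * (u + - (z * h)) + P * (z * (h * h))) (sym #1) (trans (#-suc i) (cong (_+ # i) (sym #1))))
      (trans (solve 3 (λ P h i → (κ 1 :+ h) :* P :* (κ 1 :- (κ 1 :+ i) :* h) :+ P :* ((κ 1 :+ i) :* (h :* h))
                 := P :* (κ 1 :- i :* h) :+ κ 0) refl P h (# i))
        (cong (λ u → P * (u + - (# i * h)) + 0#) #1))

  bernoulli-lower : ∀ {h} i → 0# ≤ h → 1# + # i * h ≤ (1# + h) ^ i
  bernoulli-lower {h} zero 0≤h = ≤-reflexive (trans (cong (λ z → 1# + z * h) #0) (solve 2 (λ u h → u :+ κ 0 :* h := u) refl 1# h))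
  bernoulli-lower {h} (suc i) 0≤h = ≤-trans
    (lin (*-nonneg (0≤# i) (0≤x² h)) (trans (cong₂ (λ u z → u + z * h + # i * (h * h)) (sym #1) (trans (#-suc i) (cong (_+ # i) (sym #1))))
      (trans (solve 2 (λ h i → κ 1 :+ (κ 1 :+ i) :* h :+ i :* (h :* h) := (κ 1 :+ h) :* (κ 1 :+ i :* h) :+ κ 0) refl h (# i))
        (cong (λ u → (u + h) * (u + # i * h) + 0#) #1))))
    (*-monoʳ-≤ (subst (_≤ 1# + h) (+-identityʳ 0#) (0≤1 ⟨+⟩ 0≤h)) (bernoulli-lower i 0≤h))

  module _ (k : ℕ) .{{_ : NonZero k}} where
    k⁻¹ θ : ℝ
    k⁻¹ = (# k) ⁻¹
    θ = 1# + - k⁻¹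

    k⁻¹≤1 : k⁻¹ ≤ 1#
    k⁻¹≤1 = *-cancelˡ-≤ (0<# k) (subst₂ _≤_ (trans #1 (sym (#⁻¹ k))) (sym (*-identityʳ (# k))) (#-mono (ℕ.>-nonZero⁻¹ k)))

    0≤θ : 0# ≤ θ
    0≤θ = ≤⇒nonneg k⁻¹≤1

    θ≤1 : θ ≤ 1#
    θ≤1 = lin (0≤#⁻¹ k) (solve 2 (λ u h → u :- h :+ h := u :+ κ 0) refl 1# k⁻¹)

    compound : ∀ {h} j → 0# ≤ h → # j * h ≡ k⁻¹ → θ * (1# + h) ^ j ≤ 1#
    compound {h} j 0≤h jh≡k⁻¹ = subst (_≤ 1#) (trans (*-comm _ _) (cong (λ z → (1# + - z) * (1# + h) ^ j) jh≡k⁻¹)) (bernoulli-upper j 0≤h)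

    -- `θ (1 + 1/k) ≤ 1`, and `(1 + 1/k)ᵏ ≥ 2` by Bernoulli.
    θᵏ-halves : # 2 * θ ^ k ≤ 1#
    θᵏ-halves = ≤-trans (*-monoˡ-≤ (0≤^ k 0≤θ) 2≤) (≤-trans (≤-reflexive (trans (*-comm _ _) (sym (^-distrib-* θ (1# + k⁻¹) k))))
      (^-≤1 k (*-nonneg 0≤θ 0≤1+) (subst (λ z → θ * z ≤ 1#) (*-identityʳ _) (compound 1 (0≤#⁻¹ k) (trans (cong (_* k⁻¹) #1) (*-identityˡ k⁻¹))))))
      where
      0≤1+ : 0# ≤ 1# + k⁻¹
      0≤1+ = subst (_≤ 1# + k⁻¹) (+-identityʳ 0#) (0≤1 ⟨+⟩ 0≤#⁻¹ k)
      2≤ : # 2 ≤ (1# + k⁻¹) ^ k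
      2≤ = ≤-trans (≤-reflexive (trans (#-suc 1) (cong (1# +_) (trans #1 (sym (#⁻¹ k)))))) (bernoulli-lower k (0≤#⁻¹ k))

    θ-halves : ∀ a → # (2 ℕ.^ a) * θ ^ (k ℕ.* a) ≤ 1#
    θ-halves a = subst (_≤ 1#) (trans (^-distrib-* (# 2) (θ ^ k) a) (cong₂ _*_ (#-^ a) (^-assocʳ θ k a)))
      (^-≤1 a (*-nonneg (0≤# 2) (0≤^ k 0≤θ)) θᵏ-halves)
      where
      #-^ : ∀ a → # 2 ^ a ≡ # (2 ℕ.^ a)
      #-^ zero    = sym #1
      #-^ (suc a) = trans (cong (# 2 *_) (#-^ a)) (sym (#-* 2 (2 ℕ.^ a)))

    -- (1 + ℓ/N)ᴺ ≤ (1 + 1/(kj))ᴺ for N = mj, and θ (1 + 1/(kj))ʲ ≤ 1.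
    compound-power : ∀ {ℓ} m j → # k * ℓ ≤ # (suc m) → 0# ≤ # (suc m ℕ.* suc j) + ℓ →
      θ ^ suc m * (1# + ℓ * (# (suc m ℕ.* suc j)) ⁻¹) ^ (suc m ℕ.* suc j) ≤ 1#
    compound-power {ℓ} m j kℓ≤m 0≤N+ℓ = ≤-trans (*-monoʳ-≤ (0≤^ (suc m) 0≤θ) (^-mono-≤ N 0≤a a≤1+h))
      (subst (_≤ 1#) (trans (^-distrib-* θ ((1# + h) ^ suc j) (suc m))
          (cong (θ ^ suc m *_) (trans (^-assocʳ (1# + h) (suc j) (suc m)) (cong ((1# + h) ^_) (ℕₚ.*-comm (suc j) (suc m))))))
        (^-≤1 (suc m) (*-nonneg 0≤θ (0≤^ (suc j) 0≤1+h)) (compound (suc j) 0≤h jh≡k⁻¹)))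
      where
      N = suc m ℕ.* suc j
      N⁻¹ = (# N) ⁻¹
      a = 1# + ℓ * N⁻¹
      instance
        kj≢0 : NonZero (k ℕ.* suc j)
        kj≢0 = ℕₚ.m*n≢0 k (suc j)
      h = (# (k ℕ.* suc j)) ⁻¹
      0≤h : 0# ≤ h
      0≤h = 0≤#⁻¹ (k ℕ.* suc j)
      0≤1+h : 0# ≤ 1# + h
      0≤1+h = subst (_≤ 1# + h) (+-identityʳ 0#) (0≤1 ⟨+⟩ 0≤h)
      kjh≡1 : # k * (# (suc j) * h) ≡ 1#
      kjh≡1 = trans (sym (*-assoc _ _ _)) (trans (cong (_* h) (sym (#-* k (suc j)))) (#⁻¹ (k ℕ.* suc j)))
      jh≡k⁻¹ : # (suc j) * h ≡ k⁻¹
      jh≡k⁻¹ = begin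
        # (suc j) * h                       ≡⟨ sym (*-identityʳ _) ⟩
        # (suc j) * h * 1#                  ≡⟨ cong (# (suc j) * h *_) (sym (#⁻¹ k)) ⟩
        # (suc j) * h * (# k * k⁻¹)         ≡⟨ solve 3 (λ a b c → a :* (b :* c) := b :* a :* c) refl (# (suc j) * h) (# k) k⁻¹ ⟩
        # k * (# (suc j) * h) * k⁻¹         ≡⟨ cong (_* k⁻¹) kjh≡1 ⟩
        1# * k⁻¹                            ≡⟨ *-identityˡ k⁻¹ ⟩
        k⁻¹                                 ∎
        where open ≡-Reasoning
      N*a : # N * a ≡ # N + ℓ
      N*a = trans (solve 4 (λ n u l i → n :* (u :+ l :* i) := n :* u :+ l :* (n :* i)) refl (# N) 1# ℓ N⁻¹)
        (cong₂ _+_ (*-identityʳ (# N)) (trans (cong (ℓ *_) (#⁻¹ N)) (*-identityʳ ℓ)))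
      0≤a : 0# ≤ a
      0≤a = *-cancelˡ-≤ (0<# N) (subst₂ _≤_ (sym (zeroʳ (# N))) (sym N*a) 0≤N+ℓ)
      a≤1+h : a ≤ 1# + h
      a≤1+h = *-cancelˡ-≤ (0<# N) (*-cancelˡ-≤ (0<# k) (subst₂ _≤_ (cong (# k *_) (sym N*a)) target
        (lin kℓ≤m (solve 4 (λ k n l m → k :* (n :+ l) :+ m := k :* n :+ m :+ k :* l) refl (# k) (# N) ℓ (# (suc m))))))
        where
        target : # k * # N + # (suc m) ≡ # k * (# N * (1# + h))
        target = sym (begin
          # k * (# N * (1# + h))                              ≡⟨ solve 4 (λ k n u h → k :* (n :* (u :+ h)) := k :* (n :* u) :+ n :* (k :* h)) refl (# k) (# N) 1# h ⟩
          # k * (# N * 1#) + # N * (# k * h)                  ≡⟨ cong₂ _+_ (cong (# k *_) (*-identityʳ (# N))) (cong (_* (# k * h)) (#-* (suc m) (suc j))) ⟩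
          # k * # N + # (suc m) * # (suc j) * (# k * h)       ≡⟨ cong (# k * # N +_) (solve 4 (λ m j k h → m :* j :* (k :* h) := m :* (k :* (j :* h))) refl (# (suc m)) (# (suc j)) (# k) h) ⟩
          # k * # N + # (suc m) * (# k * (# (suc j) * h))     ≡⟨ cong (λ z → # k * # N + # (suc m) * z) kjh≡1 ⟩
          # k * # N + # (suc m) * 1#                          ≡⟨ cong (# k * # N +_) (*-identityʳ _) ⟩
          # k * # N + # (suc m)                               ∎)
          where open ≡-Reasoning


    ⁻¹-pos : ∀ {x} → 0# < x → 0# < x ⁻¹
    ⁻¹-pos {x} 0<x = ≰⇒> λ x⁻¹≤0 → <⇒≱ 0<1 (subst₂ _≤_
      (*-inverseʳ x (λ x≡0 → proj₂ 0<x (sym x≡0))) (zeroʳ x) (*-monoʳ-≤ (proj₁ 0<x) x⁻¹≤0))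

    -- If `X`, the power of `θ`, exceeds `ε`, then `X / ε = 1 + 2δ` with `δ > 0`. A compound power
    -- `u` within `δ` of `1/ε` has `X u ≤ 1`, so `X / ε ≤ 1 + X δ ≤ 1 + δ`.
    θ-power-≤ : ∀ {ε ℓ} → 0# < ε → IsLog (ε ⁻¹) ℓ → ∀ m → # k * ℓ ≤ # (suc m) → θ ^ suc m ≤ ε
    θ-power-≤ {ε} {ℓ} 0<ε isLog m kℓ≤m = by-contradiction (θ ^ suc m ≤? ε)
      where
      X = θ ^ suc m
      δ = (X * ε ⁻¹ + - 1#) * (# 2) ⁻¹

      2δ : # 2 * δ ≡ X * ε ⁻¹ + - 1#
      2δ = trans (solve 3 (λ a b c → a :* (b :* c) := b :* (a :* c)) refl (# 2) (X * ε ⁻¹ + - 1#) ((# 2) ⁻¹))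
        (trans (cong ((X * ε ⁻¹ + - 1#) *_) (#⁻¹ 2)) (*-identityʳ _))

      impossible : ε < X → ⊥
      impossible ε<X = <⇒≱ 0<δ (lin (≤-trans (*-monoʳ-≤ (0≤^ (suc m) 0≤θ) ε⁻¹≤) (≤-trans (≤-reflexive (distribˡ X (u M) δ))
        (compound-power m j kℓ≤m 0≤N+ℓ′ ⟨+⟩ (*-monoˡ-≤ (proj₁ 0<δ) (^-≤1 (suc m) 0≤θ θ≤1)))))
        (trans (cong (λ z → δ + (1# + z)) (*-identityˡ δ)) (trans (solve 2 (λ d u → d :+ (u :+ d) := u :+ κ 2 :* d) refl δ 1#)
          (trans (cong (1# +_) 2δ) (solve 2 (λ u z → u :+ (z :- u) := κ 0 :+ z) refl 1# (X * ε ⁻¹))))))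
        where
        0<δ : 0# < δ
        0<δ = *-pos (lin< (*-monoʳ-< (⁻¹-pos 0<ε) ε<X) (trans (cong (0# +_) (*-comm (ε ⁻¹) X))
            (trans (solve 2 (λ a u → κ 0 :+ a := (a :- u) :+ u) refl (X * ε ⁻¹) 1#)
              (cong (X * ε ⁻¹ + - 1# +_) (sym (trans (*-comm _ _) (*-inverseʳ ε (λ ε≡0 → proj₂ 0<ε (sym ε≡0)))))))))
          (⁻¹-pos (0<# 2))
        limit = isLog δ 0<δ
        N₀ = proj₁ limit
        bound = archimedean (- ℓ)
        -- Large enough for the limit, and for `N + ℓ` to be nonnegative when `ℓ` is negative.
        j = N₀ ℕ.+ proj₁ bound
        -- Chosen so that `suc M` is definitionally `suc m * suc j`, the exponent in
        -- `compound-power`.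
        M = j ℕ.+ m ℕ.* suc j
        N = suc m ℕ.* suc j
        u : ℕ → ℝ
        u M = (1# + ℓ * (# (suc M)) ⁻¹) ^ suc M
        0≤N+ℓ′ : 0# ≤ # N + ℓ
        0≤N+ℓ′ = lin (≤-trans (proj₂ bound) (#-mono (ℕₚ.≤-trans (ℕₚ.m≤n+m (proj₁ bound) N₀) (ℕₚ.≤-trans (ℕₚ.n≤1+n j) (ℕₚ.m≤m+n (suc j) (m ℕ.* suc j))))))
          (solve 2 (λ n l → κ 0 :+ n := n :+ l :+ (:- l)) refl (# N) ℓ)
        u-close : (u M + - ε ⁻¹) ⊔ (- (u M + - ε ⁻¹)) ≤ δ
        u-close = subst (λ z → ((1# + ℓ * z ⁻¹) ^ suc M + - ε ⁻¹) ⊔ (- ((1# + ℓ * z ⁻¹) ^ suc M + - ε ⁻¹)) ≤ δ)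
          (sym (#≡fromℕ (suc M))) (proj₂ limit M (ℕₚ.≤-trans (ℕₚ.m≤m+n N₀ (proj₁ bound)) (ℕₚ.m≤m+n j (m ℕ.* suc j))))
        ε⁻¹≤ : ε ⁻¹ ≤ u M + δ
        ε⁻¹≤ = lin (≤-trans (x≤y⊔x (u M + - ε ⁻¹) (- (u M + - ε ⁻¹))) u-close)
          (solve 3 (λ e u d → e :+ d := u :+ d :+ (:- (u :- e))) refl (ε ⁻¹) (u M) δ)

      by-contradiction : Dec (X ≤ ε) → X ≤ ε
      by-contradiction (yes h) = h
      by-contradiction (no h)  = ⊥-elim (impossible (≰⇒> h))

    -- The first `k a` factors cancel `2ᵃ`; more than `k ℓ` further ones would bring the bound down
    -- to `ε`. The maximum with 0 covers `ε > 1`, where `ℓ` is negative.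
    decay-steps : ∀ {ε ℓ} a → 0# < ε → IsLog (ε ⁻¹) ℓ → ∀ m → ε < # (2 ℕ.^ a) * θ ^ m →
      # m ≤ # (k ℕ.* a) + # k * (0# ⊔ ℓ)
    decay-steps {ε} {ℓ} a 0<ε isLog m ε< = by-contradiction (# m ≤? # (k ℕ.* a) + # k * (0# ⊔ ℓ))
      where
      0≤kℓ⁺ : 0# ≤ # k * (0# ⊔ ℓ)
      0≤kℓ⁺ = *-nonneg (0≤# k) (x≤x⊔y 0# ℓ)

      impossible : # (k ℕ.* a) + # k * (0# ⊔ ℓ) < # m → ⊥
      impossible late = go (m ℕ.∸ k ℕ.* a) (sym (ℕₚ.m+[n∸m]≡n ka≤m))
        where
        ka≤m : k ℕ.* a ℕ.≤ m
        ka≤m = ℕₚ.≮⇒≥ λ m<ka → <⇒≱ late (≤-trans (#-mono (ℕₚ.<⇒≤ m<ka))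
          (lin 0≤kℓ⁺ (solve 2 (λ a b → a :+ b := a :+ b :+ κ 0) refl _ _)))
        extra : ∀ {m′} → m ≡ k ℕ.* a ℕ.+ m′ → # k * (0# ⊔ ℓ) < # m′
        extra {m′} eq = lin< (subst (λ z → # (k ℕ.* a) + # k * (0# ⊔ ℓ) < z) (trans (cong # eq) (#-+ (k ℕ.* a) m′)) late)
          (solve 3 (λ a b c → b :+ (a :+ c) := c :+ (a :+ b)) refl (# (k ℕ.* a)) (# k * (0# ⊔ ℓ)) (# m′))
        go : ∀ m′ → m ≡ k ℕ.* a ℕ.+ m′ → ⊥
        go zero    eq = <⇒≱ (extra eq) (subst (_≤ # k * (0# ⊔ ℓ)) (sym #0) 0≤kℓ⁺)
        go (suc m′) eq = <⇒≱ ε< (≤-trans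
          (≤-reflexive (trans (cong (λ z → # (2 ℕ.^ a) * θ ^ z) eq)
            (trans (cong (# (2 ℕ.^ a) *_) (^-homo-* θ (k ℕ.* a) (suc m′))) (sym (*-assoc _ _ _)))))
          (≤-trans (*-monoˡ-≤ (0≤^ (suc m′) 0≤θ) (θ-halves a))
            (≤-trans (≤-reflexive (*-identityˡ _))
              (θ-power-≤ 0<ε isLog m′ (≤-trans (*-monoʳ-≤ (0≤# k) (x≤y⊔x 0# ℓ)) (proj₁ (extra eq)))))))

      by-contradiction : Dec (# m ≤ # (k ℕ.* a) + # k * (0# ⊔ ℓ)) → # m ≤ # (k ℕ.* a) + # k * (0# ⊔ ℓ)
      by-contradiction (yes h) = h
      by-contradiction (no h)  = ⊥-elim (impossible (≰⇒> h))

    decay-stops : ∀ {ε ℓ} a → 0# < ε → IsLog (ε ⁻¹) ℓ → ∃[ m ] ¬ (ε < # (2 ℕ.^ a) * θ ^ m)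
    decay-stops {ε} {ℓ} a 0<ε isLog = let m , bound = archimedean (# (k ℕ.* a) + # k * (0# ⊔ ℓ)) in
      suc m , λ ε< → <⇒≱ (≤-<-trans bound (lin< 0<1 (trans (solve 2 (λ m u → m :+ u := u :+ m :+ κ 0) refl (# m) 1#)
        (cong (_+ 0#) (sym (#-suc m)))))) (decay-steps a 0<ε isLog (suc m) ε<)

-- Execution and cost of programs

≡ᵇ-refl : ∀ m → (m ≡ᵇ m) ≡ true
≡ᵇ-refl zero    = refl
≡ᵇ-refl (suc m) = ≡ᵇ-refl m

≢⇒≡ᵇ : ∀ m n → m ≢ n → (m ≡ᵇ n) ≡ false
≢⇒≡ᵇ zero    zero    m≢n = ⊥-elim (m≢n refl)
≢⇒≡ᵇ zero    (suc n) m≢n = refl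
≢⇒≡ᵇ (suc m) zero    m≢n = refl
≢⇒≡ᵇ (suc m) (suc n) m≢n = ≢⇒≡ᵇ m n (m≢n ∘ cong suc)

≤⇒≤ᵇ : ∀ {m n} → m ℕ.≤ n → (m ≤ᵇ n) ≡ true
≤⇒≤ᵇ {m} {n} m≤n with m ≤ᵇ n | ℕₚ.≤⇒≤ᵇ m≤n
... | true | _ = refl

≰⇒≤ᵇ : ∀ {m n} → ¬ m ℕ.≤ n → (m ≤ᵇ n) ≡ false
≰⇒≤ᵇ {m} {n} m≰n with m ≤ᵇ n in eq
... | false = refl
... | true  = ⊥-elim (m≰n (ℕₚ.≤ᵇ⇒≤ m n (subst T (sym eq) tt)))

∨-false : ∀ {a b} → a ∨ b ≡ false → a ≡ false × b ≡ false
∨-false {false} h = refl , h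

write-hit : {A : Set} (μ : Memory A) (a i j : ℕ) {v : A} → write μ a i j v a i j ≡ v
write-hit μ a i j rewrite ≡ᵇ-refl a | ≡ᵇ-refl i | ≡ᵇ-refl j = refl

write-row : {A : Set} (μ : Memory A) (a : ℕ) {i i′ : ℕ} (j j′ : ℕ) {v : A} → i ≢ i′ → write μ a i j v a i′ j′ ≡ μ a i′ j′
write-row μ a {i} {i′} j j′ i≢i′ rewrite ≡ᵇ-refl a | ≢⇒≡ᵇ i i′ i≢i′ = refl

write-array : {A : Set} (μ : Memory A) (a a′ i i′ j j′ : ℕ) {v : A} → (a ≡ᵇ a′) ≡ false → write μ a i j v a′ i′ j′ ≡ μ a′ i′ j′
write-array μ a a′ i i′ j j′ a≢a′ rewrite a≢a′ = refl

-- A syntactic approximation that computes, so that preservation of an array by a concrete program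
-- is proved by `refl`.
writesᴺ writesᴿ : Program → ℕ → Bool
writesᴺ skip               a = false
writesᴺ (setNat b _ _ _)   a = b ≡ᵇ a
writesᴺ (setReal _ _ _ _)  a = false
writesᴺ (p ⨾ q)            a = writesᴺ p a ∨ writesᴺ q a
writesᴺ (ifThenElse _ p q) a = writesᴺ p a ∨ writesᴺ q a
writesᴺ (while _ p)        a = writesᴺ p a
writesᴿ skip               a = false
writesᴿ (setNat _ _ _ _)   a = false
writesᴿ (setReal b _ _ _)  a = b ≡ᵇ a
writesᴿ (p ⨾ q)            a = writesᴿ p a ∨ writesᴿ q a
writesᴿ (ifThenElse _ p q) a = writesᴿ p a ∨ writesᴿ q a
writesᴿ (while _ p)        a = writesᴿ p a

module Execution (R : Reals) where
  open OrderedField R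
  open RealRAM R public

  frameᴺ : ∀ {p σ τ t a} → ⟨ p , σ ⟩⇓⟨ τ , t ⟩ → writesᴺ p a ≡ false → ∀ i j → nats τ a i j ≡ nats σ a i j
  frameᴺ ⇓skip _ i j = refl
  frameᴺ {setNat b e e′ _} {σ} {a = a} ⇓setNat w i j = write-array (nats σ) b a (evalᴺ σ e) i (evalᴺ σ e′) j w
  frameᴺ ⇓setReal _ i j = refl
  frameᴺ (⇓seq P Q) w i j = trans (frameᴺ Q (proj₂ (∨-false w)) i j) (frameᴺ P (proj₁ (∨-false w)) i j)
  frameᴺ (⇓then _ P) w i j = frameᴺ P (proj₁ (∨-false w)) i j
  frameᴺ {ifThenElse _ p q} {a = a} (⇓else _ Q) w i j = frameᴺ Q (proj₂ (∨-false {writesᴺ p a} w)) i j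
  frameᴺ (⇓loop _ P Q) w i j = trans (frameᴺ Q w i j) (frameᴺ P w i j)
  frameᴺ (⇓done _) _ i j = refl

  frameᴿ : ∀ {p σ τ t a} → ⟨ p , σ ⟩⇓⟨ τ , t ⟩ → writesᴿ p a ≡ false → ∀ i j → reals τ a i j ≡ reals σ a i j
  frameᴿ ⇓skip _ i j = refl
  frameᴿ ⇓setNat _ i j = refl
  frameᴿ {setReal b e e′ _} {σ} {a = a} ⇓setReal w i j = write-array (reals σ) b a (evalᴺ σ e) i (evalᴺ σ e′) j w
  frameᴿ (⇓seq P Q) w i j = trans (frameᴿ Q (proj₂ (∨-false w)) i j) (frameᴿ P (proj₁ (∨-false w)) i j)
  frameᴿ (⇓then _ P) w i j = frameᴿ P (proj₁ (∨-false w)) i j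
  frameᴿ {ifThenElse _ p q} {a = a} (⇓else _ Q) w i j = frameᴿ Q (proj₂ (∨-false {writesᴿ p a} w)) i j
  frameᴿ (⇓loop _ P Q) w i j = trans (frameᴿ Q w i j) (frameᴿ P w i j)
  frameᴿ (⇓done _) _ i j = refl

  record Frame (p : Program) (σ τ : State) : Set where
    constructor frame
    field
      natᶠ  : ∀ a → writesᴺ p a ≡ false → ∀ i j → nats τ a i j ≡ nats σ a i j
      realᶠ : ∀ a → writesᴿ p a ≡ false → ∀ i j → reals τ a i j ≡ reals σ a i j
  open Frame public

  -- A total-correctness triple with a time budget, for one start state.
  record Run (p : Program) (σ : State) (B : ℕ) (Post : State → Set) : Set where
    constructor run
    field
      {final} : State
      {steps} : ℕ
      halts   : ⟨ p , σ ⟩⇓⟨ final , steps ⟩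
      bound   : steps ℕ.≤ B
      post    : Post final

    framed : Frame p σ final
    framed = frame (λ a → frameᴺ halts) (λ a → frameᴿ halts)
  open Run public

  weaken : ∀ {p σ B B′ P P′} → B ℕ.≤ B′ → (∀ {τ} → Frame p σ τ → P τ → P′ τ) → Run p σ B P → Run p σ B′ P′
  weaken B≤B′ P⇒P′ r = run (halts r) (ℕₚ.≤-trans (bound r) B≤B′) (P⇒P′ (framed r) (post r))

  run-skip : ∀ {σ P} → P σ → Run skip σ 1 P
  run-skip h = run ⇓skip ℕₚ.≤-refl h

  run-setNat : ∀ {σ a i j e P} → P (state (write (nats σ) a (evalᴺ σ i) (evalᴺ σ j) (evalᴺ σ e)) (reals σ)) →
    Run (setNat a i j e) σ (1 ℕ.+ costᴺ i ℕ.+ costᴺ j ℕ.+ costᴺ e) P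
  run-setNat h = run ⇓setNat ℕₚ.≤-refl h

  run-setReal : ∀ {σ a i j e P} → P (state (nats σ) (write (reals σ) a (evalᴺ σ i) (evalᴺ σ j) (evalᴿ σ e))) →
    Run (setReal a i j e) σ (1 ℕ.+ costᴺ i ℕ.+ costᴺ j ℕ.+ costᴿ e) P
  run-setReal h = run ⇓setReal ℕₚ.≤-refl h

  infixr 4 _then_

  _then_ : ∀ {p q σ B B′ P Q} → Run p σ B P → (∀ {τ} → Frame p σ τ → P τ → Run q τ B′ Q) → Run (p ⨾ q) σ (B ℕ.+ B′) Q
  r then k = let r′ = k (framed r) (post r) in run (⇓seq (halts r) (halts r′)) (ℕₚ.+-mono-≤ (bound r) (bound r′)) (post r′)

  run-if : ∀ {e e′ p q σ B P} → (evalᴿ σ e ≤ evalᴿ σ e′ → Run p σ B P) → (¬ evalᴿ σ e ≤ evalᴿ σ e′ → Run q σ B P) →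
    Run (ifThenElse (e ≤ᴿ e′) p q) σ (1 ℕ.+ costᵀ (e ≤ᴿ e′) ℕ.+ B) P
  run-if {e} {e′} {p} {q} {σ} {B} {P} f g = go (evalᴿ σ e ≤? evalᴿ σ e′)
    where
    go : Dec (evalᴿ σ e ≤ evalᴿ σ e′) → Run (ifThenElse (e ≤ᴿ e′) p q) σ (1 ℕ.+ costᵀ (e ≤ᴿ e′) ℕ.+ B) P
    go (yes h) = let r = f h in run (⇓then (dec-true (_ ≤? _) h) (halts r)) (ℕₚ.+-monoʳ-≤ (1 ℕ.+ costᵀ (e ≤ᴿ e′)) (bound r)) (post r)
    go (no h)  = let r = g h in run (⇓else (dec-false (_ ≤? _) h) (halts r)) (ℕₚ.+-monoʳ-≤ (1 ℕ.+ costᵀ (e ≤ᴿ e′)) (bound r)) (post r)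

  scalar : ℕ → NatExp
  scalar a = cell a (lit 0) (lit 0)

  size : ℕ → NatExp
  size r = cell 0 (lit r) (lit 0)

  loop : ℕ → ℕ → Program → Program
  loop a r body = setNat a (lit 0) (lit 0) (lit 0)
    ⨾ while (neg (size r ≤ᴺ scalar a)) (body ⨾ setNat a (lit 0) (lit 0) (scalar a ⊕ lit 1))

  tick : ℕ → State → ℕ → State
  tick a τ v = state (write (nats τ) a 0 0 v) (reals τ)

  -- The overhead is 4 for the reset and 9 for the failing test, and per turn 9 for the test and 8
  -- for the increment. The body may write neither the counter nor the input sizes, and the
  -- invariant has to survive any change of the counter cell.
  run-loop : ∀ {a r body σ N B} (Inv : ℕ → State → Set) → (a ≡ᵇ 0) ≡ false → writesᴺ body 0 ≡ false → writesᴺ body a ≡ false →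
    nats σ 0 r 0 ≡ N →
    (∀ {m τ} v → Inv m τ → Inv m (tick a τ v)) → Inv 0 σ →
    (∀ {m τ} → m ℕ.< N → nats τ a 0 0 ≡ m → Frame (loop a r body) σ τ → Inv m τ → Run body τ B (Inv (suc m))) →
    Run (loop a r body) σ (13 ℕ.+ N ℕ.* (17 ℕ.+ B)) (Inv N)
  run-loop {a} {r} {body} {σ} {N} {B} Inv a≢0 w₀ wₐ size≡N stable base step =
    weaken (ℕₚ.≤-reflexive (cong (4 ℕ.+_) (ℕₚ.+-comm (N ℕ.* (17 ℕ.+ B)) 9))) (λ _ h → h)
      (run-setNat {P = λ τ → τ ≡ tick a σ 0} refl then λ { {τ} _ refl →
        iterate N 0 refl (write-hit (nats σ) a 0 0) (start 0) (stable 0 base) })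
    where
    W = loop a r body
    start : ∀ v → Frame W σ (tick a σ v)
    start v = frame (λ a′ w i j → write-array (nats σ) a a′ 0 i 0 j (proj₁ (∨-false {a ≡ᵇ a′} w))) (λ _ _ _ _ → refl)

    onward : ∀ {τ υ} → Frame W σ τ → Frame (body ⨾ setNat a (lit 0) (lit 0) (scalar a ⊕ lit 1)) τ υ → Frame W σ υ
    onward F G = frame (λ a′ w i j → trans (natᶠ G a′ (proj₂ (∨-false {a ≡ᵇ a′} w)) i j) (natᶠ F a′ w i j))
      (λ a′ w i j → trans (realᶠ G a′ w i j) (realᶠ F a′ w i j))

    size≡ : ∀ {τ} → Frame W σ τ → nats τ 0 r 0 ≡ N
    size≡ F = trans (natᶠ F 0 (cong₂ _∨_ a≢0 (cong₂ _∨_ w₀ a≢0)) r 0) size≡N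

    iterate : ∀ fuel m {τ} → m ℕ.+ fuel ≡ N → nats τ a 0 0 ≡ m → Frame W σ τ → Inv m τ →
      Run (while (neg (size r ≤ᴺ scalar a)) (body ⨾ setNat a (lit 0) (lit 0) (scalar a ⊕ lit 1))) τ (fuel ℕ.* (17 ℕ.+ B) ℕ.+ 9) (Inv N)
    iterate zero m {τ} m+0≡N count F inv = run
      (⇓done (cong not (≤⇒≤ᵇ (ℕₚ.≤-reflexive (trans (size≡ F) (sym (trans count m≡N)))))))
      ℕₚ.≤-refl (subst (λ m → Inv m τ) m≡N inv)
      where
      m≡N : m ≡ N
      m≡N = trans (sym (ℕₚ.+-identityʳ m)) m+0≡N
    iterate (suc fuel) m {τ} m+≡N count F inv =
      run (⇓loop (cong not (≰⇒≤ᵇ λ N≤m → ℕₚ.<⇒≱ m<N (subst₂ ℕ._≤_ (size≡ F) count N≤m))) (halts once) (halts rest))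
        (ℕₚ.≤-trans (ℕₚ.+-mono-≤ (ℕₚ.+-monoʳ-≤ 9 (bound once)) (bound rest))
          (ℕₚ.≤-reflexive (trans (cong (λ z → 9 ℕ.+ z ℕ.+ (fuel ℕ.* (17 ℕ.+ B) ℕ.+ 9)) (ℕₚ.+-comm B 8))
            (sym (ℕₚ.+-assoc (17 ℕ.+ B) (fuel ℕ.* (17 ℕ.+ B)) 9)))))
        (post rest)
      where
      m<N : m ℕ.< N
      m<N = subst (suc m ℕ.≤_) (trans (sym (ℕₚ.+-suc m fuel)) m+≡N) (ℕₚ.m≤m+n (suc m) fuel)
      once : Run (body ⨾ setNat a (lit 0) (lit 0) (scalar a ⊕ lit 1)) τ (B ℕ.+ 8) (λ υ → nats υ a 0 0 ≡ suc m × Inv (suc m) υ)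
      once = step m<N count F inv then λ {υ} G inv′ → run-setNat
        (trans (write-hit (nats υ) a 0 0) (trans (cong (ℕ._+ 1) (trans (natᶠ G a wₐ 0 0) count)) (ℕₚ.+-comm m 1)) , stable _ inv′)
      rest = iterate fuel (suc m) (trans (sym (ℕₚ.+-suc m fuel)) m+≡N) (proj₁ (post once)) (onward F (framed once)) (proj₂ (post once))

-- The program

∣tabulate∣-≤ : ∀ {n} (g h : Fin n → Bool) → (∀ i → g i ≡ h i) → ∣ tabulate g ∣ ℕ.≤ ∣ tabulate h ∣
∣tabulate∣-≤ g h g≡h = ℕₚ.≤-reflexive (cong ∣_∣ (tabulate-cong g≡h))

∣∷∣-same : ∀ {n} (s t : Subset n) b {j} → ∣ s ∣ ℕ.≤ j ℕ.+ ∣ t ∣ → ∣ b Vec.∷ s ∣ ℕ.≤ j ℕ.+ ∣ b Vec.∷ t ∣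
∣∷∣-same s t false s≤t = s≤t
∣∷∣-same s t true {j} s≤t = subst (suc ∣ s ∣ ℕ.≤_) (sym (ℕₚ.+-suc j ∣ t ∣)) (ℕ.s≤s s≤t)

∣∷∣-grow : ∀ {n} (s t : Subset n) a b → ∣ s ∣ ℕ.≤ ∣ t ∣ → ∣ a Vec.∷ s ∣ ℕ.≤ suc ∣ b Vec.∷ t ∣
∣∷∣-grow s t false false s≤t = ℕₚ.m≤n⇒m≤1+n s≤t
∣∷∣-grow s t false true  s≤t = ℕₚ.m≤n⇒m≤1+n (ℕₚ.m≤n⇒m≤1+n s≤t)
∣∷∣-grow s t true  false s≤t = ℕ.s≤s s≤t
∣∷∣-grow s t true  true  s≤t = ℕ.s≤s (ℕₚ.m≤n⇒m≤1+n s≤t)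

∣tabulate∣-insert : ∀ {n} (g h : Fin n → Bool) (b : Fin n) → (∀ i → i ≢ b → g i ≡ h i) →
  ∣ tabulate g ∣ ℕ.≤ suc ∣ tabulate h ∣
∣tabulate∣-insert g h zero g≡h = ∣∷∣-grow (tabulate (λ i → g (suc i))) (tabulate (λ i → h (suc i))) (g zero) (h zero)
  (∣tabulate∣-≤ (λ i → g (suc i)) (λ i → h (suc i)) (λ i → g≡h (suc i) λ ()))
∣tabulate∣-insert g h (suc b) g≡h = subst (λ z → ∣ z Vec.∷ tabulate (λ i → g (suc i)) ∣ ℕ.≤ suc ∣ tabulate h ∣) (sym (g≡h zero λ ()))
  (∣∷∣-same (tabulate (λ i → g (suc i))) (tabulate (λ i → h (suc i))) (h zero) {1}
    (∣tabulate∣-insert (λ i → g (suc i)) (λ i → h (suc i)) b (λ i i≢b → g≡h (suc i) λ { refl → i≢b refl })))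

∣tabulate∣-empty : ∀ {n} (g : Fin n → Bool) → (∀ i → g i ≡ false) → ∣ tabulate g ∣ ≡ 0
∣tabulate∣-empty {zero}  g g≡false = refl
∣tabulate∣-empty {suc n} g g≡false rewrite g≡false zero = ∣tabulate∣-empty (λ i → g (suc i)) (λ i → g≡false (suc i))

real : ℕ → RealExp
real a = cell a (lit 0) (lit 0)

-- Integer arrays: 1 marks, 2 candidate x, 3 point y, 4 coordinate, 5 current
-- pick, 6 round.  Real arrays: 2 distances to S, 3 distance, 4 score, 5 best
-- score, 6 the number k, 7 the excess p of the cost.

module Clusterer (R : Reals) where
  open Greedy R
  open Execution R
  open KMeans R using (output)

  dist : RealExp
  dist = cell 2 (scalar 3) (lit 0)

  difference : ℕ → RealExp
  difference a = cell 0 (scalar a) (scalar 4) ⊖ cell 0 (scalar 3) (scalar 4)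

  distance : ℕ → Program
  distance a = setReal 3 (lit 0) (lit 0) (lit 0) ⨾
    loop 4 1 (setReal 3 (lit 0) (lit 0) (real 3 ⊕ (difference a ⊗ difference a)))

  gain : ℕ → Program
  gain N = distance 2 ⨾ ifThenElse ((lit N ⊗ real 3) ≤ᴿ dist)
    (setReal 4 (lit 0) (lit 0) (real 4 ⊕ (dist ⊖ (lit N ⊗ real 3)))) skip

  improve : ℕ → Program
  improve N = setReal 4 (lit 0) (lit 0) (lit 0) ⨾ loop 3 0 (gain N) ⨾ ifThenElse (real 5 ≤ᴿ real 4)
    (setReal 5 (lit 0) (lit 0) (real 4) ⨾ setNat 5 (lit 0) (lit 0) (scalar 2)) skip

  choose : ℕ → Program
  choose N = setReal 5 (lit 0) (lit 0) (lit 0) ⨾ setNat 5 (lit 0) (lit 0) (lit 0) ⨾ loop 2 0 (improve N)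

  refresh : Program
  refresh = distance 5 ⨾ ifThenElse (dist ≤ᴿ real 3) skip (setReal 2 (scalar 3) (lit 0) (real 3))

  round : ℕ → Program
  round N = choose N ⨾ setNat 1 (scalar 5) (lit 0) (lit 1) ⨾ loop 3 0 refresh

  -- The pick cell of array 5 is still 0, so point 0 is the first center.
  prepare : Program
  prepare = setNat 1 (lit 0) (lit 0) (lit 1) ⨾ loop 3 0 (distance 5 ⨾ setReal 2 (scalar 3) (lit 0) (real 3))

  -- Three rounds in each of `k` turns. `k` is counted a second time as a real, since the machine
  -- cannot convert integers and `descend` divides by it.
  seed : ℕ → Program
  seed A = loop 6 2 (setReal 6 (lit 0) (lit 0) (real 6 ⊕ lit 1) ⨾ round A ⨾ round A ⨾ round A)

  -- Real cell 7 is an a priori bound on the relative excess, multiplied by `1 - 1/k` in every turn;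
  -- the test against `ε` replaces a logarithm.
  descend : Program
  descend = while (neg (real 7 ≤ᴿ real 1)) (round 1 ⨾ setReal 7 (lit 0) (lit 0) (real 7 ⊖ (real 7 ⊘ real 6)))

  cluster : ℕ → ℕ → Program
  cluster A P = prepare ⨾ seed A ⨾ setReal 7 (lit 0) (lit 0) (lit P) ⨾ descend

  euclid : ℕ → (ℕ → ℕ → ℝ) → ℕ → ℕ → ℝ
  euclid d xs i j = ∑ d (λ c → (xs i c + - xs j c) * (xs i c + - xs j c))

  -- Correctness and cost of each piece of the program

  module _ (n d k : ℕ) (xs : ℕ → ℕ → ℝ) (ε : ℝ) where
    q : ℕ → ℕ → ℝ
    q = euclid d xs

    record Loaded (σ : State) : Set where
      field
        size-n  : nats σ 0 0 0 ≡ n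
        size-d  : nats σ 0 1 0 ≡ d
        size-k  : nats σ 0 2 0 ≡ k
        coords  : ∀ i c → reals σ 0 i c ≡ xs i c
        epsilon : reals σ 1 0 0 ≡ ε
    open Loaded

    stays : ∀ {p σ τ} → writesᴺ p 0 ≡ false → writesᴿ p 0 ≡ false → writesᴿ p 1 ≡ false →
      Frame p σ τ → Loaded σ → Loaded τ
    stays w₀ r₀ r₁ F L = record
      { size-n = trans (natᶠ F 0 w₀ 0 0) (size-n L)
      ; size-d = trans (natᶠ F 0 w₀ 1 0) (size-d L)
      ; size-k = trans (natᶠ F 0 w₀ 2 0) (size-k L)
      ; coords = λ i c → trans (realᶠ F 0 r₀ i c) (coords L i c)
      ; epsilon = trans (realᶠ F 1 r₁ 0 0) (epsilon L) }

    -- Node counts plus the overhead of `run-loop`: 4 + 13 outside the loop, and 17 + 38 per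
    -- coordinate.
    cost-distance : ℕ
    cost-distance = 17 ℕ.+ d ℕ.* 55

    run-distance : ∀ {σ a I J} → (4 ≡ᵇ a) ≡ false → Loaded σ → nats σ a 0 0 ≡ I → nats σ 3 0 0 ≡ J →
      Run (distance a) σ cost-distance (λ τ → reals τ 3 0 0 ≡ q I J)
    run-distance {σ} {a} {I} {J} a≢4 L at-I at-J =
      run-setReal {P = λ τ → reals τ 3 0 0 ≡ 0#} refl then λ {τ₁} F₁ start →
      run-loop (λ m τ → reals τ 3 0 0 ≡ ∑ m (λ c → (xs I c + - xs J c) * (xs I c + - xs J c)))
        refl refl refl (size-d (stays refl refl refl F₁ L)) (λ _ h → h) start
        λ {m} {τ} m<d at-m F acc →
          let I≡ = trans (natᶠ F a (cong₂ _∨_ a≢4 a≢4) 0 0) (trans (natᶠ F₁ a refl 0 0) at-I)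
              J≡ = trans (natᶠ F 3 refl 0 0) (trans (natᶠ F₁ 3 refl 0 0) at-J)
              L′ = stays {loop 4 1 (setReal 3 (lit 0) (lit 0) (real 3 ⊕ (difference a ⊗ difference a)))} refl refl refl F (stays refl refl refl F₁ L)
              xI = trans (cong₂ (reals τ 0) I≡ at-m) (coords L′ I m)
              xJ = trans (cong₂ (reals τ 0) J≡ at-m) (coords L′ J m)
              Δ = cong₂ (λ u v → u + - v) xI xJ
          in run-setReal (cong₂ _+_ acc (cong₂ _*_ Δ Δ))

    cost-gain cost-improve cost-choose cost-refresh cost-round : ℕ
    cost-gain    = cost-distance ℕ.+ 30
    cost-improve = 4 ℕ.+ ((13 ℕ.+ n ℕ.* (17 ℕ.+ cost-gain)) ℕ.+ 20)
    cost-choose  = 4 ℕ.+ (4 ℕ.+ (13 ℕ.+ n ℕ.* (17 ℕ.+ cost-improve)))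
    cost-refresh = cost-distance ℕ.+ 18
    cost-round   = cost-choose ℕ.+ (6 ℕ.+ (13 ℕ.+ n ℕ.* (17 ℕ.+ cost-refresh)))

    Stores : (ℕ → ℝ) → State → Set
    Stores D σ = ∀ y → y ℕ.< n → reals σ 2 y 0 ≡ D y

    run-gain : ∀ {σ D x y s} N → Loaded σ → Stores D σ → y ℕ.< n → nats σ 2 0 0 ≡ x → nats σ 3 0 0 ≡ y → reals σ 4 0 0 ≡ s →
      Run (gain N) σ cost-gain (λ τ → reals τ 4 0 0 ≡ s + excess (# N * q x y) (D y))
    run-gain {σ} {D} {x} {y} {s} N L stored y<n at-x at-y acc =
      run-distance refl L at-x at-y then λ {τ} F q≡ →
      let s≡ = trans (realᶠ F 4 refl 0 0) acc
          D≡ : reals τ 2 (nats τ 3 0 0) 0 ≡ D y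
          D≡ = trans (cong (λ z → reals τ 2 z 0) (trans (natᶠ F 3 refl 0 0) at-y)) (trans (realᶠ F 2 refl y 0) (stored y y<n))
          Nq≡ : fromℕ N * reals τ 3 0 0 ≡ # N * q x y
          Nq≡ = cong₂ _*_ (sym (#≡fromℕ N)) q≡
      in run-if
        (λ h → run-setReal (cong₂ _+_ s≡ (trans (cong₂ (λ u v → u + - v) D≡ Nq≡) (sym (excess-pos (subst₂ _≤_ Nq≡ D≡ h))))))
        (λ h → weaken (ℕ.s≤s ℕ.z≤n) (λ _ h → h) (run-skip (trans s≡
          (trans (sym (+-identityʳ s)) (cong (s +_) (sym (excess-neg (λ h′ → h (subst₂ _≤_ (sym Nq≡) (sym D≡) h′)))))))))

    run-improve : ∀ {σ D x g v} N → Loaded σ → Stores D σ → nats σ 2 0 0 ≡ x → (nats σ 5 0 0 , reals σ 5 0 0) ≡ (g , v) →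
      Run (improve N) σ cost-improve (λ τ → (nats τ 5 0 0 , reals τ 5 0 0) ≡ advance (g , v) x (score n q N D x))
    run-improve {σ} {D} {x} {g} {v} N L stored at-x at-best =
      run-setReal {P = λ τ → reals τ 4 0 0 ≡ 0#} refl then λ {τ₁} F₁ start →
      run-loop (λ m τ → reals τ 4 0 0 ≡ ∑ m (λ y → excess (# N * q x y) (D y)))
        refl refl refl (size-n (stays refl refl refl F₁ L)) (λ _ h → h) start
        (λ {m} {τ} m<n at-m F acc → run-gain N
          (stays {loop 3 0 (gain N)} refl refl refl F (stays refl refl refl F₁ L))
          (λ y y<n → trans (realᶠ F 2 refl y 0) (trans (realᶠ F₁ 2 refl y 0) (stored y y<n)))
          m<n (trans (natᶠ F 2 refl 0 0) (trans (natᶠ F₁ 2 refl 0 0) at-x)) at-m acc)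
      then λ {τ₂} F₂ score≡ →
      let g≡ = trans (natᶠ F₂ 5 refl 0 0) (trans (natᶠ F₁ 5 refl 0 0) (cong proj₁ at-best))
          v≡ = trans (realᶠ F₂ 5 refl 0 0) (trans (realᶠ F₁ 5 refl 0 0) (cong proj₂ at-best))
          x≡ = trans (natᶠ F₂ 2 refl 0 0) (trans (natᶠ F₁ 2 refl 0 0) at-x)
      in run-if
        (λ h → run-setReal {P = λ τ → reals τ 5 0 0 ≡ score n q N D x} score≡ then λ F₃ w≡ →
          run-setNat (trans (cong₂ _,_ (trans (natᶠ F₃ 2 refl 0 0) x≡) w≡) (sym (advance-yes (subst₂ _≤_ v≡ score≡ h)))))
        (λ h → weaken (ℕ.s≤s ℕ.z≤n) (λ _ h → h) (run-skip (trans (cong₂ _,_ g≡ v≡)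
          (sym (advance-no (λ h′ → h (subst₂ _≤_ (sym v≡) (sym score≡) h′)))))))

    run-choose : ∀ {σ D} N → Loaded σ → Stores D σ →
      Run (choose N) σ cost-choose (λ τ → nats τ 5 0 0 ≡ argmax n (score n q N D))
    run-choose {σ} {D} N L stored =
      run-setReal {P = λ τ → reals τ 5 0 0 ≡ 0#} refl then λ {τ₁} F₁ v≡ →
      run-setNat {P = λ τ → (nats τ 5 0 0 , reals τ 5 0 0) ≡ (0 , 0#)} (cong (0 ,_) v≡) then λ {τ₂} F₂ start →
      weaken ℕₚ.≤-refl (λ _ h → cong proj₁ h)
        (run-loop (λ m τ → (nats τ 5 0 0 , reals τ 5 0 0) ≡ scan (score n q N D) m)
          refl refl refl (size-n (stays refl refl refl F₂ (stays refl refl refl F₁ L))) (λ _ h → h) start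
          (λ {m} {τ} m<n at-m F best → run-improve N
            (stays {loop 2 0 (improve N)} refl refl refl F (stays refl refl refl F₂ (stays refl refl refl F₁ L)))
            (λ y y<n → trans (realᶠ F 2 refl y 0) (trans (realᶠ F₂ 2 refl y 0) (trans (realᶠ F₁ 2 refl y 0) (stored y y<n))))
            at-m best))

    run-refresh : ∀ {σ b y} (D : ℕ → ℝ) → Loaded σ → reals σ 2 y 0 ≡ D y → nats σ 5 0 0 ≡ b → nats σ 3 0 0 ≡ y →
      Run refresh σ cost-refresh (λ τ → reals τ 2 y 0 ≡ D y ⊓ q b y × (∀ y′ → y ≢ y′ → reals τ 2 y′ 0 ≡ reals σ 2 y′ 0))
    run-refresh {σ} {b} {y} D L stored at-b at-y =
      run-distance refl L at-b at-y then λ {τ} F q≡ →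
      let y≡ = trans (natᶠ F 3 refl 0 0) at-y
          D≡ : reals τ 2 (nats τ 3 0 0) 0 ≡ D y
          D≡ = trans (cong (λ z → reals τ 2 z 0) y≡) (trans (realᶠ F 2 refl y 0) stored)
      in run-if
        (λ h → weaken (ℕ.s≤s ℕ.z≤n) (λ _ h → h) (run-skip
          ( trans (realᶠ F 2 refl y 0) (trans stored (sym (⊓-yes (subst₂ _≤_ D≡ q≡ h))))
          , λ y′ _ → realᶠ F 2 refl y′ 0)))
        (λ h → run-setReal
          ( trans (cong (λ z → write (reals τ) 2 z 0 (reals τ 3 0 0) 2 y 0) y≡)
              (trans (write-hit (reals τ) 2 y 0) (trans q≡ (sym (⊓-no (λ h′ → h (subst₂ _≤_ (sym D≡) (sym q≡) h′))))))
          , λ y′ y≢y′ → trans (write-row (reals τ) 2 0 0 (λ z≡ → y≢y′ (trans (sym y≡) z≡))) (realᶠ F 2 refl y′ 0)))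

    Marks : ℕ → State → State → Set
    Marks b σ τ = nats τ 1 b 0 ≡ 1 × (∀ i → b ≢ i → nats τ 1 i 0 ≡ nats σ 1 i 0)

    run-round : ∀ {σ D} N → Loaded σ → Stores D σ →
      Run (round N) σ cost-round (λ τ → Stores (next n q (score n q N) D) τ × Marks (argmax n (score n q N D)) σ τ)
    run-round {σ} {D} N L stored =
      run-choose N L stored then λ {τ₁} F₁ b≡ →
      run-setNat {P = λ τ → Marks b σ τ}
        ( trans (cong (λ z → write (nats τ₁) 1 z 0 1 1 b 0) b≡) (write-hit (nats τ₁) 1 b 0)
        , λ i b≢i → trans (write-row (nats τ₁) 1 0 0 (λ z≡ → b≢i (trans (sym b≡) z≡))) (natᶠ F₁ 1 refl i 0))
      then λ {τ₂} F₂ marked →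
      let L₂ = stays {setNat 1 (scalar 5) (lit 0) (lit 1)} refl refl refl F₂ (stays {choose N} refl refl refl F₁ L)
          stored₂ : Stores D τ₂
          stored₂ y y<n = trans (realᶠ F₂ 2 refl y 0) (trans (realᶠ F₁ 2 refl y 0) (stored y y<n))
      in weaken ℕₚ.≤-refl
        (λ F₃ inv → (λ y y<n → proj₁ inv y y<n)
          , trans (natᶠ F₃ 1 refl b 0) (proj₁ marked) , λ i b≢i → trans (natᶠ F₃ 1 refl i 0) (proj₂ marked i b≢i))
        -- The distances are overwritten in place: updated below `m`, still old from `m` on.
        (run-loop (λ m τ → (∀ y → y ℕ.< m → reals τ 2 y 0 ≡ D y ⊓ q b y) × (∀ y → m ℕ.≤ y → y ℕ.< n → reals τ 2 y 0 ≡ D y))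
          refl refl refl (size-n L₂) (λ _ h → h) ((λ _ ()) , λ y _ y<n → stored₂ y y<n)
          (λ {m} {τ} m<n at-m F inv → weaken ℕₚ.≤-refl
            (λ {υ} _ new → (λ y y≤m → older {m} {τ} {υ} inv new y (ℕₚ.m≤n⇒m<n∨m≡n (ℕₚ.≤-pred y≤m)))
              , λ y m<y y<n → trans (proj₂ new y (ℕₚ.<⇒≢ m<y)) (proj₂ inv y (ℕₚ.<⇒≤ m<y) y<n))
            (run-refresh D (stays {loop 3 0 refresh} refl refl refl F L₂) (proj₂ inv m ℕₚ.≤-refl m<n)
              (trans (natᶠ F 5 refl 0 0) (trans (natᶠ F₂ 5 refl 0 0) b≡)) at-m)))
      where
      b : ℕ
      b = argmax n (score n q N D)
      older : ∀ {m} {τ υ : State} →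
        (∀ y → y ℕ.< m → reals τ 2 y 0 ≡ D y ⊓ q b y) × (∀ y → m ℕ.≤ y → y ℕ.< n → reals τ 2 y 0 ≡ D y) →
        reals υ 2 m 0 ≡ D m ⊓ q b m × (∀ y′ → m ≢ y′ → reals υ 2 y′ 0 ≡ reals τ 2 y′ 0) →
        ∀ y → y ℕ.< m ⊎ y ≡ m → reals υ 2 y 0 ≡ D y ⊓ q b y
      older inv new y (inj₁ y<m)  = trans (proj₂ new y (λ m≡y → ℕₚ.<⇒≢ y<m (sym m≡y))) (proj₁ inv y y<m)
      older inv new y (inj₂ refl) = proj₁ new

    -- `covered` lets `∑ n D` bound the cost of the output from above: each stored distance is
    -- attained at a marked point.
    record Good (j : ℕ) (D : ℕ → ℝ) (σ : State) : Set where
      field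
        loaded  : Loaded σ
        stored  : Stores D σ
        covered : ∀ y → y ℕ.< n → ∃[ c ] (c ℕ.< n × nats σ 1 c 0 ≢ 0 × D y ≡ q c y)
        few     : ∣ output n σ ∣ ℕ.≤ j
    open Good

    marked : State → Fin n → Bool
    marked σ i = not (nats σ 1 (toℕ i) 0 ≡ᵇ 0)

    marks-few : ∀ {σ τ b j} → b ℕ.< n → Marks b σ τ → ∣ output n σ ∣ ℕ.≤ j → ∣ output n τ ∣ ℕ.≤ suc j
    marks-few {σ} {τ} b<n (_ , same) few = ℕₚ.≤-trans
      (∣tabulate∣-insert (marked τ) (marked σ) (fromℕ< b<n) (λ i i≢b → cong (λ z → not (z ≡ᵇ 0))
        (same (toℕ i) (λ b≡i → i≢b (toℕ-injective (trans (sym b≡i) (sym (toℕ-fromℕ< b<n))))))))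
      (ℕ.s≤s few)

    still-marked : ∀ {σ τ b c} → Marks b σ τ → nats σ 1 c 0 ≢ 0 → nats τ 1 c 0 ≢ 0
    still-marked {σ} {τ} {b} {c} (hit , same) mark-c ≡0 = decide (b ℕₚ.≟ c)
      where
      decide : Dec (b ≡ c) → ⊥
      decide (yes refl) with trans (sym hit) ≡0
      ... | ()
      decide (no b≢c)   = mark-c (trans (sym (same c b≢c)) ≡0)

    good-frame : ∀ {p σ τ j D} → writesᴺ p 0 ≡ false → writesᴺ p 1 ≡ false → writesᴿ p 0 ≡ false → writesᴿ p 1 ≡ false →
      writesᴿ p 2 ≡ false → Frame p σ τ → Good j D σ → Good j D τ
    good-frame {p} {σ} {τ} w₀ w₁ r₀ r₁ r₂ F G = record
      { loaded = stays {p} w₀ r₀ r₁ F (loaded G)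
      ; stored = λ y y<n → trans (realᶠ F 2 r₂ y 0) (stored G y y<n)
      ; covered = λ y y<n → let c , c<n , mark-c , D≡ = covered G y y<n in
          c , c<n , (λ ≡0 → mark-c (trans (sym (natᶠ F 1 w₁ c 0)) ≡0)) , D≡
      ; few = ℕₚ.≤-trans (∣tabulate∣-≤ (marked τ) (marked σ) (λ i → cong (λ z → not (z ≡ᵇ 0)) (natᶠ F 1 w₁ (toℕ i) 0))) (few G) }

    good-tick : ∀ {σ j D} v → Good j D σ → Good j D (tick 6 σ v)
    good-tick v G = record
      { loaded = record { size-n = size-n (loaded G) ; size-d = size-d (loaded G) ; size-k = size-k (loaded G)
          ; coords = coords (loaded G) ; epsilon = epsilon (loaded G) }
      ; stored = stored G ; covered = covered G ; few = few G }

    run-round-good : ∀ {σ j D} N → 0 ℕ.< n → Good j D σ →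
      Run (round N) σ cost-round (Good (suc j) (next n q (score n q N) D))
    run-round-good {σ} {j} {D} N 0<n G = weaken ℕₚ.≤-refl
      (λ {τ} F (stored′ , marks) → record
        { loaded = stays {round N} refl refl refl F (loaded G)
        ; stored = stored′
        ; covered = λ y y<n → choice τ marks y y<n (⊓-sel (D y) (q b y))
        ; few = marks-few {σ} {τ} b<n marks (few G) })
      (run-round N (loaded G) (stored G))
      where
      b : ℕ
      b = argmax n (score n q N D)
      b<n : b ℕ.< n
      b<n = argmax-< n (λ x _ → 0≤score n q N D x) 0<n
      choice : ∀ τ → Marks b σ τ → ∀ y → y ℕ.< n → (D y ⊓ q b y ≡ D y) ⊎ (D y ⊓ q b y ≡ q b y) →
        ∃[ c ] (c ℕ.< n × nats τ 1 c 0 ≢ 0 × D y ⊓ q b y ≡ q c y)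
      choice τ marks y y<n (inj₁ ≡D) = let c , c<n , mark-c , D≡ = covered G y y<n in
        c , c<n , still-marked {σ} {τ} marks mark-c , trans ≡D D≡
      choice τ marks y y<n (inj₂ ≡q) = b , b<n , (λ ≡0 → 1≢0 (trans (sym (proj₁ marks)) ≡0)) , ≡q
        where
        1≢0 : 1 ≢ 0
        1≢0 ()

    cost-prepare : ℕ
    cost-prepare = 4 ℕ.+ (13 ℕ.+ n ℕ.* (17 ℕ.+ (cost-distance ℕ.+ 8)))

    run-prepare : ∀ {σ} → 0 ℕ.< n → Loaded σ → nats σ 5 0 0 ≡ 0 → (∀ i → nats σ 1 i 0 ≡ 0) →
      Run prepare σ cost-prepare (Good 1 (q 0))
    run-prepare {σ} 0<n L at-0 blank =
      run-setNat {P = Marks 0 σ} (write-hit (nats σ) 1 0 0 , λ i 0≢i → write-row (nats σ) 1 0 0 0≢i) then λ {τ₁} F₁ marks →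
      let L₁ = stays {setNat 1 (lit 0) (lit 0) (lit 1)} refl refl refl F₁ L in
      weaken ℕₚ.≤-refl
        (λ {τ} F stored′ → record
          { loaded = stays {loop 3 0 (distance 5 ⨾ setReal 2 (scalar 3) (lit 0) (real 3))} refl refl refl F L₁
          ; stored = stored′
          ; covered = λ y _ → 0 , 0<n , (λ ≡0 → 1≢0 (trans (sym (proj₁ marks)) (trans (sym (natᶠ F 1 refl 0 0)) ≡0))) , refl
          ; few = ℕₚ.≤-trans (∣tabulate∣-≤ (marked τ) (marked τ₁) (λ i → cong (λ z → not (z ≡ᵇ 0)) (natᶠ F 1 refl (toℕ i) 0)))
              (marks-few {σ} {τ₁} 0<n marks (ℕₚ.≤-reflexive (∣tabulate∣-empty (marked σ) (λ i → cong (λ z → not (z ≡ᵇ 0)) (blank (toℕ i)))))) })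
        (run-loop (λ m τ → ∀ y → y ℕ.< m → reals τ 2 y 0 ≡ q 0 y) refl refl refl (size-n L₁) (λ _ h → h) (λ _ ())
          λ {m} {τ} m<n at-m F inv →
            run-distance refl (stays {loop 3 0 (distance 5 ⨾ setReal 2 (scalar 3) (lit 0) (real 3))} refl refl refl F L₁)
              (trans (natᶠ F 5 refl 0 0) (trans (natᶠ F₁ 5 refl 0 0) at-0)) at-m
            then λ {υ} F₂ q≡ → run-setReal λ y y≤m → filled F₂ q≡ at-m inv y (ℕₚ.m≤n⇒m<n∨m≡n (ℕₚ.≤-pred y≤m)))
      where
      1≢0 : 1 ≢ 0
      1≢0 ()
      filled : ∀ {m τ υ} → Frame (distance 5) τ υ → reals υ 3 0 0 ≡ q 0 m → nats τ 3 0 0 ≡ m → (∀ y → y ℕ.< m → reals τ 2 y 0 ≡ q 0 y) →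
        ∀ y → y ℕ.< m ⊎ y ≡ m → write (reals υ) 2 (nats υ 3 0 0) 0 (reals υ 3 0 0) 2 y 0 ≡ q 0 y
      filled {m} {τ} {υ} F q≡ at-m inv y (inj₁ y<m) =
        trans (write-row (reals υ) 2 0 0 (λ z≡y → ℕₚ.<⇒≢ y<m (trans (sym z≡y) (trans (natᶠ F 3 refl 0 0) at-m))))
          (trans (realᶠ F 2 refl y 0) (inv y y<m))
      filled {m} {τ} {υ} F q≡ at-m inv y (inj₂ refl) =
        trans (cong (λ z → write (reals υ) 2 z 0 (reals υ 3 0 0) 2 y 0) (trans (natᶠ F 3 refl 0 0) at-m))
          (trans (write-hit (reals υ) 2 y 0) q≡)

    cost-seed : ℕ
    cost-seed = 13 ℕ.+ k ℕ.* (17 ℕ.+ (8 ℕ.+ (cost-round ℕ.+ (cost-round ℕ.+ cost-round))))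

    run-seed : ∀ {σ} A → 0 ℕ.< n → Good 1 (q 0) σ → reals σ 6 0 0 ≡ 0# →
      Run (seed A) σ cost-seed (λ τ → Good (suc (k ℕ.* 3)) (rounds n q (score n q A) (q 0) (k ℕ.* 3)) τ × reals τ 6 0 0 ≡ # k)
    run-seed {σ} A 0<n G at-0 = run-loop
      (λ m τ → Good (suc (m ℕ.* 3)) (rounds n q (score n q A) (q 0) (m ℕ.* 3)) τ × reals τ 6 0 0 ≡ # m)
      refl refl refl (size-k (loaded G)) (λ v (G , h) → good-tick v G , h) (G , trans at-0 (sym #0))
      λ {m} {τ} m<k at-m F (G , count) →
        run-setReal {P = λ τ → reals τ 6 0 0 ≡ # (suc m)}
          -- The literal 1 evaluates to `1# + 0#`.
          (trans (cong₂ _+_ count (+-identityʳ 1#)) (trans (+-comm (# m) 1#) (sym (#-suc m))))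
        then λ {τ₁} F₁ h₁ → run-round-good A 0<n (good-frame {setReal 6 (lit 0) (lit 0) (real 6 ⊕ lit 1)} refl refl refl refl refl F₁ G)
        then λ {τ₂} F₂ G₂ → run-round-good A 0<n G₂
        then λ {τ₃} F₃ G₃ → weaken ℕₚ.≤-refl
          (λ F₄ G₄ → G₄ , trans (realᶠ F₄ 6 refl 0 0) (trans (realᶠ F₃ 6 refl 0 0) (trans (realᶠ F₂ 6 refl 0 0) h₁)))
          (run-round-good A 0<n G₃)

    slack : ℝ → ℕ → ℝ
    slack p zero    = p
    slack p (suc t) = slack p t + - (slack p t * (# k) ⁻¹)

    cost-step : ℕ
    cost-step = 9 ℕ.+ (cost-round ℕ.+ 14)

    -- `M` supplies the fuel that makes the loop terminate. The number `m` of turns is estimated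
    -- through the last component: one turn earlier the bound was still above `ε`.
    run-descend : ∀ {σ j D p M} → 0 ℕ.< n → Good j D σ → reals σ 6 0 0 ≡ # k → reals σ 7 0 0 ≡ p → slack p M ≤ ε →
      ∃[ m ] (Run descend σ (m ℕ.* cost-step ℕ.+ 9) (λ τ → Good (m ℕ.+ j) (rounds n q (score n q 1) D m) τ × slack p m ≤ ε)
        × (∀ i → suc i ≡ m → ε < slack p i))
    run-descend {σ} {j} {D} {p} {M} 0<n G at-k at-p stop =
      let s , m , s+0≡m , r , before = go M 0 (ℕₚ.+-identityʳ M) (G , at-k , at-p) (λ _ ()) (p ≤? ε) in
      m , subst (λ s → Run descend σ (s ℕ.* cost-step ℕ.+ 9) (Done m)) (trans (sym (ℕₚ.+-identityʳ s)) s+0≡m) r , before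
      where
      Done : ℕ → State → Set
      Done m τ = Good (m ℕ.+ j) (rounds n q (score n q 1) D m) τ × slack p m ≤ ε

      Outcome : ℕ → State → Set
      Outcome t τ = Σ[ s ∈ ℕ ] Σ[ m ∈ ℕ ] (s ℕ.+ t ≡ m × Run descend τ (s ℕ.* cost-step ℕ.+ 9) (Done m)
        × (∀ i → suc i ≡ m → ε < slack p i))

      At : ℕ → State → Set
      At t τ = Good (t ℕ.+ j) (rounds n q (score n q 1) D t) τ × reals τ 6 0 0 ≡ # k × reals τ 7 0 0 ≡ slack p t

      body : Program
      body = round 1 ⨾ setReal 7 (lit 0) (lit 0) (real 7 ⊖ (real 7 ⊘ real 6))

      once : ∀ {t τ} → At t τ → Run body τ (cost-round ℕ.+ 14) (At (suc t))
      once {t} (G , at-k , at-p) = run-round-good 1 0<n G then λ {τ₁} F₁ G₁ →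
        weaken ℕₚ.≤-refl
          (λ F₂ h → good-frame {setReal 7 (lit 0) (lit 0) (real 7 ⊖ (real 7 ⊘ real 6))} refl refl refl refl refl F₂ G₁
            , trans (realᶠ F₂ 6 refl 0 0) (trans (realᶠ F₁ 6 refl 0 0) at-k) , h)
          (run-setReal {P = λ υ → reals υ 7 0 0 ≡ slack p (suc t)}
            (cong₂ (λ u v → u + - (u * v ⁻¹)) (trans (realᶠ F₁ 7 refl 0 0) at-p) (trans (realᶠ F₁ 6 refl 0 0) at-k)))

      halt : ∀ {t τ} → At t τ → slack p t ≤ ε → (∀ i → suc i ≡ t → ε < slack p i) → Outcome t τ
      halt {t} (G , _ , at-p) p≤ε before = 0 , t , refl
        , run (⇓done (cong not (dec-true (_ ≤? _) (subst₂ _≤_ (sym at-p) (sym (epsilon (loaded G))) p≤ε)))) ℕₚ.≤-refl (G , p≤ε) , before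

      extend : ∀ {t τ} → At t τ → ¬ slack p t ≤ ε → (r : Run body τ (cost-round ℕ.+ 14) (At (suc t))) → Outcome (suc t) (final r) → Outcome t τ
      extend {t} (G , _ , at-p) p≰ε r (s , m , s+≡m , r′ , before) = suc s , m , trans (sym (ℕₚ.+-suc s t)) s+≡m
        , run (⇓loop (cong not (dec-false (_ ≤? _) (λ h → p≰ε (subst₂ _≤_ at-p (epsilon (loaded G)) h)))) (halts r) (halts r′))
            (ℕₚ.≤-trans (ℕₚ.+-mono-≤ (ℕₚ.+-monoʳ-≤ 9 (bound r)) (bound r′))
              (ℕₚ.≤-reflexive (sym (ℕₚ.+-assoc cost-step (s ℕ.* cost-step) 9))))
            (post r′)
        , before

      go : ∀ fuel t {τ} → fuel ℕ.+ t ≡ M → At t τ → (∀ i → suc i ≡ t → ε < slack p i) → Dec (slack p t ≤ ε) → Outcome t τ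
      go fuel       t _    at before (yes p≤ε) = halt at p≤ε before
      go zero       t refl at before (no p≰ε)  = ⊥-elim (p≰ε stop)
      go (suc fuel) t eq   at before (no p≰ε)  = let r = once at in
        extend at p≰ε r (go fuel (suc t) (trans (ℕₚ.+-suc fuel t) eq) (post r) (λ { i refl → ≰⇒> p≰ε }) (slack p (suc t) ≤? ε))

    cost-cluster : ℕ → ℕ
    cost-cluster m = cost-prepare ℕ.+ (cost-seed ℕ.+ (4 ℕ.+ (m ℕ.* cost-step ℕ.+ 9)))

    run-cluster : ∀ {σ M} A P → 0 ℕ.< n → Loaded σ → nats σ 5 0 0 ≡ 0 → (∀ i → nats σ 1 i 0 ≡ 0) → reals σ 6 0 0 ≡ 0# →
      slack (# P) M ≤ ε →
      ∃[ m ] (Run (cluster A P) σ (cost-cluster m)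
          (λ τ → Good (m ℕ.+ suc (k ℕ.* 3)) (rounds n q (score n q 1) (rounds n q (score n q A) (q 0) (k ℕ.* 3)) m) τ × slack (# P) m ≤ ε)
        × (∀ i → suc i ≡ m → ε < slack (# P) i))
    run-cluster {σ} {M} A P 0<n L at-5 blank at-6 stop =
      let r₁ = run-prepare 0<n L at-5 blank
          r₂ = run-seed A 0<n (post r₁) (trans (realᶠ (framed r₁) 6 refl 0 0) at-6)
          r₃ : Run (setReal 7 (lit 0) (lit 0) (lit P)) (final r₂) 4 (λ τ → reals τ 7 0 0 ≡ # P)
          r₃ = run-setReal (sym (#≡fromℕ P))
          m , r₄ , before = run-descend {M = M} 0<n
            (good-frame {setReal 7 (lit 0) (lit 0) (lit P)} refl refl refl refl refl (framed r₃) (proj₁ (post r₂)))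
            (trans (realᶠ (framed r₃) 6 refl 0 0) (proj₂ (post r₂))) (post r₃) stop
      in m , run (⇓seq (halts r₁) (⇓seq (halts r₂) (⇓seq (halts r₃) (halts r₄))))
             (ℕₚ.+-mono-≤ (bound r₁) (ℕₚ.+-mono-≤ (bound r₂) (ℕₚ.+-mono-≤ (bound r₃) (bound r₄)))) (post r₄)
         , before

-- From the program back to subsets of X

-- Past the last element the value is `n`, which `clamp` sends to 0.
nth : ∀ {n} → Subset n → ℕ → ℕ
nth []          i       = 0
nth (true  ∷ s) zero    = 0
nth (true  ∷ s) (suc i) = suc (nth s i)
nth (false ∷ s) i       = suc (nth s i)

rank : ∀ {n} {s : Subset n} {x} → x ∈ s → ∃[ i ] (i ℕ.< ∣ s ∣ × nth s i ≡ toℕ x)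
rank here = 0 , ℕ.z<s , refl
rank {s = true ∷ s}  (there x∈s) = let i , i<s , eq = rank x∈s in suc i , ℕ.s<s i<s , cong suc eq
rank {s = false ∷ s} (there x∈s) = let i , i<s , eq = rank x∈s in i , i<s , cong suc eq

clamp : ℕ → ℕ → ℕ
clamp n m with m ℕₚ.<? n
... | yes _ = m
... | no  _ = 0

clamp-< : ∀ {n} m → 0 ℕ.< n → clamp n m ℕ.< n
clamp-< {n} m 0<n with m ℕₚ.<? n
... | yes m<n = m<n
... | no  _   = 0<n

clamp-≡ : ∀ {n m} → m ℕ.< n → clamp n m ≡ m
clamp-≡ {n} {m} m<n with m ℕₚ.<? n
... | yes _   = refl
... | no  m≮n = ⊥-elim (m≮n m<n)

extend : ∀ {n} → (Fin n → ℕ) → ℕ → ℕ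
extend {zero}  g y       = 0
extend {suc n} g zero    = g zero
extend {suc n} g (suc y) = extend (g ∘ suc) y

extend-toℕ : ∀ {n} (g : Fin n → ℕ) i → extend g (toℕ i) ≡ g i
extend-toℕ g zero    = refl
extend-toℕ g (suc i) = extend-toℕ (g ∘ suc) i

-- Moves additive overhead into the coefficient of a positive product, which turns nested loop costs
-- into a single multiple of `n n d`.
absorbˡ : ∀ c e x .{{_ : NonZero x}} → c ℕ.+ x ℕ.* e ℕ.≤ x ℕ.* (c ℕ.+ e)
absorbˡ c e x = subst (c ℕ.+ x ℕ.* e ℕ.≤_) (sym (ℕₚ.*-distribˡ-+ x c e)) (ℕₚ.+-monoˡ-≤ (x ℕ.* e) (ℕₚ.m≤n*m c x))

absorbʳ : ∀ c e x .{{_ : NonZero x}} → x ℕ.* e ℕ.+ c ℕ.≤ x ℕ.* (e ℕ.+ c)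
absorbʳ c e x = subst (x ℕ.* e ℕ.+ c ℕ.≤_) (sym (ℕₚ.*-distribˡ-+ x e c)) (ℕₚ.+-monoʳ-≤ (x ℕ.* e) (ℕₚ.m≤n*m c x))

module Assembly (R : Reals) where
  open Greedy R
  open Execution R
  open Clusterer R hiding (q)
  open KMeans R using (‖_‖²; _⊟_; min[_,_]; f; inputReals; input; output)
  open import Data.List.Extrema totalOrder using (min≤xs; argmin-sel)
  open Logarithm R

  -- 8 A: after the seeding phase the cost is at most 1 + P times the optimum.
  P : ℕ
  P = 2 ℕ.^ 22

  euclidean : ℕ → (ℕ → ℕ → ℝ) → QuasiMetric
  euclidean d xs = record
    { q = euclid d xs
    ; 0≤q = λ i j → ∑-nonneg d (λ c _ → 0≤x² _)
    ; q-refl = λ i → ∑-zero d (λ c _ → solve 1 (λ x → (x :- x) :* (x :- x) := κ 0) refl (xs i c))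
    ; q-sym = λ i j → ∑-cong d (λ c _ → solve 2 (λ x y → (x :- y) :* (x :- y) := (y :- x) :* (y :- x)) refl (xs i c) (xs j c))
    ; q-tri = λ i j l → ≤-trans (∑-mono d (λ c _ → square (xs i c) (xs j c) (xs l c)))
        (≤-reflexive (trans (∑-+ d _ _) (cong₂ _+_ (∑-*ˡ d (# 2) _) (∑-*ˡ d (# 2) _)))) }
    where
    square : ∀ x y z → (x + - z) * (x + - z) ≤ # 2 * ((x + - y) * (x + - y)) + # 2 * ((y + - z) * (y + - z))
    -- Parallelogram law: the defect is the square of `(x - y) - (y - z)`.
    square x y z = lin (0≤x² ((x + - y) + - (y + - z)))
      (solve 3 (λ x y z → (x :- z) :* (x :- z) :+ ((x :- y) :- (y :- z)) :* ((x :- y) :- (y :- z))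
        := (κ 2 :* ((x :- y) :* (x :- y)) :+ κ 2 :* ((y :- z) :* (y :- z))) :+ κ 0) refl x y z)

  ∑-front : ∀ n (h : ℕ → ℝ) → ∑ (suc n) h ≡ h 0 + ∑ n (h ∘ suc)
  ∑-front zero    h = +-comm 0# (h 0)
  ∑-front (suc n) h = trans (cong (_+ h (suc n)) (∑-front n h)) (+-assoc _ _ _)

  sum-≤-∑ : ∀ {n} (g : Fin n → ℝ) (h : ℕ → ℝ) → (∀ i → g i ≤ h (toℕ i)) → sum g ≤ ∑ n h
  sum-≤-∑ {zero}  g h g≤h = ≤-refl
  sum-≤-∑ {suc n} g h g≤h = subst (sum g ≤_) (sym (∑-front n h)) (g≤h zero ⟨+⟩ sum-≤-∑ (g ∘ suc) (h ∘ suc) (g≤h ∘ suc))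

  ∑-≤-sum : ∀ {n} (g : Fin n → ℝ) (h : ℕ → ℝ) → (∀ i → h (toℕ i) ≤ g i) → ∑ n h ≤ sum g
  ∑-≤-sum {zero}  g h h≤g = ≤-refl
  ∑-≤-sum {suc n} g h h≤g = subst (_≤ sum g) (sym (∑-front n h)) (h≤g zero ⟨+⟩ ∑-≤-sum (g ∘ suc) (h ∘ suc) (h≤g ∘ suc))

  sum-≡-∑ : ∀ {n} (g : Fin n → ℝ) (h : ℕ → ℝ) → (∀ i → g i ≡ h (toℕ i)) → sum g ≡ ∑ n h
  sum-≡-∑ g h g≡h = antisym (sum-≤-∑ g h (≤-reflexive ∘ g≡h)) (∑-≤-sum g h (≤-reflexive ∘ sym ∘ g≡h))

  min-≤ : ∀ {n} {S : Subset n} (ne : Nonempty S) (g : Fin n → ℝ) {j} → j ∈ S → min[ S , ne ] g ≤ g j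
  min-≤ {S = S} ne g {j} j∈S = All-lookup (min≤xs (g (proj₁ ne)) (List.map g (filter (_∈? S) (allFin _))))
    (∈-map⁺ g (∈-filter⁺ (_∈? S) (∈-allFin j) j∈S))

  min-attained : ∀ {n} {S : Subset n} (ne : Nonempty S) (g : Fin n → ℝ) → ∃[ j ] (j ∈ S × min[ S , ne ] g ≡ g j)
  min-attained {S = S} ne g with argmin-sel id (g (proj₁ ne)) (List.map g (filter (_∈? S) (allFin _)))
  ... | inj₁ ≡g = proj₁ ne , proj₂ ne , ≡g
  ... | inj₂ ∈map with ∈-map⁻ g ∈map
  ...   | j , j∈filter , ≡g = j , proj₂ (∈-filter⁻ (_∈? S) {xs = allFin _} j∈filter) , ≡g

  module _ {n d} (X : Fin n → Fin d → ℝ) (ε : ℝ) where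
    xs : ℕ → ℕ → ℝ
    xs = inputReals X ε 0

    xs-toℕ : ∀ i c → xs (toℕ i) (toℕ c) ≡ X i c
    xs-toℕ i c with toℕ i ℕₚ.<? n | toℕ c ℕₚ.<? d
    ... | yes i<n | yes c<d = cong₂ X (fromℕ<-toℕ i i<n) (fromℕ<-toℕ c c<d)
    ... | no  i≮n | _       = ⊥-elim (i≮n (toℕ<n i))
    ... | yes _   | no  c≮d = ⊥-elim (c≮d (toℕ<n c))

    ‖⊟‖² : ∀ i j → ‖ X i ⊟ X j ‖² ≡ euclid d xs (toℕ i) (toℕ j)
    ‖⊟‖² i j = sum-≡-∑ _ _ (λ c → cong (λ z → z * z) (sym (cong₂ (λ u v → u + - v) (xs-toℕ i c) (xs-toℕ j c))))

    -- The optimal centers are enumerated as o 0, …, o (k - 1), with junk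
    -- repetitions of 0 past ∣ Sᵒ ∣, and ν y is the number of the center of y.
    module _ {k} (0<n : 0 ℕ.< n) (Sᵒ : Subset n) (neᵒ : Nonempty Sᵒ) (small : ∣ Sᵒ ∣ ℕ.≤ k) where
      open QuasiMetric (euclidean d xs) using (q; q-sym)

      nearest : ∀ i → ∃[ j ] (j ∈ Sᵒ × min[ Sᵒ , neᵒ ] (λ j → ‖ X i ⊟ X j ‖²) ≡ ‖ X i ⊟ X j ‖²)
      nearest i = min-attained neᵒ (λ j → ‖ X i ⊟ X j ‖²)

      o ν : ℕ → ℕ
      o i = clamp n (nth Sᵒ i)
      ν = extend (λ i → proj₁ (rank (proj₁ (proj₂ (nearest i)))))

      o<n : ∀ {i} → i ℕ.< k → o i ℕ.< n
      o<n {i} _ = clamp-< (nth Sᵒ i) 0<n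

      ν<k : ∀ {y} → y ℕ.< n → ν y ℕ.< k
      ν<k {y} y<n = subst (λ y → ν y ℕ.< k) (toℕ-fromℕ< y<n)
        (subst (ℕ._< k) (sym (extend-toℕ _ (fromℕ< y<n)))
          (ℕₚ.<-≤-trans (proj₁ (proj₂ (rank (proj₁ (proj₂ (nearest (fromℕ< y<n))))))) small))

      open Clustering (euclidean d xs) n k 0<n o o<n ν ν<k public using (cost; 0≤cost; shrink)

      cost≤f : cost ≤ f X Sᵒ neᵒ
      cost≤f = ∑-≤-sum _ _ pointwise
        where
        pointwise : ∀ i → q (o (ν (toℕ i))) (toℕ i) ≤ min[ Sᵒ , neᵒ ] (λ j → ‖ X i ⊟ X j ‖²)
        pointwise i = let j , j∈S , min≡ = nearest i ; r , _ , nth≡ = rank j∈S in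
          ≤-reflexive (trans (cong (λ z → q z (toℕ i)) (trans (cong o (extend-toℕ _ i))
              (trans (clamp-≡ (subst (ℕ._< n) (sym nth≡) (toℕ<n j))) nth≡)))
            (trans (q-sym (toℕ j) (toℕ i)) (sym (trans min≡ (‖⊟‖² i j)))))

      seeded : 0 ℕ.< k → ∑ n (rounds n q (score n q A) (q 0) (k ℕ.* 3)) ≤ cost + # P * cost
      seeded 0<k = linarith (∑ n (rounds n q (score n q A) (q 0) (k ℕ.* 3)) ∷ cost ∷ [])
        -- 524289 is `1 + P - 7 A`.
        (λ s c → (1 , s ⊑ 7 ⋆ A ⋆ c) ∷ (524289 , 𝟎 ⊑ c) ∷ [] ⊢ 1 · s ⊑ c ∔ P ⋆ c) refl
        (SeedingPhase.seeding (euclidean d xs) n k (k ℕ.* 3) 0<n 0<k o o<n ν ν<k thrice , 0≤cost , tt)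
        where
        thrice : # (k ℕ.* 3) ≡ # k + # k + # k
        thrice = trans (#-* k 3) (solve 1 (λ k → k :* κ 3 := k :+ k :+ k) refl (# k))

  slack-θ : ∀ n d k xs ε .{{_ : NonZero k}} p m → slack n d k xs ε p m ≡ p * θ k ^ m
  slack-θ n d k xs ε p zero    = sym (*-identityʳ p)
  slack-θ n d k xs ε p (suc m) = trans (cong (λ s → s + - (s * k⁻¹ k)) (slack-θ n d k xs ε p m))
    (trans (cong (λ z → z + - (p * θ k ^ m * k⁻¹ k)) (sym (*-identityʳ _)))
      (solve 4 (λ p t u i → p :* t :* u :- p :* t :* i := p :* ((u :- i) :* t)) refl p (θ k ^ m) 1# (k⁻¹ k)))

  slack-step : ∀ n d k xs ε .{{_ : NonZero k}} p m → # k * slack n d k xs ε p (suc m) ≡ # k * slack n d k xs ε p m + - slack n d k xs ε p m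
  slack-step n d k xs ε p m = trans (solve 3 (λ k s i → k :* (s :- s :* i) := k :* s :- s :* (k :* i)) refl (# k) _ (k⁻¹ k))
    (cong (λ z → # k * s + - z) (trans (cong (s *_) (#⁻¹ k)) (*-identityʳ s)))
    where
    s : ℝ
    s = slack n d k xs ε p m

  module _ {n d} (k : ℕ) .{{_ : NonZero k}} (X : Fin n → Fin d → ℝ) (ε : ℝ) (0<n : 0 ℕ.< n)
    (Sᵒ : Subset n) (neᵒ : Nonempty Sᵒ) (small : ∣ Sᵒ ∣ ℕ.≤ k) where
    private
      q : ℕ → ℕ → ℝ
      q = euclid d (xs X ε)

      c₀ : ℝ
      c₀ = cost X ε 0<n Sᵒ neᵒ small

      s : ℕ → ℝ
      s = slack n d k (xs X ε) ε (# P)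

      E : ℕ → ℕ → ℝ
      E = rounds n q (score n q 1) (rounds n q (score n q A) (q 0) (k ℕ.* 3))

    descent : ∀ m → ∑ n (E m) ≤ c₀ + s m * c₀
    descent zero    = seeded X ε 0<n Sᵒ neᵒ small (ℕ.>-nonZero⁻¹ k)
    descent (suc m) = shrink X ε 0<n Sᵒ neᵒ small {p = s m} {p′ = s (suc m)} (ℕ.>-nonZero⁻¹ k) (descent m)
      (slack-step n d k (xs X ε) ε (# P) m)

    near-optimal : ∀ m → 0# < ε → s m ≤ ε → ∑ n (E m) ≤ (1# + ε) * f X Sᵒ neᵒ
    near-optimal m 0<ε s≤ε = ≤-trans (descent m) (≤-trans
      (≤-reflexive (trans (cong (_+ s m * c₀) (sym (*-identityˡ c₀))) (sym (distribʳ c₀ 1# (s m)))))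
      (≤-trans (*-monoˡ-≤ (0≤cost X ε 0<n Sᵒ neᵒ small) (≤-refl ⟨+⟩ s≤ε))
        (*-monoʳ-≤ (subst (_≤ 1# + ε) (+-identityʳ 0#) (0≤1 ⟨+⟩ proj₁ 0<ε)) (cost≤f X ε 0<n Sᵒ neᵒ small))))

    cover≤ : ∀ {j D τ} → (G : Good n d k (xs X ε) ε j D τ) → Σ[ ne ∈ Nonempty (output n τ) ] f X (output n τ) ne ≤ ∑ n D
    cover≤ {j} {D} {τ} G = ne , sum-≤-∑ _ _ pointwise
      where
      member : ∀ {c} (c<n : c ℕ.< n) → nats τ 1 c 0 ≢ 0 → fromℕ< c<n ∈ output n τ
      member {c} c<n mark-c = lookup⇒[]= (fromℕ< c<n) (output n τ) (trans (lookup∘tabulate _ (fromℕ< c<n))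
        (cong not (≢⇒≡ᵇ _ 0 (λ ≡0 → mark-c (trans (cong (λ z → nats τ 1 z 0) (sym (toℕ-fromℕ< c<n))) ≡0)))))
      ne : Nonempty (output n τ)
      ne = let c , c<n , mark-c , _ = Good.covered G 0 0<n in fromℕ< c<n , member c<n mark-c
      pointwise : ∀ i → min[ output n τ , ne ] (λ j → ‖ X i ⊟ X j ‖²) ≤ D (toℕ i)
      pointwise i = let c , c<n , mark-c , D≡ = Good.covered G (toℕ i) (toℕ<n i) in
        ≤-trans (min-≤ ne (λ j → ‖ X i ⊟ X j ‖²) (member c<n mark-c))
          (≤-reflexive (trans (‖⊟‖² X ε i (fromℕ< c<n)) (trans (cong (q (toℕ i)) (toℕ-fromℕ< c<n))
            (trans (QuasiMetric.q-sym (euclidean d (xs X ε)) (toℕ i) c) (sym D≡)))))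

  -- Arithmetic of the time and size bounds

  module _ (n d k : ℕ) .{{n≢0 : NonZero n}} .{{d≢0 : NonZero d}} .{{k≢0 : NonZero k}} (xs : ℕ → ℕ → ℝ) (ε : ℝ) where
    private
      V : ℕ
      V = n ℕ.* n ℕ.* d

      instance
        nd≢0 : NonZero (n ℕ.* d)
        nd≢0 = ℕₚ.m*n≢0 n d
        nn≢0 : NonZero (n ℕ.* n)
        nn≢0 = ℕₚ.m*n≢0 n n
        V≢0 : NonZero (n ℕ.* n ℕ.* d)
        V≢0 = ℕₚ.m*n≢0 (n ℕ.* n) d
        Vk≢0 : NonZero (n ℕ.* n ℕ.* d ℕ.* k)
        Vk≢0 = ℕₚ.m*n≢0 (n ℕ.* n ℕ.* d) k

      nest : ∀ {a} x y c → a ℕ.≤ x ℕ.* c → y ℕ.* a ℕ.≤ y ℕ.* x ℕ.* c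
      nest x y c a≤xc = ℕₚ.≤-trans (ℕₚ.*-monoʳ-≤ y a≤xc) (ℕₚ.≤-reflexive (sym (ℕₚ.*-assoc y x c)))

      addˡ : ∀ {a} x .{{_ : NonZero x}} b c → a ℕ.≤ x ℕ.* c → b ℕ.+ a ℕ.≤ x ℕ.* (b ℕ.+ c)
      addˡ x b c a≤xc = ℕₚ.≤-trans (ℕₚ.+-monoʳ-≤ b a≤xc) (absorbˡ b c x)

      addʳ : ∀ {a} x .{{_ : NonZero x}} b c → a ℕ.≤ x ℕ.* c → a ℕ.+ b ℕ.≤ x ℕ.* (c ℕ.+ b)
      addʳ x b c a≤xc = ℕₚ.≤-trans (ℕₚ.+-monoˡ-≤ b a≤xc) (absorbʳ b c x)

      add : ∀ {a b} x c e → a ℕ.≤ x ℕ.* c → b ℕ.≤ x ℕ.* e → a ℕ.+ b ℕ.≤ x ℕ.* (c ℕ.+ e)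
      add x c e a≤ b≤ = ℕₚ.≤-trans (ℕₚ.+-mono-≤ a≤ b≤) (ℕₚ.≤-reflexive (sym (ℕₚ.*-distribˡ-+ x c e)))

      nd : ℕ
      nd = n ℕ.* d

      grow : ∀ {a} c → a ℕ.≤ n ℕ.* d ℕ.* c → a ℕ.≤ V ℕ.* c
      grow c a≤ = ℕₚ.≤-trans a≤ (ℕₚ.*-monoˡ-≤ c (ℕₚ.*-monoˡ-≤ d (ℕₚ.m≤m*n n n)))

      square : ∀ {a} c → a ℕ.≤ n ℕ.* (n ℕ.* d) ℕ.* c → a ℕ.≤ V ℕ.* c
      square c a≤ = ℕₚ.≤-trans a≤ (ℕₚ.≤-reflexive (cong (ℕ._* c) (sym (ℕₚ.*-assoc n n d))))

    cost-distance-≤ : cost-distance n d k xs ε ℕ.≤ d ℕ.* 72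
    cost-distance-≤ = absorbˡ 17 55 d

    -- 194 for choosing and 126 for marking and refreshing, each the sum of the fixed costs met on
    -- the way into the nested loops.
    cost-round-≤ : cost-round n d k xs ε ℕ.≤ V ℕ.* 320
    cost-round-≤ = add V 194 126
      (addˡ V 4 190 (addˡ V 4 186 (addˡ V 13 173 (square 173 (nest nd n 173 (addˡ nd 17 156 (addˡ nd 4 152 (addʳ nd 20 132
        (addˡ nd 13 119 (nest d n 119 (addˡ d 17 102 (addʳ d 30 72 cost-distance-≤))))))))))))
      (addˡ V 6 120 (grow 120 (addˡ nd 13 107 (nest d n 107 (addˡ d 17 90 (addʳ d 18 72 cost-distance-≤))))))

    cost-prepare-≤ : cost-prepare n d k xs ε ℕ.≤ V ℕ.* 114
    cost-prepare-≤ = grow 114 (addˡ nd 4 110 (addˡ nd 13 97 (nest d n 97 (addˡ d 17 80 (addʳ d 8 72 cost-distance-≤)))))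

    cost-cluster-≤ : ∀ m → cost-cluster n d k xs ε m ℕ.≤ V ℕ.* k ℕ.* 1125 ℕ.+ V ℕ.* m ℕ.* 343
    cost-cluster-≤ m = begin
      cost-prepare n d k xs ε ℕ.+ (cost-seed n d k xs ε ℕ.+ (4 ℕ.+ (m ℕ.* cost-step n d k xs ε ℕ.+ 9)))
        ≤⟨ ℕₚ.+-mono-≤ prepare≤ (ℕₚ.+-mono-≤ seed≤ (ℕₚ.+-monoʳ-≤ 4 (ℕₚ.+-monoˡ-≤ 9 steps≤))) ⟩
      V ℕ.* k ℕ.* 114 ℕ.+ (V ℕ.* k ℕ.* 998 ℕ.+ (4 ℕ.+ (V ℕ.* m ℕ.* 343 ℕ.+ 9)))
        ≡⟨ ℕ-solve 2 (λ x y → x :*ℕ conℕ 114 :+ℕ (x :*ℕ conℕ 998 :+ℕ (conℕ 4 :+ℕ (y :+ℕ conℕ 9)))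
             :=ℕ conℕ 13 :+ℕ x :*ℕ conℕ 1112 :+ℕ y) refl (V ℕ.* k) (V ℕ.* m ℕ.* 343) ⟩
      13 ℕ.+ V ℕ.* k ℕ.* 1112 ℕ.+ V ℕ.* m ℕ.* 343
        ≤⟨ ℕₚ.+-monoˡ-≤ (V ℕ.* m ℕ.* 343) (absorbˡ 13 1112 (V ℕ.* k)) ⟩
      V ℕ.* k ℕ.* 1125 ℕ.+ V ℕ.* m ℕ.* 343 ∎
      where
      open ℕₚ.≤-Reasoning
      swap : ∀ y c → y ℕ.* V ℕ.* c ≡ V ℕ.* y ℕ.* c
      swap y c = cong (ℕ._* c) (ℕₚ.*-comm y V)
      prepare≤ : cost-prepare n d k xs ε ℕ.≤ V ℕ.* k ℕ.* 114
      prepare≤ = ℕₚ.≤-trans cost-prepare-≤ (ℕₚ.*-monoˡ-≤ 114 (ℕₚ.m≤m*n V k))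
      seed≤ : cost-seed n d k xs ε ℕ.≤ V ℕ.* k ℕ.* 998
      seed≤ = addˡ (V ℕ.* k) 13 985 (ℕₚ.≤-trans
        (nest V k 985 (addˡ V 17 968 (addˡ V 8 960 (add V 320 640 cost-round-≤ (add V 320 320 cost-round-≤ cost-round-≤)))))
        (ℕₚ.≤-reflexive (swap k 985)))
      steps≤ : m ℕ.* cost-step n d k xs ε ℕ.≤ V ℕ.* m ℕ.* 343
      steps≤ = ℕₚ.≤-trans (nest V m 343 (addˡ V 9 334 (addʳ V 14 320 cost-round-≤))) (ℕₚ.≤-reflexive (swap m 343))

  -- `decay-steps` applies to the round before the last, with `P = 2²²` accounting for the 22; the
  -- last round adds 1.
  rounds-≤ : ∀ n d k xs .{{_ : NonZero k}} {ε ℓ} → 0# < ε → IsLog (ε ⁻¹) ℓ → ∀ m →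
    (∀ i → suc i ≡ m → ε < slack n d k xs ε (# P) i) → # m ≤ 1# + (# (k ℕ.* 22) + # k * (0# ⊔ ℓ))
  rounds-≤ n d k xs {ε} {ℓ} 0<ε isLog zero    before = subst₂ _≤_ (trans (cong (0# +_) (+-identityʳ 0#)) (trans (+-identityʳ 0#) (sym #0))) refl
    (0≤1 ⟨+⟩ (0≤# (k ℕ.* 22) ⟨+⟩ *-nonneg (0≤# k) (x≤x⊔y 0# ℓ)))
  rounds-≤ n d k xs {ε} {ℓ} 0<ε isLog (suc i) before = subst (_≤ 1# + (# (k ℕ.* 22) + # k * (0# ⊔ ℓ))) (sym (#-suc i))
    (≤-refl ⟨+⟩ decay-steps k 22 0<ε isLog i (subst (ε <_) (slack-θ n d k xs ε (# P) i) (before i refl)))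

  -- A round number above both requirements: `1125 + 343 * 24 = 9357` for the time and
  -- `2 + 22 + 3 = 27` for the size.
  C : ℕ
  C = 10000

  time-≤ : ∀ V k m .{{_ : NonZero k}} {μ} → 1# ≤ μ → # m ≤ # 24 * (# k * μ) →
    # (V ℕ.* k ℕ.* 1125 ℕ.+ V ℕ.* m ℕ.* 343) ≤ # (C ℕ.* (V ℕ.* k)) * μ
  time-≤ V k m {μ} 1≤μ m≤ = subst₂ _≤_
    (sym (trans (#-+ (V ℕ.* k ℕ.* 1125) (V ℕ.* m ℕ.* 343)) (cong₂ _+_
      (trans (#-* (V ℕ.* k) 1125) (*-comm _ _)) (trans (#-* (V ℕ.* m) 343) (trans (*-comm _ _) (cong (# 343 *_) (#-* V m)))))))
    (sym (trans (cong (_* μ) (#-* C (V ℕ.* k))) (*-assoc _ _ _)))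
    (linarith (# (V ℕ.* k) ∷ # V * # m ∷ # (V ℕ.* k) * μ ∷ # V * (# 24 * (# k * μ)) ∷ [])
      (λ a b c e → (1125 , a ⊑ c) ∷ (343 , b ⊑ e) ∷ (343 , e ⊑ 24 ⋆ c) ∷ (643 , 𝟎 ⊑ c) ∷ [] ⊢ 1 · 1125 ⋆ a ∔ 343 ⋆ b ⊑ C ⋆ c) refl
      ( Vk≤ , *-monoʳ-≤ (0≤# V) m≤
      , ≤-reflexive (trans (solve 4 (λ v t k μ → v :* (t :* (k :* μ)) := t :* (v :* k :* μ)) refl (# V) (# 24) (# k) μ)
          (cong (λ z → # 24 * (z * μ)) (sym (#-* V k))))
      , *-nonneg (0≤# (V ℕ.* k)) (≤-trans 0≤1 1≤μ) , tt))
    where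
    Vk≤ : # (V ℕ.* k) ≤ # (V ℕ.* k) * μ
    Vk≤ = subst (_≤ # (V ℕ.* k) * μ) (*-identityʳ _) (*-monoʳ-≤ (0≤# (V ℕ.* k)) 1≤μ)

  m-≤ : ∀ k m .{{_ : NonZero k}} {ℓ} → # m ≤ 1# + (# (k ℕ.* 22) + # k * (0# ⊔ ℓ)) → # m ≤ # 24 * (# k * (1# ⊔ ℓ))
  m-≤ k m {ℓ} m≤ = linarith (# m ∷ 1# ∷ # (k ℕ.* 22) ∷ # k * (0# ⊔ ℓ) ∷ # k ∷ # k * (1# ⊔ ℓ) ∷ [])
    (λ m u a b k c → (1 , m ⊑ u ∔ (a ∔ b)) ∷ (1 , u ⊑ k) ∷ (1 , a ⊑ 22 ⋆ k) ∷ (1 , b ⊑ c) ∷ (23 , k ⊑ c) ∷ [] ⊢ 1 · m ⊑ 24 ⋆ c) refl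
    ( m≤ , subst (_≤ # k) #1 (#-mono (ℕ.>-nonZero⁻¹ k)) , ≤-reflexive (trans (#-* k 22) (*-comm _ _))
    , *-monoʳ-≤ (0≤# k) (⊔-lub (≤-trans 0≤1 (x≤x⊔y 1# ℓ)) (x≤y⊔x 1# ℓ))
    , subst (_≤ # k * (1# ⊔ ℓ)) (*-identityʳ _) (*-monoʳ-≤ (0≤# k) (x≤x⊔y 1# ℓ)) , tt)

  size-≤ : ∀ k m .{{_ : NonZero k}} {ℓ} → # m ≤ 1# + (# (k ℕ.* 22) + # k * (0# ⊔ ℓ)) →
    # (m ℕ.+ suc (k ℕ.* 3)) ≤ # (C ℕ.* k) + # k * (0# ⊔ ℓ)
  size-≤ k m {ℓ} m≤ = subst₂ _≤_
    (sym (trans (#-+ m (suc (k ℕ.* 3))) (cong (# m +_) (#-suc (k ℕ.* 3)))))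
    (cong (_+ # k * (0# ⊔ ℓ)) (sym (#-* C k)))
    (linarith (# m ∷ 1# ∷ # (k ℕ.* 22) ∷ # (k ℕ.* 3) ∷ # k * (0# ⊔ ℓ) ∷ # k ∷ [])
      (λ m u a a′ b k → (1 , m ⊑ u ∔ (a ∔ b)) ∷ (2 , u ⊑ k) ∷ (1 , a ⊑ 22 ⋆ k) ∷ (1 , a′ ⊑ 3 ⋆ k) ∷ (9973 , 𝟎 ⊑ k) ∷ []
        ⊢ 1 · m ∔ (u ∔ a′) ⊑ C ⋆ k ∔ b) refl
      ( m≤ , subst (_≤ # k) #1 (#-mono (ℕ.>-nonZero⁻¹ k)) , ≤-reflexive (trans (#-* k 22) (*-comm _ _))
      , ≤-reflexive (trans (#-* k 3) (*-comm _ _)) , 0≤# k , tt))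

  loaded-input : ∀ {n d} (X : Fin n → Fin d → ℝ) k ε → Loaded n d k (xs X ε) ε (input X k ε)
  loaded-input X k ε = record { size-n = refl ; size-d = refl ; size-k = refl ; coords = λ _ _ → refl ; epsilon = refl }

  cluster-correct : ∀ (n d k : ℕ) .{{_ : NonZero n}} .{{_ : NonZero d}} .{{_ : NonZero k}} →
    (X : Fin n → Fin d → ℝ) (Sᵒ : Subset n) (neᵒ : Nonempty Sᵒ) → ∣ Sᵒ ∣ ℕ.≤ k →
    (ε : ℝ) → 0# < ε → (ℓ : ℝ) → IsLog (ε ⁻¹) ℓ →
    ∃[ τ ] ∃[ t ] (⟨ cluster A P , input X k ε ⟩⇓⟨ τ , t ⟩
      × fromℕ t ≤ fromℕ (C ℕ.* (n ℕ.* n ℕ.* d ℕ.* k)) * (1# ⊔ ℓ)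
      × Σ[ ne ∈ Nonempty (output n τ) ]
          (fromℕ ∣ output n τ ∣ ≤ fromℕ (C ℕ.* k) + fromℕ k * (0# ⊔ ℓ)
          × f X (output n τ) ne ≤ (1# + ε) * f X Sᵒ neᵒ))
  cluster-correct n d k X Sᵒ neᵒ small ε 0<ε ℓ isLog =
    let M , stop = decay-stops k 22 0<ε isLog
        m , r , before = run-cluster n d k (xs X ε) ε {M = M} A P 0<n (loaded-input X k ε) refl (λ { zero → refl ; (suc _) → refl }) refl
          (subst (_≤ ε) (sym (slack-θ n d k (xs X ε) ε (# P) M)) (≤-by-contra stop))
        good , s≤ε = post r
        ne , f≤ = cover≤ k X ε 0<n Sᵒ neᵒ small good
        m≤ = rounds-≤ n d k (xs X ε) 0<ε isLog m before
    in final r , steps r , halts r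
      , subst₂ (λ a b → a ≤ b * (1# ⊔ ℓ)) (#≡fromℕ (steps r)) (#≡fromℕ (C ℕ.* (n ℕ.* n ℕ.* d ℕ.* k)))
          (≤-trans (#-mono (ℕₚ.≤-trans (bound r) (cost-cluster-≤ n d k (xs X ε) ε m)))
            (time-≤ (n ℕ.* n ℕ.* d) k m (x≤x⊔y 1# ℓ) (m-≤ k m m≤)))
      , ne
      , subst₂ _≤_ (#≡fromℕ ∣ output n (final r) ∣) (cong₂ (λ a b → a + b * (0# ⊔ ℓ)) (#≡fromℕ (C ℕ.* k)) (#≡fromℕ k))
          (≤-trans (#-mono (Good.few good)) (size-≤ k m m≤))
      , ≤-trans f≤ (near-optimal k X ε 0<n Sᵒ neᵒ small m 0<ε s≤ε)
    where
    0<n : 0 ℕ.< n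
    0<n = ℕ.>-nonZero⁻¹ n
    ≤-by-contra : ∀ {a b} → ¬ (a < b) → b ≤ a
    ≤-by-contra {a} {b} h = by-cases (b ≤ a) id (λ b≰a → ⊥-elim (h (≰⇒> b≰a)))

lemma2 : (R : Reals) → let open KMeans R in
    ∃[ P ] ∃[ C ] (∀ (n d k : ℕ) .{{_ : NonZero n}} .{{_ : NonZero d}} .{{_ : NonZero k}} →
    (X : Fin n → Fin d → ℝ) → Distinct X →
    (Sᵒ : Subset n) (neᵒ : Nonempty Sᵒ) → IsOptimal X k Sᵒ neᵒ →
    (ε : ℝ) → 0# < ε → (ℓ : ℝ) → IsLog (ε ⁻¹) ℓ →
    ∃[ τ ] ∃[ t ] (⟨ P , input X k ε ⟩⇓⟨ τ , t ⟩
    × fromℕ t ≤ fromℕ (C ℕ.* (n ℕ.* n ℕ.* d ℕ.* k)) * (1# ⊔ ℓ)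
    × Σ[ ne ∈ Nonempty (output n τ) ]
    (fromℕ ∣ output n τ ∣ ≤ fromℕ (C ℕ.* k) + fromℕ k * (0# ⊔ ℓ)
    × f X (output n τ) ne ≤ (1# + ε) * f X Sᵒ neᵒ)))
lemma2 R = cluster A P , C , λ n d k X _ Sᵒ neᵒ (small , _) ε 0<ε ℓ isLog →
    cluster-correct n d k X Sᵒ neᵒ small ε 0<ε ℓ isLog
  where
  open Greedy R using (A)
  open Clusterer R using (cluster)
  open Assembly R
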